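{- Let $q$ be an odd prime power, $m\ge1$, and let $G=\operatorname{O}^{\epsilon}(m,q)$ be the isometry group of a nondegenerate quadratic form on $V=\mathbb{F}_q^m$ with associated nondegenerate symmetric bilinear form $B$. Let $C$ be a conjugacy class of $G$ with representative $g$, and let $o(C)$ be the number of orbits of $C_G(g)$ on $V/[g,V]$, where $[g,V]=(I-g)V$. Let $V_1=\ker(g-I)^{m}$ (on which $B$ is nondegenerate and $g$ is unipotent) and let $a_i$ be the number of Jordan blocks of size $i$ of $g$ on $V_1$. Write $V_1$ as a $B$-orthogonal direct sum of $g$-invariant subspaces $W_i$ such that $g|_{W_i}$ has exactly $a_i$ Jordan blocks, all of size $i$. For odd $i$, the form $(x,y)\mapsto B(x,(g-I)^{i-1}y)$ induces a nondegenerate symmetric bilinear form on $W_i/(g-I)W_i$; when $a_i=2$, say the sign attached to $i$ is $+$ if this $2$-dimensional form is isotropic (hyperbolic) and $-$ otherwise. Then \[ o(C)=1+\#\{i\text{ even}: a_i\ne0\}+\sum_{i\text{ odd},\,a_i\ne0} f_i, \] where $f_i=q$ if $a_i>2$; $f_i=q$ if $a_i=2$ and the sign is $+$; $f_i=q-1$ if $a_i=2$ and the sign is $-$; and $f_i=(q-1)/2$ if $a_i=1$.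
   Context: $o(C)$ depends only on the class $C$. The signs are those of the standard parametrization of unipotent classes of orthogonal groups in odd characteristic by signed partitions (a sign for each odd part size); the isometry type of the form described does not depend on the chosen decomposition. -}

module Defs where

open import Level using (0ℓ)
open import Data.Nat as ℕ using (ℕ; zero; suc; _≡ᵇ_; _%_; _∸_; _^_)
open import Data.Nat.Primality using (Prime)
open import Data.Bool using (Bool; true; false; if_then_else_; _∧_; not)
open import Data.Fin using (Fin; toℕ) renaming (zero to fzero; suc to fsuc)
open import Data.List using (List; length)
open import Data.List.Membership.Propositional using (_∈_)
open import Data.List.Relation.Unary.Any using (Any)
open import Data.List.Relation.Unary.AllPairs using (AllPairs)
open import Data.List.Relation.Unary.Unique.Propositional using (Unique)
open import Data.Product using (Σ; ∃; _×_; _,_)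
open import Relation.Binary.PropositionalEquality using (_≡_; _≢_)
open import Relation.Nullary using (¬_; Dec)
open import Algebra.Structures using (IsCommutativeRing)

record FiniteField : Set₁ where
  field
    Carrier : Set
    _+_ _*_ : Carrier → Carrier → Carrier
    -_      : Carrier → Carrier
    0# 1#   : Carrier
    isCommutativeRing : IsCommutativeRing _≡_ _+_ _*_ -_ 0# 1#
    0≢1     : 0# ≢ 1#
    inverse : ∀ x → x ≢ 0# → ∃ λ y → x * y ≡ 1#
    _≟_     : (x y : Carrier) → Dec (x ≡ y)
    elements : List Carrier
    complete : ∀ x → x ∈ elements
    unique   : Unique elements

  order : ℕ
  order = length elements

IsOddPrimePower : ℕ → Set
IsOddPrimePower q = Σ ℕ λ p → Σ ℕ λ k → Prime p × (q ≡ p ^ suc k) × (q % 2 ≡ 1)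

sumTo : (ℕ → ℕ) → ℕ → ℕ
sumTo f zero    = 0
sumTo f (suc m) = sumTo f m ℕ.+ f (suc m)

isEven isOdd : ℕ → Bool
isEven i = i % 2 ≡ᵇ 0
isOdd  i = i % 2 ≡ᵇ 1

nonzero : ℕ → Bool
nonzero n = not (n ≡ᵇ 0)

evenCount : (ℕ → ℕ) → ℕ → ℕ
evenCount a = sumTo (λ i → if isEven i ∧ nonzero (a i) then 1 else 0)

oddSum : (ℕ → ℕ) → (ℕ → ℕ) → ℕ → ℕ
oddSum a f = sumTo (λ i → if isOdd i ∧ nonzero (a i) then f i else 0)

module LinAlg (𝔽 : FiniteField) (m : ℕ) where
  open FiniteField 𝔽

  F : Set
  F = Carrier

  Σ[_] : (n : ℕ) → (Fin n → F) → F
  Σ[ zero  ] f = 0#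
  Σ[ suc n ] f = f fzero + Σ[ n ] (λ i → f (fsuc i))

  V : Set
  V = Fin m → F

  _≈_ : V → V → Set
  u ≈ v = ∀ i → u i ≡ v i

  0V : V
  0V _ = 0#

  _⊕_ : V → V → V
  (u ⊕ v) i = u i + v i

  _⊖_ : V → V → V
  (u ⊖ v) i = u i + (- v i)

  _•_ : F → V → V
  (c • v) i = c * v i

  ΣV[_] : (n : ℕ) → (Fin n → V) → V
  ΣV[ n ] f i = Σ[ n ] (λ k → f k i)

  Mat : Set
  Mat = Fin m → Fin m → F

  _·_ : Mat → V → V
  (A · v) i = Σ[ m ] (λ j → A i j * v j)

  QForm : Set
  QForm = Mat

  Qv : QForm → V → F
  Qv c v = Σ[ m ] (λ i → Σ[ m ] (λ j → c i j * (v i * v j)))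

  Bf : QForm → V → V → F
  Bf c x y = Qv c (x ⊕ y) + (- (Qv c x + Qv c y))

  Nondegenerate : QForm → Set
  Nondegenerate c = ∀ u → (∀ v → Bf c u v ≡ 0#) → u ≈ 0V

  Invertible : Mat → Set
  Invertible g = ∃ λ h → (∀ v → (h · (g · v)) ≈ v) × (∀ v → (g · (h · v)) ≈ v)

  InO : QForm → Mat → Set
  InO c g = Invertible g × (∀ v → Qv c (g · v) ≡ Qv c v)

  InCentralizer : QForm → Mat → Mat → Set
  InCentralizer c g h = InO c h × (∀ v → (h · (g · v)) ≈ (g · (h · v)))

  Nop : Mat → V → V
  Nop g v = (g · v) ⊖ v

  Npow : Mat → ℕ → V → V
  Npow g zero    v = v
  Npow g (suc k) v = Nop g (Npow g k v)

  InCommutator : Mat → V → Set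
  InCommutator g w = ∃ λ v → w ≈ (v ⊖ (g · v))

  SameOrbit : QForm → Mat → V → V → Set
  SameOrbit c g x y = ∃ λ h → InCentralizer c g h × InCommutator g ((h · x) ⊖ y)

  OrbitCount : QForm → Mat → ℕ → Set
  OrbitCount c g n = ∃ λ (reps : List V) →
    (length reps ≡ n)
    × AllPairs (λ x y → ¬ SameOrbit c g x y) reps
    × (∀ x → Any (λ r → SameOrbit c g x r) reps)

  InV₁ : Mat → V → Set
  InV₁ g v = Npow g m v ≈ 0V

  Subspace : Set₁
  Subspace = V → Set

  IsSubspace : Subspace → Set
  IsSubspace W = (∀ u v → u ≈ v → W u → W v)
               × W 0V
               × (∀ u v → W u → W v → W (u ⊕ v))
               × (∀ a u → W u → W (a • u))

  Invariant : Mat → Subspace → Set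
  Invariant g W = ∀ u → W u → W (g · u)

  -- g|_W has exactly a Jordan blocks, all of size i:
  -- W has a basis { N^k x_j | j < a , k < i } with N^i x_j = 0
  JordanType : Mat → Subspace → (a i : ℕ) → Set
  JordanType g W a i = ∃ λ (x : Fin a → V) →
    (∀ j → W (x j))
    × (∀ j → Npow g i (x j) ≈ 0V)
    × (∀ (c : Fin a → Fin i → F) →
         ΣV[ a ] (λ j → ΣV[ i ] (λ k → c j k • Npow g (toℕ k) (x j))) ≈ 0V →
         ∀ j k → c j k ≡ 0#)
    × (∀ w → W w → ∃ λ (c : Fin a → Fin i → F) →
         w ≈ ΣV[ a ] (λ j → ΣV[ i ] (λ k → c j k • Npow g (toℕ k) (x j))))

  -- block size attached to an index k : Fin m is i = k + 1 ∈ [1,m]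
  sz : Fin m → ℕ
  sz k = suc (toℕ k)

  OrthJordanDecomp : QForm → Mat → (ℕ → Subspace) → (ℕ → ℕ) → Set
  OrthJordanDecomp c g W a =
    (∀ k → IsSubspace (W (sz k)))
    × (∀ k → Invariant g (W (sz k)))
    × (∀ k → JordanType g (W (sz k)) (a (sz k)) (sz k))
    × (∀ k l → toℕ k ≢ toℕ l → ∀ u v → W (sz k) u → W (sz l) v → Bf c u v ≡ 0#)
    × (∀ k u → W (sz k) u → InV₁ g u)
    × (∀ v → InV₁ g v → ∃ λ (w : Fin m → V) → (∀ k → W (sz k) (w k)) × v ≈ ΣV[ m ] w)
    × (∀ (w : Fin m → V) → (∀ k → W (sz k) (w k)) → ΣV[ m ] w ≈ 0V → ∀ k → w k ≈ 0V)

  InNImage : Mat → Subspace → V → Set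
  InNImage g W v = ∃ λ w → W w × v ≈ Nop g w

  -- the form (x,y) ↦ B(x, N^{i-1} y) on W/NW is isotropic (sign +)
  SignPlus : QForm → Mat → Subspace → ℕ → Set
  SignPlus c g W i = ∃ λ x → W x × ¬ InNImage g W x × Bf c x (Npow g (i ∸ 1) x) ≡ 0#

  FSpec : QForm → Mat → Subspace → (aᵢ i fᵢ : ℕ) → Set
  FSpec c g W aᵢ i fᵢ =
      (2 ℕ.< aᵢ → fᵢ ≡ order)
    × (aᵢ ≡ 2 → SignPlus c g W i → fᵢ ≡ order)
    × (aᵢ ≡ 2 → ¬ SignPlus c g W i → fᵢ ≡ order ∸ 1)
    × (aᵢ ≡ 1 → fᵢ ≡ (order ∸ 1) ℕ./ 2)

module Submission where

open import Defs
open import Algebra.Bundles using (CommutativeRing; RawRing)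
import Algebra.Properties.AbelianGroup as AbelianGroupProperties
import Algebra.Properties.Ring as RingProperties
import Algebra.Properties.Semiring.Mult.TCOptimised as Multiples
import Algebra.Solver.Ring as RingSolver
open import Algebra.Solver.Ring.AlmostCommutativeRing using (AlmostCommutativeRing; fromCommutativeRing; _-Raw-AlmostCommutative⟶_; Induced-equivalence)
open import Data.Bool using (true; false; if_then_else_; _∧_)
open import Data.Empty using (⊥; ⊥-elim)
open import Data.Fin using (Fin; toℕ; fromℕ; fromℕ<) renaming (zero to fzero; suc to fsuc)
import Data.Fin.Properties as Finₚ
open import Data.Integer as ℤ using (ℤ; -[1+_]) renaming (+_ to pos)
import Data.Integer.Properties as ℤₚ
open import Data.List using (List; []; _∷_; length; map; filter; _++_)
import Data.List.Properties as Listₚ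
open import Data.List.Membership.Propositional using (_∈_; _∉_; find; lose)
open import Data.List.Membership.Propositional.Properties using (∈-filter⁺; ∈-filter⁻; ∈-map⁺; ∈-map⁻; ∈-++⁺ˡ; ∈-++⁺ʳ; ∈-++⁻)
open import Data.List.Relation.Unary.All as All using (All; []; _∷_)
import Data.List.Relation.Unary.All.Properties as Allₚ
open import Data.List.Relation.Unary.AllPairs using (AllPairs; []; _∷_)
open import Data.List.Relation.Unary.Any as Any using (Any; here; there; any?)
open import Data.List.Relation.Unary.Unique.Propositional using (Unique)
import Data.List.Relation.Unary.Unique.Propositional.Properties as Uniqueₚ
open import Data.Maybe using (just; nothing)
open import Data.Nat as ℕ using (ℕ; zero; suc)
open import Data.Nat.DivMod using (m*n%n≡0; m*n/n≡m)
import Data.Nat.Properties as ℕₚ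
open import Data.Product using (∃; _×_; _,_; proj₁; proj₂)
open import Data.Sum using (_⊎_; inj₁; inj₂)
open import Function using (_∘_)
open import Relation.Binary.Bundles using (Setoid)
open import Relation.Binary.Definitions using (DecidableEquality; WeaklyDecidable; tri<; tri≈; tri>)
open import Relation.Binary.PropositionalEquality using (_≡_; _≢_; refl; sym; trans; cong; cong₂; subst; module ≡-Reasoning)
import Relation.Binary.Reasoning.Setoid as SetoidReasoning
open import Relation.Nullary using (¬_; Dec; yes; no)
open import Relation.Nullary.Decidable using (¬?; _×-dec_)

-- Write N = g - 1. The orbit of x modulo N V is determined by the least i with
-- x ∈ ker Nⁱ + N V together with, for x ≡ u mod N V and Nⁱ u = 0, the value B(u, N^(i-1) u). This form on
-- ker Nⁱ is symmetric for odd i and alternating for even i, and the largest block size with a nonzero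
-- coordinate of x computes both invariants. Conversely, vectors u, u′ of ker Nⁱ with equal invariants
-- are joined modulo N V by isometries commuting with g: for odd i reflections in the nondegenerate
-- cyclic submodule generated by v = u - u′, for even i Cayley transforms lifting symplectic
-- transvections along v. Both are built from the operator x ↦ Σ_{a+b=i-1} B(N^a x, v) N^b v, which
-- commutes with g because Nⁱ v = 0. The count is then that of the values of nondegenerate
-- quadratic forms over the field at nonzero vectors.

-- The difficulty is lifting: the wanted motion is prescribed only modulo N V, while an element of
-- the centralizer must preserve B on all of V and commute with g exactly. The adjoint of N is g⁻¹ -
-- 1 = - g⁻¹ N rather than - N, so the sum operator is in general neither symmetric nor skew. Adding
-- its adjoint with the sign (-1)^(i-1) repairs this, and for v in ker Nⁱ both summands have the
-- same leading coefficient along v. The result still acts as intended only up to N times the cyclic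
-- submodule of v; these errors are nilpotent, and a high power (odd i) or the Cayley transform
-- (even i) absorbs them. A single isometry along u - u′ is available only if B(u, N^(i-1) u)
-- differs from B(u, N^(i-1) u′). If the two agree and are nonzero, the target is first replaced by
-- - u′; if both vanish, the route passes through a third vector of value zero that pairs
-- nontrivially with u and with u′. The part of V on which g has no eigenvalue 1 lies in N V and
-- gives no further orbits. The given W_i enter when the invariants are computed and counted.

CharacteristicNot2 : FiniteField → Set
CharacteristicNot2 𝔽 = (1# + 1#) ≢ 0#
  where open FiniteField 𝔽

-- Polynomial identities over the field, solved with integer coefficients.

module FieldArithmetic (𝔽 : FiniteField) where
  open FiniteField 𝔽 public
    renaming (_+_ to infixl 6 _+_; _*_ to infixl 7 _*_; -_ to infix 8 -_; _≟_ to infix 4 _≟_)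

  commutativeRing : CommutativeRing _ _
  commutativeRing = record { isCommutativeRing = isCommutativeRing }

  private
    module R = CommutativeRing commutativeRing
    module RP = RingProperties R.ring
    module GP = AbelianGroupProperties R.+-abelianGroup
    module M = Multiples R.semiring
    open ≡-Reasoning

    -- The canonical homomorphism from the integers. Integer coefficients have an equality test that
    -- computes, so the solver can normalise and finish with `refl`. The chosen multiples make
    -- `pos 1` evaluate to `1#` itself.
    ⟦_⟧ : ℤ → Carrier
    ⟦ pos n ⟧      = n M.× 1#
    ⟦ -[1+ n ] ⟧ = - (suc n M.× 1#)

    ⟦-⟧ : ∀ i → ⟦ ℤ.- i ⟧ ≡ - ⟦ i ⟧
    ⟦-⟧ (pos zero)   = sym GP.ε⁻¹≈ε
    ⟦-⟧ (pos (suc n))  = refl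
    ⟦-⟧ -[1+ n ]   = sym (GP.⁻¹-involutive _)

    ⟦⊖⟧ : ∀ m n → ⟦ m ℤ.⊖ n ⟧ ≡ m M.× 1# + - (n M.× 1#)
    ⟦⊖⟧ m zero = trans (cong ⟦_⟧ (ℤₚ.⊖-≥ {m} {0} ℕ.z≤n))
      (sym (trans (cong ((m M.× 1#) +_) GP.ε⁻¹≈ε) (R.+-identityʳ _)))
    ⟦⊖⟧ zero (suc n) = trans (cong ⟦_⟧ (ℤₚ.⊖-≤ {0} {suc n} ℕ.z≤n)) (sym (R.+-identityˡ _))
    ⟦⊖⟧ (suc m) (suc n) = begin
      ⟦ suc m ℤ.⊖ suc n ⟧                          ≡⟨ cong ⟦_⟧ (ℤₚ.[1+m]⊖[1+n]≡m⊖n m n) ⟩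
      ⟦ m ℤ.⊖ n ⟧                                  ≡⟨ ⟦⊖⟧ m n ⟩
      m M.× 1# + - (n M.× 1#)                      ≡⟨ cong (_+ _) (sym (GP.xyx⁻¹≈y 1# _)) ⟩
      1# + m M.× 1# + - 1# + - (n M.× 1#)          ≡⟨ R.+-assoc _ _ _ ⟩
      1# + m M.× 1# + (- 1# + - (n M.× 1#))        ≡⟨ cong₂ _+_ (sym (M.1+× m 1#)) (GP.⁻¹-∙-comm _ _) ⟩
      suc m M.× 1# + - (1# + n M.× 1#)             ≡⟨ cong (λ z → _ + - z) (sym (M.1+× n 1#)) ⟩
      suc m M.× 1# + - (suc n M.× 1#)              ∎

    ⟦+⟧ : ∀ i j → ⟦ i ℤ.+ j ⟧ ≡ ⟦ i ⟧ + ⟦ j ⟧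
    ⟦+⟧ (pos m) (pos n) = M.×-homo-+ 1# m n
    ⟦+⟧ (pos m) -[1+ n ] = ⟦⊖⟧ m (suc n)
    ⟦+⟧ -[1+ m ] (pos n) = trans (⟦⊖⟧ n (suc m)) (R.+-comm _ _)
    ⟦+⟧ -[1+ m ] -[1+ n ] = begin
      - (suc (suc (m ℕ.+ n)) M.× 1#)          ≡⟨ cong (λ k → - (suc k M.× 1#)) (sym (ℕₚ.+-suc m n)) ⟩
      - ((suc m ℕ.+ suc n) M.× 1#)            ≡⟨ cong -_ (M.×-homo-+ 1# (suc m) (suc n)) ⟩
      - (suc m M.× 1# + suc n M.× 1#)         ≡⟨ sym (GP.⁻¹-∙-comm _ _) ⟩
      - (suc m M.× 1#) + - (suc n M.× 1#)     ∎

    ⟦*⟧⁺ : ∀ m j → ⟦ pos m ℤ.* j ⟧ ≡ ⟦ pos m ⟧ * ⟦ j ⟧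
    ⟦*⟧⁺ m (pos n) = trans (cong ⟦_⟧ (sym (ℤₚ.pos-* m n))) (M.×1-homo-* m n)
    ⟦*⟧⁺ m -[1+ n ] = begin
      ⟦ pos m ℤ.* -[1+ n ] ⟧             ≡⟨ cong ⟦_⟧ (sym (ℤₚ.neg-distribʳ-* (pos m) (pos (suc n)))) ⟩
      ⟦ ℤ.- (pos m ℤ.* pos (suc n)) ⟧    ≡⟨ ⟦-⟧ (pos m ℤ.* pos (suc n)) ⟩
      - ⟦ pos m ℤ.* pos (suc n) ⟧        ≡⟨ cong -_ (⟦*⟧⁺ m (pos (suc n))) ⟩
      - (⟦ pos m ⟧ * ⟦ pos (suc n) ⟧)    ≡⟨ RP.-‿distribʳ-* _ _ ⟩
      ⟦ pos m ⟧ * ⟦ -[1+ n ] ⟧           ∎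

    ⟦*⟧ : ∀ i j → ⟦ i ℤ.* j ⟧ ≡ ⟦ i ⟧ * ⟦ j ⟧
    ⟦*⟧ (pos m) j = ⟦*⟧⁺ m j
    ⟦*⟧ -[1+ m ] j = begin
      ⟦ -[1+ m ] ℤ.* j ⟧               ≡⟨ cong ⟦_⟧ (sym (ℤₚ.neg-distribˡ-* (pos (suc m)) j)) ⟩
      ⟦ ℤ.- (pos (suc m) ℤ.* j) ⟧      ≡⟨ ⟦-⟧ (pos (suc m) ℤ.* j) ⟩
      - ⟦ pos (suc m) ℤ.* j ⟧          ≡⟨ cong -_ (⟦*⟧⁺ (suc m) j) ⟩
      - (⟦ pos (suc m) ⟧ * ⟦ j ⟧)      ≡⟨ RP.-‿distribˡ-* _ _ ⟩
      ⟦ -[1+ m ] ⟧ * ⟦ j ⟧             ∎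

    ℤ-raw : RawRing _ _
    ℤ-raw = CommutativeRing.rawRing ℤₚ.+-*-commutativeRing

    almost : AlmostCommutativeRing _ _
    almost = fromCommutativeRing commutativeRing

    ℤ⟶F : ℤ-raw -Raw-AlmostCommutative⟶ almost
    ℤ⟶F = record { ⟦_⟧ = ⟦_⟧ ; +-homo = ⟦+⟧ ; *-homo = ⟦*⟧ ; -‿homo = ⟦-⟧ ; 0-homo = refl ; 1-homo = refl }

    equalCoefficients : WeaklyDecidable (Induced-equivalence ℤ⟶F)
    equalCoefficients i j with i ℤ.≟ j
    ... | yes i≡j = just (cong ⟦_⟧ i≡j)
    ... | no  _   = nothing

  module Solver = RingSolver ℤ-raw almost ℤ⟶F equalCoefficients
  open Solver public using (solve; _:+_; _:*_; :-_; _:=_; con)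

  :0 :1 : ∀ {n} → Solver.Polynomial n
  :0 = con (pos 0)
  :1 = con (pos 1)

-- Finite sums, linear operators and underdetermined linear systems.

module LinearAlgebra (𝔽 : FiniteField) (m : ℕ) where
  open FieldArithmetic 𝔽 public
  open LinAlg 𝔽 m public
    renaming (_⊕_ to infixl 6 _⊕_; _⊖_ to infixl 6 _⊖_; _•_ to infixr 7 _•_; _≈_ to infix 4 _≈_; _·_ to infixr 8 _·_)

  two : F
  two = 1# + 1#

  infix 9 _⁻¹[_]
  _⁻¹[_] : ∀ x → x ≢ 0# → F
  x ⁻¹[ x≢0 ] = proj₁ (inverse x x≢0)

  *-inverse : ∀ x (x≢0 : x ≢ 0#) → x * x ⁻¹[ x≢0 ] ≡ 1#
  *-inverse x x≢0 = proj₂ (inverse x x≢0)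

  *-cancelˡ : ∀ {x} → x ≢ 0# → ∀ {y z} → x * y ≡ x * z → y ≡ z
  *-cancelˡ {x} x≢0 {y} {z} xy≡xz = begin
    y                  ≡⟨ shape y ⟩
    x⁻¹ * (x * y) + (1# + - (x * x⁻¹)) * y  ≡⟨ cong₂ (λ a b → x⁻¹ * a + (1# + - b) * y) xy≡xz (*-inverse x x≢0) ⟩
    x⁻¹ * (x * z) + (1# + - 1#) * y         ≡⟨ solve 4 (λ x x⁻¹ y z → x⁻¹ :* (x :* z) :+ (:1 :+ :- :1) :* y := x⁻¹ :* (x :* z) :+ (:1 :+ :- :1) :* z) refl x x⁻¹ y z ⟩
    x⁻¹ * (x * z) + (1# + - 1#) * z         ≡⟨ cong (λ b → x⁻¹ * (x * z) + (1# + - b) * z) (sym (*-inverse x x≢0)) ⟩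
    x⁻¹ * (x * z) + (1# + - (x * x⁻¹)) * z  ≡⟨ sym (shape z) ⟩
    z ∎
    where
    open ≡-Reasoning
    x⁻¹ = x ⁻¹[ x≢0 ]
    -- The solver knows nothing of x x⁻¹ = 1. Hence y is split into a part that depends on y only
    -- through x y and a part with the factor 1 - x x⁻¹, which vanishes after rewriting.
    shape : ∀ y → y ≡ x⁻¹ * (x * y) + (1# + - (x * x⁻¹)) * y
    shape = λ y → solve 3 (λ x x⁻¹ y → y := x⁻¹ :* (x :* y) :+ (:1 :+ :- (x :* x⁻¹)) :* y) refl x x⁻¹ y

  *-zeroʳ : ∀ x → x * 0# ≡ 0#
  *-zeroʳ = solve 1 (λ x → x :* :0 := :0) refl

  *-nonzero : ∀ {x y} → x ≢ 0# → y ≢ 0# → x * y ≢ 0#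
  *-nonzero x≢0 y≢0 xy≡0 = y≢0 (*-cancelˡ x≢0 (trans xy≡0 (sym (*-zeroʳ _))))

  -‿nonzero : ∀ {x} → x ≢ 0# → - x ≢ 0#
  -‿nonzero {x} x≢0 -x≡0 = x≢0 (trans (solve 1 (λ x → x := :- :- x) refl x)
    (trans (cong -_ -x≡0) (solve 0 (:- :0 := :0) refl)))

  x-y≡0⇒x≡y : ∀ {x y} → x + - y ≡ 0# → x ≡ y
  x-y≡0⇒x≡y {x} {y} eq = trans (solve 2 (λ x y → x := (x :+ :- y) :+ y) refl x y)
    (trans (cong (_+ y) eq) (solve 1 (λ y → :0 :+ y := y) refl y))

  infix 9 _/_[_]
  _/_[_] : F → ∀ y → y ≢ 0# → F
  x / y [ y≢0 ] = y ⁻¹[ y≢0 ] * x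

  *-/ : ∀ x y (y≢0 : y ≢ 0#) → y * (x / y [ y≢0 ]) ≡ x
  *-/ x y y≢0 = trans (solve 3 (λ x y y⁻¹ → y :* (y⁻¹ :* x) := (y :* y⁻¹) :* x) refl x y _)
    (trans (cong (_* x) (*-inverse y y≢0)) (solve 1 (λ x → :1 :* x := x) refl x))

  Σ-cong : ∀ n {f h : Fin n → F} → (∀ i → f i ≡ h i) → Σ[ n ] f ≡ Σ[ n ] h
  Σ-cong zero    f≗h = refl
  Σ-cong (suc n) f≗h = cong₂ _+_ (f≗h fzero) (Σ-cong n (f≗h ∘ fsuc))

  Σ-zero : ∀ n {f : Fin n → F} → (∀ i → f i ≡ 0#) → Σ[ n ] f ≡ 0#
  Σ-zero zero    f≗0 = refl
  Σ-zero (suc n) f≗0 = trans (cong₂ _+_ (f≗0 fzero) (Σ-zero n (f≗0 ∘ fsuc))) (solve 0 (:0 :+ :0 := :0) refl)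

  Σ-+ : ∀ n (f h : Fin n → F) → Σ[ n ] (λ i → f i + h i) ≡ Σ[ n ] f + Σ[ n ] h
  Σ-+ zero    f h = solve 0 (:0 := :0 :+ :0) refl
  Σ-+ (suc n) f h = trans (cong (_ +_) (Σ-+ n (f ∘ fsuc) (h ∘ fsuc)))
    (solve 4 (λ a b s t → a :+ b :+ (s :+ t) := a :+ s :+ (b :+ t)) refl (f fzero) (h fzero) _ _)

  Σ-* : ∀ n a (f : Fin n → F) → Σ[ n ] (λ i → a * f i) ≡ a * Σ[ n ] f
  Σ-* zero    a f = sym (*-zeroʳ a)
  Σ-* (suc n) a f = trans (cong (_ +_) (Σ-* n a (f ∘ fsuc)))
    (solve 3 (λ a b s → a :* b :+ a :* s := a :* (b :+ s)) refl a (f fzero) _)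

  Σ-single : ∀ n (f : Fin n → F) i → (∀ j → j ≢ i → f j ≡ 0#) → Σ[ n ] f ≡ f i
  Σ-single (suc n) f fzero f≗0 = trans (cong (f fzero +_) (Σ-zero n (λ j → f≗0 (fsuc j) λ ())))
    (solve 1 (λ a → a :+ :0 := a) refl (f fzero))
  Σ-single (suc n) f (fsuc i) f≗0 = trans
    (cong₂ _+_ (f≗0 fzero λ ()) (Σ-single n (f ∘ fsuc) i (λ j j≢i → f≗0 (fsuc j) (λ { refl → j≢i refl }))))
    (solve 1 (λ a → :0 :+ a := a) refl (f (fsuc i)))

  δ : ∀ {n} → Fin n → Fin n → F
  δ fzero    fzero    = 1#
  δ fzero    (fsuc _) = 0#
  δ (fsuc _) fzero    = 0#
  δ (fsuc i) (fsuc j) = δ i j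

  δ-diag : ∀ {n} (i : Fin n) → δ i i ≡ 1#
  δ-diag fzero    = refl
  δ-diag (fsuc i) = δ-diag i

  δ-off : ∀ {n} {i j : Fin n} → i ≢ j → δ i j ≡ 0#
  δ-off {i = fzero}  {fzero}  i≢j = ⊥-elim (i≢j refl)
  δ-off {i = fzero}  {fsuc j} i≢j = refl
  δ-off {i = fsuc i} {fzero}  i≢j = refl
  δ-off {i = fsuc i} {fsuc j} i≢j = δ-off (i≢j ∘ cong fsuc)

  Σ-δ : ∀ n (f : Fin n → F) i → Σ[ n ] (λ j → f j * δ j i) ≡ f i
  Σ-δ n f i = trans (Σ-single n _ i (λ j j≢i → trans (cong (f j *_) (δ-off j≢i)) (*-zeroʳ _)))
    (trans (cong (f i *_) (δ-diag i)) (solve 1 (λ a → a :* :1 := a) refl (f i)))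

  nonzero-entry : ∀ n (f : Fin n → F) → (∃ λ j → f j ≢ 0#) ⊎ (∀ j → f j ≡ 0#)
  nonzero-entry zero    f = inj₂ λ ()
  nonzero-entry (suc n) f with f fzero ≟ 0# | nonzero-entry n (f ∘ fsuc)
  ... | no  f₀≢0 | _               = inj₁ (fzero , f₀≢0)
  ... | yes _    | inj₁ (j , fⱼ≢0) = inj₁ (fsuc j , fⱼ≢0)
  ... | yes f₀≡0 | inj₂ f≗0        = inj₂ λ { fzero → f₀≡0 ; (fsuc j) → f≗0 j }

  V-setoid : Setoid _ _
  V-setoid = record
    { Carrier = V ; _≈_ = _≈_
    ; isEquivalence = record { refl = λ _ → refl ; sym = λ e i → sym (e i) ; trans = λ e e′ i → trans (e i) (e′ i) } }

  open Setoid V-setoid public using () renaming (refl to ≈-refl; sym to ≈-sym; trans to ≈-trans)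
  module ≈-Reasoning = SetoidReasoning V-setoid

  ⊕-cong : ∀ {u u′ v v′} → u ≈ u′ → v ≈ v′ → u ⊕ v ≈ u′ ⊕ v′
  ⊕-cong e e′ i = cong₂ _+_ (e i) (e′ i)

  ⊖-cong : ∀ {u u′ v v′} → u ≈ u′ → v ≈ v′ → u ⊖ v ≈ u′ ⊖ v′
  ⊖-cong e e′ i = cong₂ (λ a b → a + - b) (e i) (e′ i)

  •-cong : ∀ {a b u v} → a ≡ b → u ≈ v → a • u ≈ b • v
  •-cong e e′ i = cong₂ _*_ e (e′ i)

  •-congˡ : ∀ a {u v} → u ≈ v → a • u ≈ a • v
  •-congˡ a = •-cong {a} refl

  ⊖-≈-0 : ∀ {u v} → u ⊖ v ≈ 0V → u ≈ v
  ⊖-≈-0 e i = x-y≡0⇒x≡y (e i)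

  ΣV-cong : ∀ n {f h : Fin n → V} → (∀ k → f k ≈ h k) → ΣV[ n ] f ≈ ΣV[ n ] h
  ΣV-cong n e i = Σ-cong n (λ k → e k i)

  ΣV-zero : ∀ n {f : Fin n → V} → (∀ k → f k ≈ 0V) → ΣV[ n ] f ≈ 0V
  ΣV-zero n e i = Σ-zero n (λ k → e k i)

  -- Vectors are functions compared pointwise, so a linear map has to carry its compatibility with
  -- `_≈_`. Working with maps makes composition immediate; matrices return only through `matrix`, to
  -- match the centralizer of the statement.
  record Operator : Set where
    field
      fn    : V → V
      resp  : ∀ {u v} → u ≈ v → fn u ≈ fn v
      add   : ∀ u v → fn (u ⊕ v) ≈ fn u ⊕ fn v
      scale : ∀ a u → fn (a • u) ≈ a • fn u

    zeroᶠ : fn 0V ≈ 0V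
    zeroᶠ = ≈-trans (resp {0V} {0# • 0V} (λ _ → sym (*-zeroʳ 0#)))
      (≈-trans (scale 0# 0V) (λ i → solve 1 (λ a → :0 :* a := :0) refl (fn 0V i)))

    resp-0 : ∀ {u} → u ≈ 0V → fn u ≈ 0V
    resp-0 e = ≈-trans (resp e) zeroᶠ

    sub : ∀ u v → fn (u ⊖ v) ≈ fn u ⊖ fn v
    sub u v = begin
      fn (u ⊖ v)                ≈⟨ resp (λ i → solve 2 (λ a b → a :+ :- b := a :+ :- :1 :* b) refl (u i) (v i)) ⟩
      fn (u ⊕ (- 1#) • v)       ≈⟨ add u ((- 1#) • v) ⟩
      fn u ⊕ fn ((- 1#) • v)    ≈⟨ ⊕-cong (≈-refl {fn u}) (scale (- 1#) v) ⟩
      fn u ⊕ (- 1#) • fn v      ≈⟨ (λ i → solve 2 (λ a b → a :+ :- :1 :* b := a :+ :- b) refl (fn u i) (fn v i)) ⟩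
      fn u ⊖ fn v ∎
      where open ≈-Reasoning

    sum : ∀ n (f : Fin n → V) → fn (ΣV[ n ] f) ≈ ΣV[ n ] (fn ∘ f)
    sum zero    f = zeroᶠ
    sum (suc n) f = ≈-trans (add (f fzero) (ΣV[ n ] (f ∘ fsuc))) (⊕-cong (≈-refl {fn (f fzero)}) (sum n (f ∘ fsuc)))

  infixr 8 _$_
  _$_ : Operator → V → V
  A $ v = Operator.fn A v

  open Operator using (resp; add; scale; sub; zeroᶠ; resp-0) public

  ⟪_⟫ : Mat → Operator
  ⟪ A ⟫ = record
    { fn    = A ·_
    ; resp  = λ e i → Σ-cong m (λ j → cong (A i j *_) (e j))
    ; add   = λ u v i → trans
        (Σ-cong m (λ j → solve 3 (λ a b c → a :* (b :+ c) := a :* b :+ a :* c) refl (A i j) (u j) (v j)))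
        (Σ-+ m (λ j → A i j * u j) (λ j → A i j * v j))
    ; scale = λ a u i → trans
        (Σ-cong m (λ j → solve 3 (λ a b c → b :* (a :* c) := a :* (b :* c)) refl a (A i j) (u j)))
        (Σ-* m a (λ j → A i j * u j))
    }

  matrix : Operator → Mat
  matrix A i j = (A $ δ j) i

  basis-expansion : ∀ v → ΣV[ m ] (λ j → v j • δ j) ≈ v
  basis-expansion v = Σ-δ m v

  matrix-· : ∀ A v → matrix A · v ≈ A $ v
  matrix-· A v = begin
    matrix A · v                            ≈⟨ (λ i → Σ-cong m (λ j → solve 2 (λ a b → a :* b := b :* a) refl (matrix A i j) (v j))) ⟩
    ΣV[ m ] (λ j → v j • (A $ δ j))         ≈⟨ ΣV-cong m (λ j → ≈-sym (scale A (v j) (δ j))) ⟩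
    ΣV[ m ] (λ j → A $ (v j • δ j))         ≈⟨ ≈-sym (Operator.sum A m (λ j → v j • δ j)) ⟩
    A $ ΣV[ m ] (λ j → v j • δ j)           ≈⟨ resp A (basis-expansion v) ⟩
    A $ v ∎
    where open ≈-Reasoning

  𝟙 : Operator
  𝟙 = record { fn = λ v → v ; resp = λ e → e ; add = λ u v → ≈-refl {u ⊕ v} ; scale = λ a u → ≈-refl {a • u} }

  infixr 8 _∘ᵒ_
  _∘ᵒ_ : Operator → Operator → Operator
  A ∘ᵒ C = record
    { fn = λ v → A $ C $ v
    ; resp = λ e → resp A (resp C e)
    ; add = λ u v → ≈-trans (resp A (add C u v)) (add A (C $ u) (C $ v))
    ; scale = λ a u → ≈-trans (resp A (scale C a u)) (scale A a (C $ u)) }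

  infixl 6 _⊞_
  _⊞_ : Operator → Operator → Operator
  A ⊞ C = record
    { fn = λ v → (A $ v) ⊕ (C $ v)
    ; resp = λ e → ⊕-cong (resp A e) (resp C e)
    ; add = λ u v → ≈-trans (⊕-cong (add A u v) (add C u v))
        (λ i → solve 4 (λ x y z w → x :+ y :+ (z :+ w) := x :+ z :+ (y :+ w)) refl
          ((A $ u) i) ((A $ v) i) ((C $ u) i) ((C $ v) i))
    ; scale = λ s u → ≈-trans (⊕-cong (scale A s u) (scale C s u))
        (λ i → solve 3 (λ s x z → s :* x :+ s :* z := s :* (x :+ z)) refl s ((A $ u) i) ((C $ u) i)) }

  infixr 7 _⊡_
  _⊡_ : F → Operator → Operator
  a ⊡ A = record
    { fn = λ v → a • (A $ v)
    ; resp = λ e → •-congˡ a (resp A e)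
    ; add = λ u v → ≈-trans (•-congˡ a (add A u v))
        (λ i → solve 3 (λ a x y → a :* (x :+ y) := a :* x :+ a :* y) refl a ((A $ u) i) ((A $ v) i))
    ; scale = λ s u → ≈-trans (•-congˡ a (scale A s u))
        (λ i → solve 3 (λ a s x → a :* (s :* x) := s :* (a :* x)) refl a s ((A $ u) i)) }

  pow : Operator → ℕ → Operator
  pow A zero    = 𝟙
  pow A (suc k) = A ∘ᵒ pow A k

  Commute : Operator → Operator → Set
  Commute A C = ∀ v → A $ C $ v ≈ C $ A $ v

  ⊞-commute : ∀ A A′ C → Commute A C → Commute A′ C → Commute (A ⊞ A′) C
  ⊞-commute A A′ C e e′ v = ≈-trans (⊕-cong (e v) (e′ v)) (≈-sym (add C (A $ v) (A′ $ v)))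

  ⊡-commute : ∀ a A C → Commute A C → Commute (a ⊡ A) C
  ⊡-commute a A C e v = ≈-trans (•-congˡ a (e v)) (≈-sym (scale C a (A $ v)))

  ∘-commute : ∀ A A′ C → Commute A C → Commute A′ C → Commute (A ∘ᵒ A′) C
  ∘-commute A A′ C e e′ v = ≈-trans (resp A (e′ v)) (e (A′ $ v))

  pow-commute : ∀ A C → Commute A C → ∀ k → Commute (pow A k) C
  pow-commute A C com zero    v = ≈-refl {C $ v}
  pow-commute A C com (suc k) v = ≈-trans (resp A (pow-commute A C com k v)) (com (pow A k $ v))

  pow-suc : ∀ A k v → pow A (suc k) $ v ≈ pow A k $ A $ v
  pow-suc A k v = ≈-sym (pow-commute A A (λ u → ≈-refl {A $ A $ u}) k v)

  pow-vanish : ∀ A {j k v} → j ℕ.≤ k → pow A j $ v ≈ 0V → pow A k $ v ≈ 0V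
  pow-vanish A {zero}  {zero}  ℕ.z≤n e = e
  pow-vanish A {zero}  {suc k} ℕ.z≤n e = resp-0 A (pow-vanish A {zero} {k} ℕ.z≤n e)
  pow-vanish A {suc j} {suc k} {v} (ℕ.s≤s j≤k) e = ≈-trans (pow-suc A k v)
    (pow-vanish A {j} {k} {A $ v} j≤k (≈-trans (≈-sym (pow-suc A j v)) e))

  -- A parametrisation of the hyperplane Σ aⱼ xⱼ = 0 by n coordinates; the last component
  -- expresses that it is linear.
  hyperplane : ∀ n (a : Fin (suc n) → F) → ∃ λ (ι : (Fin n → F) → Fin (suc n) → F) →
    (∀ d → Σ[ suc n ] (λ j → a j * ι d j) ≡ 0#)
    × (∀ d → (∃ λ j → d j ≢ 0#) → ∃ λ j → ι d j ≢ 0#)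
    × (∀ (b : Fin (suc n) → F) → ∃ λ (b′ : Fin n → F) → ∀ d → Σ[ suc n ] (λ j → b j * ι d j) ≡ Σ[ n ] (λ j → b′ j * d j))
  hyperplane n a with a fzero ≟ 0#
  hyperplane zero a | yes a₀≡0 = (λ _ _ → 0#)
    , (λ _ → solve 1 (λ a → a :* :0 :+ :0 := :0) refl (a fzero))
    , (λ { _ (() , _) })
    , (λ b → (λ ()) , λ _ → solve 1 (λ a → a :* :0 :+ :0 := :0) refl (b fzero))
  -- Without a pivot at index zero that coordinate stays free and the equation concerns the tail
  -- alone; with a pivot, below, it is solved from the others.
  hyperplane (suc n) a | yes a₀≡0 with hyperplane n (a ∘ fsuc)
  ... | ι′ , ι′-zero , ι′-inj , ι′-lin = ι
    , (λ d → trans (cong₂ _+_ (cong (_* d fzero) a₀≡0) (ι′-zero (d ∘ fsuc))) (solve 1 (λ d → :0 :* d :+ :0 := :0) refl (d fzero)))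
    , (λ { d (fzero , p) → fzero , p ; d (fsuc j , p) → let (l , q) = ι′-inj (d ∘ fsuc) (j , p) in fsuc l , q })
    , (λ b → let (b″ , e) = ι′-lin (b ∘ fsuc) in
        (λ { fzero → b fzero ; (fsuc j) → b″ j }) , λ d → cong (b fzero * d fzero +_) (e (d ∘ fsuc)))
    where
    ι : (Fin (suc n) → F) → Fin (suc (suc n)) → F
    ι d fzero    = d fzero
    ι d (fsuc j) = ι′ (d ∘ fsuc) j
  hyperplane n a | no a₀≢0 = ι
    , (λ d → trans (solve 3 (λ a a⁻¹ s → a :* (:- a⁻¹ :* s) :+ s := s :+ :- (a :* a⁻¹ :* s)) refl (a fzero) a₀⁻¹ (s d))
        (trans (cong (λ x → s d + - (x * s d)) (*-inverse (a fzero) a₀≢0)) (solve 1 (λ s → s :+ :- (:1 :* s) := :0) refl (s d))))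
    , (λ { d (j , p) → fsuc j , p })
    , (λ b → (λ j → b (fsuc j) + b fzero * - a₀⁻¹ * a (fsuc j)) , λ d → sym (trans
        (Σ-cong n (λ j → solve 4 (λ b x a d → (b :+ x :* a) :* d := b :* d :+ x :* (a :* d)) refl (b (fsuc j)) (b fzero * - a₀⁻¹) (a (fsuc j)) (d j)))
        (trans (Σ-+ n (λ j → b (fsuc j) * d j) _) (trans (cong (Σ[ n ] (λ j → b (fsuc j) * d j) +_) (Σ-* n (b fzero * - a₀⁻¹) (λ j → a (fsuc j) * d j)))
          (solve 4 (λ t b x s → t :+ b :* :- x :* s := b :* (:- x :* s) :+ t) refl (Σ[ n ] (λ j → b (fsuc j) * d j)) (b fzero) a₀⁻¹ (s d))))))
    where
    a₀⁻¹ = a fzero ⁻¹[ a₀≢0 ]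
    s : (Fin n → F) → F
    s d = Σ[ n ] (λ j → a (fsuc j) * d j)
    ι : (Fin n → F) → Fin (suc n) → F
    ι d fzero    = - a₀⁻¹ * s d
    ι d (fsuc j) = d j

  -- Gaussian elimination by one equation at a time: pulled back to the parametrised hyperplane of
  -- the first equation, the others form a system with one equation and one unknown fewer, and
  -- injectivity keeps the solution nonzero.
  underdetermined : ∀ {r n} → r ℕ.< n → (A : Fin r → Fin n → F) →
    ∃ λ (d : Fin n → F) → (∃ λ j → d j ≢ 0#) × (∀ i → Σ[ n ] (λ j → A i j * d j) ≡ 0#)
  underdetermined {zero}  {suc n} _ A = (λ _ → 1#) , (fzero , 0≢1 ∘ sym) , λ ()
  underdetermined {suc r} {suc n} (ℕ.s≤s r<n) A with hyperplane n (A fzero)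
  ... | ι , ι-zero , ι-inj , ι-lin with underdetermined r<n (λ i → proj₁ (ι-lin (A (fsuc i))))
  ... | d , d≢0 , e = ι d , ι-inj d d≢0 , λ
    { fzero → ι-zero d ; (fsuc i) → trans (proj₂ (ι-lin (A (fsuc i))) d) (e i) }

  ΣV-single : ∀ n (f : Fin n → V) k → (∀ l → l ≢ k → f l ≈ 0V) → ΣV[ n ] f ≈ f k
  ΣV-single n f k e i = Σ-single n (λ l → f l i) k (λ l l≢k → e l l≢k i)

  ΣV-⊖ : ∀ n (f h : Fin n → V) → ΣV[ n ] f ⊖ ΣV[ n ] h ≈ ΣV[ n ] (λ k → f k ⊖ h k)
  ΣV-⊖ zero    f h i = solve 0 (:0 :+ :- :0 := :0) refl
  ΣV-⊖ (suc n) f h i = trans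
    (solve 4 (λ a s b t → a :+ s :+ :- (b :+ t) := a :+ :- b :+ (s :+ :- t)) refl (f fzero i) (ΣV[ n ] (f ∘ fsuc) i) (h fzero i) (ΣV[ n ] (h ∘ fsuc) i))
    (cong (f fzero i + - h fzero i +_) (ΣV-⊖ n (f ∘ fsuc) (h ∘ fsuc) i))

-- The polar form of the quadratic form.

module BilinearForm (𝔽 : FiniteField) (m : ℕ) (c : LinAlg.QForm 𝔽 m) where
  open LinearAlgebra 𝔽 m public

  private
    Σ² : (Fin m → Fin m → F) → F
    Σ² f = Σ[ m ] (λ i → Σ[ m ] (f i))

    Σ²-cong : ∀ {f h} → (∀ i j → f i j ≡ h i j) → Σ² f ≡ Σ² h
    Σ²-cong e = Σ-cong m (λ i → Σ-cong m (e i))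

    Σ²-+ : ∀ f h → Σ² (λ i j → f i j + h i j) ≡ Σ² f + Σ² h
    Σ²-+ f h = trans (Σ-cong m (λ i → Σ-+ m (f i) (h i))) (Σ-+ m (λ i → Σ[ m ] (f i)) (λ i → Σ[ m ] (h i)))

    Σ²-* : ∀ a f → Σ² (λ i j → a * f i j) ≡ a * Σ² f
    Σ²-* a f = trans (Σ-cong m (λ i → Σ-* m a (f i))) (Σ-* m a (λ i → Σ[ m ] (f i)))

    term : V → V → Fin m → Fin m → F
    term u v i j = c i j * (u i * v j + v i * u j)

  abstract
    -- Kept abstract so that goals do not unfold into double sums over the coefficients.
    B : V → V → F
    B = Bf c

    B≡Bf : ∀ u v → B u v ≡ Bf c u v
    B≡Bf u v = refl

    private
      -- Polarisation cancels the pure terms and leaves a visibly symmetric and bilinear sum,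
      -- although the coefficient matrix of the quadratic form need not be symmetric.
      B-expand : ∀ u v → B u v ≡ Σ² (term u v)
      B-expand u v = begin
        Σ² (λ i j → c i j * ((u i + v i) * (u j + v j))) + - (Qv c u + Qv c v)
          ≡⟨ cong (_+ - (Qv c u + Qv c v)) (Σ²-cong λ i j → solve 5 (λ k a b a′ b′ → k :* ((a :+ b) :* (a′ :+ b′))
               := k :* (a :* b′ :+ b :* a′) :+ (k :* (a :* a′) :+ k :* (b :* b′))) refl (c i j) (u i) (v i) (u j) (v j)) ⟩
        Σ² (λ i j → term u v i j + (c i j * (u i * u j) + c i j * (v i * v j))) + - (Qv c u + Qv c v)
          ≡⟨ cong (_+ - (Qv c u + Qv c v)) (trans (Σ²-+ (term u v) _) (cong (Σ² (term u v) +_) (Σ²-+ _ _))) ⟩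
        Σ² (term u v) + (Qv c u + Qv c v) + - (Qv c u + Qv c v)
          ≡⟨ solve 2 (λ s q → s :+ q :+ :- q := s) refl (Σ² (term u v)) (Qv c u + Qv c v) ⟩
        Σ² (term u v) ∎
        where open ≡-Reasoning

    B-cong : ∀ {u u′ v v′} → u ≈ u′ → v ≈ v′ → B u v ≡ B u′ v′
    B-cong {u} {u′} {v} {v′} e e′ = trans (B-expand u v) (trans
      (Σ²-cong (λ i j → cong (c i j *_) (cong₂ _+_ (cong₂ _*_ (e i) (e′ j)) (cong₂ _*_ (e′ i) (e j)))))
      (sym (B-expand u′ v′)))

    B-sym : ∀ u v → B u v ≡ B v u
    B-sym u v = trans (B-expand u v) (trans
      (Σ²-cong (λ i j → solve 5 (λ k a b a′ b′ → k :* (a :* b′ :+ b :* a′) := k :* (b :* a′ :+ a :* b′)) refl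
        (c i j) (u i) (v i) (u j) (v j)))
      (sym (B-expand v u)))

    B-addʳ : ∀ u v w → B u (v ⊕ w) ≡ B u v + B u w
    B-addʳ u v w = trans (B-expand u (v ⊕ w)) (trans
      (Σ²-cong (λ i j → solve 7 (λ k a b d a′ b′ d′ → k :* (a :* (b′ :+ d′) :+ (b :+ d) :* a′)
         := k :* (a :* b′ :+ b :* a′) :+ k :* (a :* d′ :+ d :* a′)) refl (c i j) (u i) (v i) (w i) (u j) (v j) (w j)))
      (trans (Σ²-+ (term u v) (term u w)) (sym (cong₂ _+_ (B-expand u v) (B-expand u w)))))

    B-scaleʳ : ∀ a u v → B u (a • v) ≡ a * B u v
    B-scaleʳ a u v = trans (B-expand u (a • v)) (trans
      (Σ²-cong (λ i j → solve 6 (λ a k x y x′ y′ → k :* (x :* (a :* y′) :+ (a :* y) :* x′)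
         := a :* (k :* (x :* y′ :+ y :* x′))) refl a (c i j) (u i) (v i) (u j) (v j)))
      (trans (Σ²-* a (term u v)) (sym (cong (a *_) (B-expand u v)))))

  B-congˡ : ∀ {u u′} v → u ≈ u′ → B u v ≡ B u′ v
  B-congˡ v e = B-cong e (≈-refl {v})

  B-congʳ : ∀ u {v v′} → v ≈ v′ → B u v ≡ B u v′
  B-congʳ u e = B-cong (≈-refl {u}) e

  B-addˡ : ∀ u v w → B (u ⊕ v) w ≡ B u w + B v w
  B-addˡ u v w = trans (B-sym _ _) (trans (B-addʳ w u v) (cong₂ _+_ (B-sym w u) (B-sym w v)))

  B-scaleˡ : ∀ a u v → B (a • u) v ≡ a * B u v
  B-scaleˡ a u v = trans (B-sym _ _) (trans (B-scaleʳ a v u) (cong (a *_) (B-sym v u)))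

  B-subʳ : ∀ u v w → B u (v ⊖ w) ≡ B u v + - B u w
  B-subʳ u v w = begin
    B u (v ⊖ w)               ≡⟨ B-congʳ u (λ i → solve 2 (λ a b → a :+ :- b := a :+ :- :1 :* b) refl (v i) (w i)) ⟩
    B u (v ⊕ (- 1#) • w)      ≡⟨ B-addʳ u v _ ⟩
    B u v + B u ((- 1#) • w)  ≡⟨ cong (B u v +_) (B-scaleʳ _ u w) ⟩
    B u v + - 1# * B u w      ≡⟨ solve 2 (λ a b → a :+ :- :1 :* b := a :+ :- b) refl (B u v) (B u w) ⟩
    B u v + - B u w ∎
    where open ≡-Reasoning

  B-subˡ : ∀ u v w → B (u ⊖ v) w ≡ B u w + - B v w
  B-subˡ u v w = trans (B-sym _ _) (trans (B-subʳ w u v) (cong₂ (λ a b → a + - b) (B-sym w u) (B-sym w v)))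

  B-0ʳ : ∀ u {v} → v ≈ 0V → B u v ≡ 0#
  B-0ʳ u {v} e = begin
    B u v            ≡⟨ B-congʳ u (λ i → trans (e i) (solve 0 (:0 := :0 :* :0) refl)) ⟩
    B u (0# • 0V)    ≡⟨ B-scaleʳ 0# u 0V ⟩
    0# * B u 0V      ≡⟨ solve 1 (λ a → :0 :* a := :0) refl (B u 0V) ⟩
    0# ∎
    where open ≡-Reasoning

  B-Σʳ : ∀ u n (f : Fin n → V) → B u (ΣV[ n ] f) ≡ Σ[ n ] (λ k → B u (f k))
  B-Σʳ u zero    f = B-0ʳ u (≈-refl {0V})
  B-Σʳ u (suc n) f = trans (B-addʳ u (f fzero) (ΣV[ n ] (f ∘ fsuc))) (cong (B u (f fzero) +_) (B-Σʳ u n (f ∘ fsuc)))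

  -- Q(2v) = 4 Q(v). Since 2 is invertible, B thus recovers Q, which turns operators isometric for B
  -- into elements of the orthogonal group.
  B-diag : ∀ v → B v v ≡ two * Qv c v
  B-diag v = begin
    B v v                              ≡⟨ B≡Bf v v ⟩
    Qv c (v ⊕ v) + - (Qv c v + Qv c v)
      ≡⟨ cong (_+ - (Qv c v + Qv c v)) (trans (Σ²-cong λ i j → solve 3 (λ k a b → k :* ((a :+ a) :* (b :+ b)) := (:1 :+ :1) :* (:1 :+ :1) :* (k :* (a :* b))) refl (c i j) (v i) (v j))
           (Σ²-* (two * two) _)) ⟩
    two * two * Qv c v + - (Qv c v + Qv c v) ≡⟨ solve 1 (λ q → (:1 :+ :1) :* (:1 :+ :1) :* q :+ :- (q :+ q) := (:1 :+ :1) :* q) refl (Qv c v) ⟩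
    two * Qv c v ∎
    where open ≡-Reasoning

  Qv-cong : ∀ {u v} → u ≈ v → Qv c u ≡ Qv c v
  Qv-cong e = Σ²-cong (λ i j → cong (c i j *_) (cong₂ _*_ (e i) (e j)))

  Isometric : Operator → Set
  Isometric A = ∀ u v → B (A $ u) (A $ v) ≡ B u v

  Qv-preserving⇒isometric : ∀ A → (∀ v → Qv c (A $ v) ≡ Qv c v) → Isometric A
  Qv-preserving⇒isometric A p u v = begin
    B (A $ u) (A $ v)  ≡⟨ B≡Bf _ _ ⟩
    Qv c ((A $ u) ⊕ (A $ v)) + - (Qv c (A $ u) + Qv c (A $ v))
      ≡⟨ cong₂ (λ a b → a + - b) (trans (Qv-cong (≈-sym (add A u v))) (p (u ⊕ v))) (cong₂ _+_ (p u) (p v)) ⟩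
    Qv c (u ⊕ v) + - (Qv c u + Qv c v) ≡⟨ sym (B≡Bf u v) ⟩
    B u v ∎
    where open ≡-Reasoning

  isometric⇒Qv-preserving : two ≢ 0# → ∀ A → Isometric A → ∀ v → Qv c (A $ v) ≡ Qv c v
  isometric⇒Qv-preserving two≢0 A iso v =
    *-cancelˡ two≢0 (trans (sym (B-diag (A $ v))) (trans (iso v v) (B-diag v)))

  module _ (nondegenerate : Nondegenerate c) where

    B-nondegenerate : ∀ {w w′} → (∀ u → B u w ≡ B u w′) → w ≈ w′
    B-nondegenerate {w} {w′} e = ⊖-≈-0 (nondegenerate (w ⊖ w′) (λ v → begin
      Bf c (w ⊖ w′) v        ≡⟨ sym (B≡Bf _ _) ⟩
      B (w ⊖ w′) v           ≡⟨ B-sym _ _ ⟩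
      B v (w ⊖ w′)           ≡⟨ B-subʳ v w w′ ⟩
      B v w + - B v w′       ≡⟨ cong (_+ - B v w′) (e v) ⟩
      B v w′ + - B v w′      ≡⟨ solve 1 (λ a → a :+ :- a := :0) refl (B v w′) ⟩
      0# ∎))
      where open ≡-Reasoning

    -- The witness must be explicit, so the basis vectors are tested one by one; if all of them pair
    -- to zero with w, linearity and nondegeneracy force w to vanish.
    nonzero-pairing : ∀ {w} → ¬ (w ≈ 0V) → ∃ λ v → B v w ≢ 0#
    nonzero-pairing {w} w≉0 with nonzero-entry m (λ j → B (δ j) w)
    ... | inj₁ (j , p) = δ j , p
    ... | inj₂ z = ⊥-elim (w≉0 (B-nondegenerate (λ u → trans (B-sym u w) (trans (B-congʳ w (≈-sym (basis-expansion u)))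
            (trans (B-Σʳ w m (λ j → u j • δ j))
            (trans (Σ-zero m (λ j → trans (B-scaleʳ (u j) w (δ j)) (trans (cong (u j *_) (trans (B-sym w (δ j)) (z j))) (*-zeroʳ _))))
              (sym (B-0ʳ u (≈-refl {0V})))))))))

-- The operator N = g - 1, its adjoint, and the forms on the kernels of its powers.

module Isometry (𝔽 : FiniteField) (m : ℕ) (c : LinAlg.QForm 𝔽 m) (nondegenerate : LinAlg.Nondegenerate 𝔽 m c)
                (g : LinAlg.Mat 𝔽 m) (g∈O : LinAlg.InO 𝔽 m c g) where
  open BilinearForm 𝔽 m c public

  -- `M` is g⁻¹ - 1. It is the adjoint of `N`, because the adjoint of an isometry is its inverse.
  G G⁻ N M : Operator
  G  = ⟪ g ⟫
  G⁻ = ⟪ proj₁ (proj₁ g∈O) ⟫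
  N = record
    { fn    = Nop g
    ; resp  = λ e → ⊖-cong (resp G e) e
    ; add   = λ u v → ≈-trans (⊖-cong (add G u v) (≈-refl {u ⊕ v}))
        (λ i → solve 4 (λ a b x y → a :+ b :+ :- (x :+ y) := a :+ :- x :+ (b :+ :- y)) refl ((G $ u) i) ((G $ v) i) (u i) (v i))
    ; scale = λ a u → ≈-trans (⊖-cong (scale G a u) (≈-refl {a • u}))
        (λ i → solve 3 (λ a x y → a :* x :+ :- (a :* y) := a :* (x :+ :- y)) refl a ((G $ u) i) (u i)) }
  M = G⁻ ⊞ (- 1#) ⊡ 𝟙

  G⁻-G : ∀ v → G⁻ $ G $ v ≈ v
  G⁻-G = proj₁ (proj₂ (proj₁ g∈O))

  G-G⁻ : ∀ v → G $ G⁻ $ v ≈ v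
  G-G⁻ = proj₂ (proj₂ (proj₁ g∈O))

  G-isometric : Isometric G
  G-isometric = Qv-preserving⇒isometric G (proj₂ g∈O)

  Npow≈pow : ∀ k v → Npow g k v ≈ pow N k $ v
  Npow≈pow zero    v = ≈-refl {v}
  Npow≈pow (suc k) v = resp N (Npow≈pow k v)

  G≈N+1 : ∀ v → G $ v ≈ (N $ v) ⊕ v
  G≈N+1 v i = solve 2 (λ a b → a := a :+ :- b :+ b) refl ((G $ v) i) (v i)

  commute-G : ∀ A → Commute A N → Commute A G
  commute-G A com v = begin
    A $ G $ v                  ≈⟨ resp A (G≈N+1 v) ⟩
    A $ ((N $ v) ⊕ v)          ≈⟨ add A (N $ v) v ⟩
    (A $ N $ v) ⊕ (A $ v)      ≈⟨ ⊕-cong (com v) (≈-refl {A $ v}) ⟩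
    (N $ A $ v) ⊕ (A $ v)      ≈⟨ ≈-sym (G≈N+1 (A $ v)) ⟩
    G $ A $ v ∎
    where open ≈-Reasoning

  commute-N : ∀ A → Commute A G → Commute A N
  commute-N A com v = ≈-trans (sub A (G $ v) v) (⊖-cong (com v) (≈-refl {A $ v}))

  commute-G⁻ : ∀ A → Commute A G → Commute A G⁻
  commute-G⁻ A com v = begin
    A $ G⁻ $ v              ≈⟨ ≈-sym (G⁻-G _) ⟩
    G⁻ $ G $ A $ G⁻ $ v     ≈⟨ resp G⁻ (≈-sym (com (G⁻ $ v))) ⟩
    G⁻ $ A $ G $ G⁻ $ v     ≈⟨ resp G⁻ (resp A (G-G⁻ v)) ⟩
    G⁻ $ A $ v ∎
    where open ≈-Reasoning

  G⁻-N : Commute G⁻ N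
  G⁻-N = commute-N G⁻ (λ v → ≈-trans (G⁻-G v) (≈-sym (G-G⁻ v)))

  M≈-G⁻N : ∀ v → M $ v ≈ (- 1#) • (G⁻ $ N $ v)
  M≈-G⁻N v = ≈-sym (≈-trans (•-congˡ (- 1#) (≈-trans (sub G⁻ (G $ v) v) (⊖-cong (G⁻-G v) (≈-refl {G⁻ $ v}))))
    (λ i → solve 2 (λ a b → :- :1 :* (a :+ :- b) := b :+ :- :1 :* a) refl (v i) ((G⁻ $ v) i)))

  M-N : Commute M N
  M-N = ⊞-commute G⁻ ((- 1#) ⊡ 𝟙) N G⁻-N (⊡-commute (- 1#) 𝟙 N (λ v → ≈-refl {N $ v}))

  adjoint : ∀ u v → B (N $ u) v ≡ B u (M $ v)
  adjoint u v = begin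
    B (N $ u) v                          ≡⟨ B-subˡ (G $ u) u v ⟩
    B (G $ u) v + - B u v                ≡⟨ cong (_+ - B u v) (trans (B-congʳ (G $ u) (≈-sym (G-G⁻ v))) (G-isometric u (G⁻ $ v))) ⟩
    B u (G⁻ $ v) + - B u v               ≡⟨ sym (B-subʳ u (G⁻ $ v) v) ⟩
    B u ((G⁻ $ v) ⊖ v)                   ≡⟨ B-congʳ u (λ i → solve 2 (λ a b → a :+ :- b := a :+ :- :1 :* b) refl ((G⁻ $ v) i) (v i)) ⟩
    B u (M $ v) ∎
    where open ≡-Reasoning

  adjoint-pow : ∀ k u v → B (pow N k $ u) v ≡ B u (pow M k $ v)
  adjoint-pow zero    u v = refl
  adjoint-pow (suc k) u v = trans (adjoint (pow N k $ u) v)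
    (trans (adjoint-pow k u (M $ v)) (B-congʳ u (≈-sym (pow-suc M k v))))

  -- `M` is - g⁻¹ N with commuting factors, so its powers are invertible multiples of those of `N`.
  pow-M-vanish : ∀ k {v} → pow N k $ v ≈ 0V → pow M k $ v ≈ 0V
  pow-M-vanish zero        e = e
  pow-M-vanish (suc k) {v} e = ≈-trans (pow-suc M k v) (pow-M-vanish k (begin
    pow N k $ M $ v     ≈⟨ pow-commute N M (λ u → ≈-sym (M-N u)) k v ⟩
    M $ pow N k $ v     ≈⟨ M≈-G⁻N (pow N k $ v) ⟩
    (- 1#) • (G⁻ $ pow N (suc k) $ v) ≈⟨ •-congˡ (- 1#) (resp-0 G⁻ e) ⟩
    (- 1#) • 0V         ≈⟨ (λ _ → *-zeroʳ _) ⟩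
    0V ∎))
    where open ≈-Reasoning

  -- The sign (-1)^k. The index k stands for the block size i = k + 1 throughout, so the sign is 1
  -- exactly for odd block sizes.
  σ : ℕ → F
  σ zero    = 1#
  σ (suc k) = - σ k

  σ-cases : ∀ k → σ k ≡ 1# ⊎ σ k ≡ - 1#
  σ-cases zero = inj₁ refl
  σ-cases (suc k) with σ-cases k
  ... | inj₁ e = inj₂ (cong -_ e)
  ... | inj₂ e = inj₁ (trans (cong -_ e) (solve 0 (:- :- :1 := :1) refl))

  σ-square : ∀ k → σ k * σ k ≡ 1#
  σ-square zero    = solve 0 (:1 :* :1 := :1) refl
  σ-square (suc k) = trans (solve 1 (λ s → :- s :* :- s := s :* s) refl (σ k)) (σ-square k)

  -- Note the shift: this is the kernel of the power k + 1, the one that belongs to block size k +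
  -- 1, on which `β k` is studied.
  Ker : ℕ → V → Set
  Ker k v = pow N (suc k) $ v ≈ 0V

  -- On ker N the operator g⁻¹ is the identity, so M = - g⁻¹ N acts on the powers as - N.
  pow-M-Ker : ∀ k {v} → Ker k v → pow M k $ v ≈ σ k • (pow N k $ v)
  pow-M-Ker zero    {v} e i = solve 1 (λ a → a := :1 :* a) refl (v i)
  pow-M-Ker (suc k) {v} e = begin
    pow M (suc k) $ v                          ≈⟨ pow-suc M k v ⟩
    pow M k $ M $ v                            ≈⟨ pow-M-Ker k (≈-trans (pow-commute N M (λ u → ≈-sym (M-N u)) (suc k) v) (killed (suc k) e)) ⟩
    σ k • (pow N k $ M $ v)                    ≈⟨ •-congˡ (σ k) (pow-commute N M (λ u → ≈-sym (M-N u)) k v) ⟩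
    σ k • (M $ pow N k $ v)                    ≈⟨ •-congˡ (σ k) (M≈-G⁻N (pow N k $ v)) ⟩
    σ k • (- 1#) • (G⁻ $ pow N (suc k) $ v)    ≈⟨ •-congˡ (σ k) (•-congˡ (- 1#) (fixed e)) ⟩
    σ k • (- 1#) • (pow N (suc k) $ v)         ≈⟨ (λ i → solve 2 (λ s a → s :* (:- :1 :* a) := :- s :* a) refl (σ k) ((pow N (suc k) $ v) i)) ⟩
    σ (suc k) • (pow N (suc k) $ v) ∎
    where
    open ≈-Reasoning
    killed : ∀ j {w} → pow N (suc j) $ w ≈ 0V → M $ pow N j $ w ≈ 0V
    killed j {w} e′ = ≈-trans (M≈-G⁻N (pow N j $ w)) (≈-trans (•-congˡ (- 1#) (resp-0 G⁻ e′)) (λ _ → *-zeroʳ _))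
    fixed : ∀ {w} → N $ w ≈ 0V → G⁻ $ w ≈ w
    fixed {w} e′ = ≈-trans (resp G⁻ (≈-sym (⊖-≈-0 e′))) (G⁻-G w)

  β : ℕ → V → V → F
  β k u v = B u (pow N k $ v)

  pow-adjoint-Ker : ∀ k u {v} → Ker k v → B (pow N k $ u) v ≡ σ k * β k u v
  pow-adjoint-Ker k u {v} e = trans (adjoint-pow k u v)
    (trans (B-congʳ u (pow-M-Ker k e)) (B-scaleʳ (σ k) u (pow N k $ v)))

  β-sym : ∀ k u {v} → Ker k v → β k v u ≡ σ k * β k u v
  β-sym k u e = trans (B-sym _ _) (pow-adjoint-Ker k u e)

  InN : V → Set
  InN w = ∃ λ r → w ≈ N $ r

  InN-resp : ∀ {u w} → u ≈ w → InN u → InN w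
  InN-resp e (r , p) = r , ≈-trans (≈-sym e) p

  InN-0 : ∀ {w} → w ≈ 0V → InN w
  InN-0 e = 0V , ≈-trans e (≈-sym (zeroᶠ N))

  InN-⊕ : ∀ {u w} → InN u → InN w → InN (u ⊕ w)
  InN-⊕ (r , p) (s , q) = r ⊕ s , ≈-trans (⊕-cong p q) (≈-sym (add N r s))

  InN-• : ∀ a {u} → InN u → InN (a • u)
  InN-• a (r , p) = a • r , ≈-trans (•-congˡ a p) (≈-sym (scale N a r))

  InN-map : ∀ A → Commute A N → ∀ {u} → InN u → InN (A $ u)
  InN-map A com (r , p) = A $ r , ≈-trans (resp A p) (com r)

  -- The j-th step N^j F[g,g⁻¹] v of the filtration of the cyclic submodule generated by v.
  data Cyclic (v : V) : ℕ → V → Set where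
    generator : Cyclic v 0 v
    respects  : ∀ {j u w} → u ≈ w → Cyclic v j u → Cyclic v j w
    null      : ∀ {j} → Cyclic v j 0V
    plus      : ∀ {j u w} → Cyclic v j u → Cyclic v j w → Cyclic v j (u ⊕ w)
    times     : ∀ {j u} a → Cyclic v j u → Cyclic v j (a • u)
    shift     : ∀ {j u} → Cyclic v j u → Cyclic v (suc j) (N $ u)
    weaken    : ∀ {j u} → Cyclic v (suc j) u → Cyclic v j u
    unshift   : ∀ {j u} → Cyclic v j u → Cyclic v j (G⁻ $ u)

  Cyclic⇒InN : ∀ {v j u} → Cyclic v (suc j) u → InN u
  Cyclic⇒InN (respects e p) = InN-resp e (Cyclic⇒InN p)
  Cyclic⇒InN null           = InN-0 (≈-refl {0V})
  Cyclic⇒InN (plus p q)     = InN-⊕ (Cyclic⇒InN p) (Cyclic⇒InN q)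
  Cyclic⇒InN (times a p)    = InN-• a (Cyclic⇒InN p)
  Cyclic⇒InN (shift {u = u} p) = u , ≈-refl {N $ u}
  Cyclic⇒InN (weaken p)     = Cyclic⇒InN p
  Cyclic⇒InN (unshift p)    = InN-map G⁻ G⁻-N (Cyclic⇒InN p)

  -- A count of powers: each `shift` contributes one factor N, so at level j only i - j further
  -- factors are needed, and g⁻¹ commutes with N and leaves the count unchanged.
  Cyclic-vanish : ∀ {v i} → pow N i $ v ≈ 0V → ∀ {j u} → Cyclic v j u → ∀ k → i ℕ.≤ j ℕ.+ k → pow N k $ u ≈ 0V
  Cyclic-vanish e generator k i≤ = pow-vanish N i≤ e
  Cyclic-vanish e (respects e′ p) k i≤ = ≈-trans (resp (pow N k) (≈-sym e′)) (Cyclic-vanish e p k i≤)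
  Cyclic-vanish e null k i≤ = zeroᶠ (pow N k)
  Cyclic-vanish e (plus {u = u} {w} p q) k i≤ = ≈-trans (add (pow N k) u w)
    (≈-trans (⊕-cong (Cyclic-vanish e p k i≤) (Cyclic-vanish e q k i≤)) (λ _ → solve 0 (:0 :+ :0 := :0) refl))
  Cyclic-vanish e (times {u = u} a p) k i≤ = ≈-trans (scale (pow N k) a u)
    (≈-trans (•-congˡ a (Cyclic-vanish e p k i≤)) (λ _ → *-zeroʳ a))
  Cyclic-vanish e (shift {j} {u} p) k i≤ = ≈-trans (≈-sym (pow-suc N k u))
    (Cyclic-vanish e p (suc k) (ℕₚ.≤-trans i≤ (ℕₚ.≤-reflexive (sym (ℕₚ.+-suc j k)))))
  Cyclic-vanish e (weaken p) k i≤ = Cyclic-vanish e p k (ℕₚ.m≤n⇒m≤1+n i≤)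
  Cyclic-vanish e (unshift {u = u} p) k i≤ = ≈-trans (pow-commute N G⁻ (λ w → ≈-sym (G⁻-N w)) k u)
    (resp-0 G⁻ (Cyclic-vanish e p k i≤))

  -- An operator commuting with N also commutes with g⁻¹, so its effect on the cyclic submodule is
  -- dictated by its value at v: if v is raised by one level, everything is.
  Cyclic-raise : ∀ A → Commute A N → ∀ {v} → Cyclic v 1 (A $ v) → ∀ {j u} → Cyclic v j u → Cyclic v (suc j) (A $ u)
  Cyclic-raise A com p generator = p
  Cyclic-raise A com p (respects e q) = respects (resp A e) (Cyclic-raise A com p q)
  Cyclic-raise A com p null = respects (≈-sym (zeroᶠ A)) null
  Cyclic-raise A com p (plus {u = u} {w} q q′) = respects (≈-sym (add A u w)) (plus (Cyclic-raise A com p q) (Cyclic-raise A com p q′))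
  Cyclic-raise A com p (times {u = u} a q) = respects (≈-sym (scale A a u)) (times a (Cyclic-raise A com p q))
  Cyclic-raise A com p (shift {u = u} q) = respects (≈-sym (com u)) (shift (Cyclic-raise A com p q))
  Cyclic-raise A com p (weaken q) = weaken (Cyclic-raise A com p q)
  Cyclic-raise A com p (unshift {u = u} q) = respects (≈-sym (commute-G⁻ A (commute-G A com) u)) (unshift (Cyclic-raise A com p q))

  Cyclic-M : ∀ {v j u} → Cyclic v j u → Cyclic v (suc j) (M $ u)
  Cyclic-M {u = u} p = respects (≈-sym (M≈-G⁻N u)) (times (- 1#) (unshift (shift p)))

  Cyclic-pow : ∀ A → Commute A N → ∀ {v} → Cyclic v 1 (A $ v) → ∀ k {u} → Cyclic v 0 u → Cyclic v k (pow A k $ u)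
  Cyclic-pow A com p zero    q = q
  Cyclic-pow A com p (suc k) q = Cyclic-raise A com p (Cyclic-pow A com p k q)

  Cyclic-nilpotent : ∀ A → Commute A N → ∀ {v} → Cyclic v 1 (A $ v) → ∀ k → Ker k v →
                     ∀ {u} → Cyclic v 0 u → pow A (suc k) $ u ≈ 0V
  Cyclic-nilpotent A com p k e q = Cyclic-vanish e (Cyclic-pow A com p (suc k) q) 0 (ℕₚ.m≤m+n (suc k) 0)

  -- Operators commuting with g that have image in a cyclic submodule.

  rank-one : Operator → V → V → Operator
  rank-one A v w = record
    { fn = λ u → B (A $ u) v • w
    ; resp = λ e → •-cong (B-congˡ v (resp A e)) (≈-refl {w})
    ; add = λ u u′ i → trans (cong (_* w i) (trans (B-congˡ v (add A u u′)) (B-addˡ (A $ u) (A $ u′) v)))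
        (solve 3 (λ a b x → (a :+ b) :* x := a :* x :+ b :* x) refl (B (A $ u) v) (B (A $ u′) v) (w i))
    ; scale = λ a u i → trans (cong (_* w i) (trans (B-congˡ v (scale A a u)) (B-scaleˡ a (A $ u) v)))
        (solve 3 (λ a b x → a :* b :* x := a :* (b :* x)) refl a (B (A $ u) v) (w i)) }

  -- The operator u ↦ Σ_{a+b=k-1} B(N^a u, v) N^b v, and its adjoint with respect to B.
  L L* : ℕ → V → Operator
  L  zero    v = 0# ⊡ 𝟙
  L  (suc k) v = N ∘ᵒ L k v ⊞ rank-one (pow N k) v v
  L* zero    v = 0# ⊡ 𝟙
  L* (suc k) v = L* k v ∘ᵒ M ⊞ rank-one 𝟙 v (pow M k $ v)

  L-adjoint : ∀ k v u z → B (L k v $ u) z ≡ B u (L* k v $ z)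
  L-adjoint zero    v u z = trans (B-scaleˡ 0# u z) (sym (B-scaleʳ 0# u z))
  L-adjoint (suc k) v u z = begin
    B ((N $ L k v $ u) ⊕ B (pow N k $ u) v • v) z
      ≡⟨ B-addˡ (N $ L k v $ u) (B (pow N k $ u) v • v) z ⟩
    B (N $ L k v $ u) z + B (B (pow N k $ u) v • v) z
      ≡⟨ cong₂ _+_ (trans (adjoint (L k v $ u) z) (L-adjoint k v u (M $ z))) (B-scaleˡ (B (pow N k $ u) v) v z) ⟩
    B u (L* k v $ M $ z) + B (pow N k $ u) v * B v z
      ≡⟨ cong (B u (L* k v $ M $ z) +_) (trans (cong₂ _*_ (adjoint-pow k u v) (B-sym v z))
           (solve 2 (λ a b → a :* b := b :* a) refl (B u (pow M k $ v)) (B z v))) ⟩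
    B u (L* k v $ M $ z) + B z v * B u (pow M k $ v)
      ≡⟨ cong (B u (L* k v $ M $ z) +_) (sym (B-scaleʳ (B z v) u (pow M k $ v))) ⟩
    B u (L* k v $ M $ z) + B u (B z v • (pow M k $ v))
      ≡⟨ sym (B-addʳ u (L* k v $ M $ z) (B z v • (pow M k $ v))) ⟩
    B u (L* (suc k) v $ z) ∎
    where open ≡-Reasoning

  -- In the commutator of L and N the sum telescopes to its two end terms. Placing one on each side
  -- gives a subtraction-free identity that passes through the induction.
  L-N : ∀ k v u → (L k v $ N $ u) ⊕ B u v • (pow N k $ v) ≈ (N $ L k v $ u) ⊕ B (pow N k $ u) v • v
  L-N zero    v u i = trans (solve 3 (λ a b x → :0 :* a :+ b :* x := :0 :+ b :* x) refl ((N $ u) i) (B u v) (v i))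
    (cong (_+ B u v * v i) (sym (trans (scale N 0# u i) (solve 1 (λ a → :0 :* a := :0) refl ((N $ u) i)))))
  L-N (suc k) v u = begin
    (N $ L k v $ N $ u) ⊕ B (pow N k $ N $ u) v • v ⊕ B u v • (N $ pow N k $ v)
      ≈⟨ (λ i → solve 3 (λ a b d → a :+ b :+ d := a :+ d :+ b) refl ((N $ L k v $ N $ u) i) ((B (pow N k $ N $ u) v • v) i) ((B u v • (N $ pow N k $ v)) i)) ⟩
    (N $ L k v $ N $ u) ⊕ B u v • (N $ pow N k $ v) ⊕ B (pow N k $ N $ u) v • v
      ≈⟨ ⊕-cong (≈-trans (⊕-cong (≈-refl {N $ L k v $ N $ u}) (≈-sym (scale N (B u v) (pow N k $ v)))) (≈-sym (add N (L k v $ N $ u) (B u v • (pow N k $ v)))))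
                (•-cong (B-congˡ v (≈-sym (pow-suc N k u))) (≈-refl {v})) ⟩
    (N $ ((L k v $ N $ u) ⊕ B u v • (pow N k $ v))) ⊕ B (pow N (suc k) $ u) v • v
      ≈⟨ ⊕-cong (resp N (L-N k v u)) (≈-refl {B (pow N (suc k) $ u) v • v}) ⟩
    (N $ L (suc k) v $ u) ⊕ B (pow N (suc k) $ u) v • v ∎
    where open ≈-Reasoning

  -- Both end terms of `L-N` vanish: one contains N^(k+1) v, the other equals B(u, M^(k+1) v).
  L-commute : ∀ k {v} → Ker k v → Commute (L (suc k) v) N
  L-commute k {v} e u = begin
    L (suc k) v $ N $ u                                         ≈⟨ (λ i → solve 1 (λ a → a := a :+ :0) refl ((L (suc k) v $ N $ u) i)) ⟩
    (L (suc k) v $ N $ u) ⊕ 0V                                  ≈⟨ ⊕-cong (≈-refl {L (suc k) v $ N $ u}) (λ i → trans (sym (*-zeroʳ (B u v))) (cong (B u v *_) (sym (e i)))) ⟩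
    (L (suc k) v $ N $ u) ⊕ B u v • (pow N (suc k) $ v)         ≈⟨ L-N (suc k) v u ⟩
    (N $ L (suc k) v $ u) ⊕ B (pow N (suc k) $ u) v • v         ≈⟨ ⊕-cong (≈-refl {N $ L (suc k) v $ u}) (λ i → trans (cong (_* v i) (trans (adjoint-pow (suc k) u v) (B-0ʳ u (pow-M-vanish (suc k) e)))) (solve 1 (λ a → :0 :* a := :0) refl (v i))) ⟩
    (N $ L (suc k) v $ u) ⊕ 0V                                  ≈⟨ (λ i → solve 1 (λ a → a :+ :0 := a) refl ((N $ L (suc k) v $ u) i)) ⟩
    N $ L (suc k) v $ u ∎
    where open ≈-Reasoning

  -- Taking adjoints in `L-commute` shows that L* commutes with M, by nondegeneracy of B; hence it
  -- commutes with g⁻¹ = M + 1, with g and with N.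
  L*-commute : ∀ k {v} → Ker k v → Commute (L* (suc k) v) N
  L*-commute k {v} e = commute-N L′ (λ z → begin
    L′ $ G $ z               ≈⟨ ≈-sym (G-G⁻ _) ⟩
    G $ G⁻ $ L′ $ G $ z      ≈⟨ resp G (≈-sym (commute (G $ z))) ⟩
    G $ L′ $ G⁻ $ G $ z      ≈⟨ resp G (resp L′ (G⁻-G z)) ⟩
    G $ L′ $ z ∎)
    where
    L′ = L* (suc k) v
    L′-M : Commute L′ M
    L′-M z = B-nondegenerate nondegenerate (λ u → trans (sym (L-adjoint (suc k) v u (M $ z)))
      (trans (sym (adjoint (L (suc k) v $ u) z)) (trans (B-congˡ z (≈-sym (L-commute k e u)))
      (trans (L-adjoint (suc k) v (N $ u) z) (adjoint u (L′ $ z))))))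
    commute : Commute L′ G⁻
    commute z = ≈-trans (resp L′ (M+1 z)) (≈-trans (add L′ (M $ z) z)
      (≈-trans (⊕-cong (L′-M z) (≈-refl {L′ $ z})) (≈-sym (M+1 (L′ $ z)))))
      where
      M+1 : ∀ z → G⁻ $ z ≈ (M $ z) ⊕ z
      M+1 z i = solve 2 (λ a b → a := a :+ :- :1 :* b :+ b) refl ((G⁻ $ z) i) (z i)
    open ≈-Reasoning

-- Reflections and transvections lifted to the centralizer of g.

module Centralizer (𝔽 : FiniteField) (m : ℕ) (c : LinAlg.QForm 𝔽 m) (nondegenerate : LinAlg.Nondegenerate 𝔽 m c)
                   (g : LinAlg.Mat 𝔽 m) (g∈O : LinAlg.InO 𝔽 m c g) where
  open Isometry 𝔽 m c nondegenerate g g∈O public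

  L-cyclic : ∀ k v u → Cyclic v 0 (L k v $ u)
  L-cyclic zero    v u = respects (λ i → solve 1 (λ a → :0 := :0 :* a) refl (u i)) null
  L-cyclic (suc k) v u = plus (weaken (shift (L-cyclic k v u))) (times (B (pow N k $ u) v) generator)

  -- All terms of the sum except b = 0 carry a factor N, so modulo level 1 only a multiple of v
  -- survives.
  L-leading : ∀ k v u → Cyclic v 1 ((L (suc k) v $ u) ⊖ B (pow N k $ u) v • v)
  L-leading k v u = respects (λ i → solve 2 (λ a b → a := a :+ b :+ :- b) refl ((N $ L k v $ u) i) ((B (pow N k $ u) v • v) i))
    (shift (L-cyclic k v u))

  Cyclic-pow-M : ∀ k {v} → Cyclic v 0 (pow M k $ v)
  Cyclic-pow-M zero    = generator
  Cyclic-pow-M (suc k) = weaken (Cyclic-M (Cyclic-pow-M k))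

  L*-cyclic : ∀ k v u → Cyclic v 0 (L* k v $ u)
  L*-cyclic zero    v u = respects (λ i → solve 1 (λ a → :0 := :0 :* a) refl (u i)) null
  L*-cyclic (suc k) v u = plus (L*-cyclic k v (M $ u)) (times (B u v) (Cyclic-pow-M k))

  -- Unrolled, this adjoint is the sum of B(M^a u, v) M^b v over a + b = k, and M raises the level,
  -- so again only b = 0 survives.
  L*-leading : ∀ k v u → Cyclic v 1 ((L* (suc k) v $ u) ⊖ B (pow M k $ u) v • v)
  L*-leading zero    v u = respects (λ i → solve 2 (λ a b → :0 := :0 :* a :+ b :+ :- b) refl ((M $ u) i) ((B u v • v) i)) null
  L*-leading (suc k) v u = respects
    (λ i → trans
      (solve 3 (λ a b d → a :+ :- d :+ b := a :+ b :+ :- d) refl ((L* (suc k) v $ M $ u) i) ((B u v • (pow M (suc k) $ v)) i) ((B (pow M k $ M $ u) v • v) i))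
      (cong (λ x → (L* (suc (suc k)) v $ u) i + - (x * v i)) (B-congˡ v (≈-sym (pow-suc M k u)))))
    (plus (L*-leading k v (M $ u)) (times (B u v) (Cyclic-M (Cyclic-pow-M k))))

  -- The symmetrisation of L: since σ² = 1, the adjoint of T is σ T. For v in `Ker k` the two
  -- leading coefficients agree, which produces the factor `two` in `T-leading`. The scalar t is
  -- left free for normalisation.
  T : F → ℕ → V → Operator
  T t k v = t ⊡ (L* (suc k) v ⊞ σ k ⊡ L (suc k) v)

  T-commute : ∀ t k {v} → Ker k v → Commute (T t k v) N
  T-commute t k {v} e = ⊡-commute t (L* (suc k) v ⊞ σ k ⊡ L (suc k) v) N
    (⊞-commute (L* (suc k) v) (σ k ⊡ L (suc k) v) N (L*-commute k e) (⊡-commute (σ k) (L (suc k) v) N (L-commute k e)))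

  T-cyclic : ∀ t k v u → Cyclic v 0 (T t k v $ u)
  T-cyclic t k v u = times t (plus (L*-cyclic (suc k) v u) (times (σ k) (L-cyclic (suc k) v u)))

  T-leading : ∀ t k {v} → Ker k v → ∀ u → Cyclic v 1 ((T t k v $ u) ⊖ (two * t * β k u v) • v)
  T-leading t k {v} e u = respects
    (λ i → trans (cong₂ (λ x y → t * ((L* (suc k) v $ u) i + - (x * v i) + σ k * ((L (suc k) v $ u) i + - (y * v i))))
                   (trans (sym (trans (B-congˡ u (≈-refl {pow N k $ v})) (trans (adjoint-pow k v u) (B-sym v (pow M k $ u))))) (B-sym (pow N k $ v) u))
                   (pow-adjoint-Ker k u e))
           (trans (solve 6 (λ t l* l s b x → t :* (l* :+ :- (b :* x) :+ s :* (l :+ :- (s :* b :* x)))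
               := t :* (l* :+ s :* l) :+ :- (t :* b :+ s :* s :* (t :* b)) :* x) refl
               t ((L* (suc k) v $ u) i) ((L (suc k) v $ u) i) (σ k) (β k u v) (v i))
           (trans (cong (λ y → t * ((L* (suc k) v $ u) i + σ k * (L (suc k) v $ u) i) + - (t * β k u v + y * (t * β k u v)) * v i) (σ-square k))
             (solve 4 (λ a t b x → a :+ :- (t :* b :+ :1 :* (t :* b)) :* x := a :+ :- ((:1 :+ :1) :* t :* b :* x)) refl
               ((T t k v $ u) i) t (β k u v) (v i)))))
    (times t (plus (L*-leading k v u) (times (σ k) (L-leading k v u))))

  T-adjoint : ∀ t k v u z → B (T t k v $ u) z ≡ σ k * B u (T t k v $ z)
  T-adjoint t k v u z = begin
    B (T t k v $ u) z                                      ≡⟨ B-scaleˡ t _ z ⟩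
    t * B ((A* $ u) ⊕ σ k • (A $ u)) z                     ≡⟨ cong (t *_) (trans (B-addˡ (A* $ u) _ z) (cong₂ _+_ swap (trans (B-scaleˡ (σ k) (A $ u) z) (cong (σ k *_) (L-adjoint (suc k) v u z))))) ⟩
    t * (B u (A $ z) + σ k * B u (A* $ z))                 ≡⟨ cong (λ y → t * (y + σ k * B u (A* $ z))) (trans (solve 1 (λ a → a := :1 :* a) refl (B u (A $ z))) (cong (_* B u (A $ z)) (sym (σ-square k)))) ⟩
    t * (σ k * σ k * B u (A $ z) + σ k * B u (A* $ z))     ≡⟨ solve 4 (λ t s a b → t :* (s :* s :* a :+ s :* b) := s :* (t :* (b :+ s :* a))) refl t (σ k) (B u (A $ z)) (B u (A* $ z)) ⟩
    σ k * (t * (B u (A* $ z) + σ k * B u (A $ z)))         ≡⟨ cong (λ y → σ k * (t * (B u (A* $ z) + y))) (sym (B-scaleʳ (σ k) u (A $ z))) ⟩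
    σ k * (t * (B u (A* $ z) + B u (σ k • (A $ z))))       ≡⟨ cong (λ y → σ k * (t * y)) (sym (B-addʳ u (A* $ z) _)) ⟩
    σ k * (t * B u ((A* $ z) ⊕ σ k • (A $ z)))             ≡⟨ cong (σ k *_) (sym (B-scaleʳ t u _)) ⟩
    σ k * B u (T t k v $ z) ∎
    where
    open ≡-Reasoning
    A  = L (suc k) v
    A* = L* (suc k) v
    swap : B (A* $ u) z ≡ B u (A $ z)
    swap = trans (B-sym (A* $ u) z) (trans (sym (L-adjoint (suc k) v z u)) (B-sym (A $ z) u))

  record CentralizerElement : Set where
    field
      op inv    : Operator
      commutes  : Commute op N
      isometric : Isometric op
      inv-op    : ∀ v → inv $ op $ v ≈ v
      op-inv    : ∀ v → op $ inv $ v ≈ v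

  -- T is symmetric, has image in the cyclic submodule of v and fixes v modulo N times it. Hence (1 - T)^i is
  -- the orthogonal projection onto the complement of that submodule, and 2 (1 - T)^i - 1 is a reflection.
  module Reflection (k : ℕ) (v : V) (v∈Ker : Ker k v) (σ≡1 : σ k ≡ 1#) (t : F) (2tβ≡1 : two * t * β k v v ≡ 1#) where
    private
      S A E H : Operator
      S = T t k v
      A = 𝟙 ⊞ (- 1#) ⊡ S
      E = pow A (suc k)
      H = two ⊡ E ⊞ (- 1#) ⊡ 𝟙

      A-commute : Commute A N
      A-commute = ⊞-commute 𝟙 ((- 1#) ⊡ S) N (λ u → ≈-refl {N $ u}) (⊡-commute (- 1#) S N (T-commute t k v∈Ker))

      -- By the choice of t the leading coefficient of S v is 1, so v itself cancels from v - S v.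
      A-lowers : Cyclic v 1 (A $ v)
      A-lowers = respects (λ i → trans
          (cong (λ x → - 1# * ((S $ v) i + - (x * v i))) 2tβ≡1)
          (solve 2 (λ s x → :- :1 :* (s :+ :- (:1 :* x)) := x :+ :- :1 :* s) refl ((S $ v) i) (v i)))
        (times (- 1#) (T-leading t k v∈Ker v))

      -- S lands in the cyclic submodule of v, and the k + 1 applications of A raise the level there
      -- until nothing is left. Consequently E (1 - S) = E, and E is idempotent.
      E-S : ∀ u → E $ S $ u ≈ 0V
      E-S u = Cyclic-nilpotent A A-commute A-lowers k v∈Ker (T-cyclic t k v u)

      A-E : ∀ u → A $ E $ u ≈ E $ u
      A-E u = begin
        pow A (suc (suc k)) $ u            ≈⟨ pow-suc A (suc k) u ⟩
        E $ (u ⊕ (- 1#) • (S $ u))         ≈⟨ add E u ((- 1#) • (S $ u)) ⟩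
        (E $ u) ⊕ (E $ ((- 1#) • (S $ u)))   ≈⟨ ⊕-cong (≈-refl {E $ u}) (≈-trans (scale E (- 1#) (S $ u)) (•-congˡ (- 1#) (E-S u))) ⟩
        (E $ u) ⊕ (- 1#) • 0V              ≈⟨ (λ i → solve 1 (λ a → a :+ :- :1 :* :0 := a) refl ((E $ u) i)) ⟩
        E $ u ∎
        where open ≈-Reasoning

      pow-A-E : ∀ j u → pow A j $ E $ u ≈ E $ u
      pow-A-E zero    u = ≈-refl {E $ u}
      pow-A-E (suc j) u = ≈-trans (resp A (pow-A-E j u)) (A-E u)

      A-symmetric : ∀ u z → B (A $ u) z ≡ B u (A $ z)
      A-symmetric u z = begin
        B (A $ u) z                        ≡⟨ trans (B-addˡ u ((- 1#) • (S $ u)) z) (cong (B u z +_) (B-scaleˡ (- 1#) (S $ u) z)) ⟩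
        B u z + - 1# * B (S $ u) z         ≡⟨ cong (λ x → B u z + - 1# * x) (trans (T-adjoint t k v u z) (trans (cong (_* B u (S $ z)) σ≡1) (solve 1 (λ a → :1 :* a := a) refl (B u (S $ z))))) ⟩
        B u z + - 1# * B u (S $ z)         ≡⟨ sym (trans (B-addʳ u z ((- 1#) • (S $ z))) (cong (B u z +_) (B-scaleʳ (- 1#) u (S $ z)))) ⟩
        B u (A $ z) ∎
        where open ≡-Reasoning

      pow-A-symmetric : ∀ j u z → B (pow A j $ u) z ≡ B u (pow A j $ z)
      pow-A-symmetric zero    u z = refl
      pow-A-symmetric (suc j) u z = trans (A-symmetric (pow A j $ u) z)
        (trans (pow-A-symmetric j u (A $ z)) (B-congʳ u (≈-sym (pow-suc A j z))))

      H-involutive : ∀ u → H $ H $ u ≈ u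
      H-involutive u = begin
        two • (E $ (two • (E $ u) ⊕ (- 1#) • u)) ⊕ (- 1#) • (H $ u)
          ≈⟨ ⊕-cong (•-congˡ two (≈-trans (add E (two • (E $ u)) ((- 1#) • u))
               (⊕-cong (≈-trans (scale E two (E $ u)) (•-congˡ two (pow-A-E (suc k) u))) (scale E (- 1#) u))))
               (≈-refl {(- 1#) • (H $ u)}) ⟩
        two • (two • (E $ u) ⊕ (- 1#) • (E $ u)) ⊕ (- 1#) • (H $ u)
          ≈⟨ (λ i → solve 2 (λ e x → (:1 :+ :1) :* ((:1 :+ :1) :* e :+ :- :1 :* e) :+ :- :1 :* ((:1 :+ :1) :* e :+ :- :1 :* x) := x) refl ((E $ u) i) (u i)) ⟩
        u ∎
        where open ≈-Reasoning

      H-symmetric : ∀ u z → B (H $ u) z ≡ B u (H $ z)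
      H-symmetric u z = begin
        B (H $ u) z                        ≡⟨ trans (B-addˡ (two • (E $ u)) ((- 1#) • u) z) (cong₂ _+_ (B-scaleˡ two (E $ u) z) (B-scaleˡ (- 1#) u z)) ⟩
        two * B (E $ u) z + - 1# * B u z   ≡⟨ cong (λ x → two * x + - 1# * B u z) (pow-A-symmetric (suc k) u z) ⟩
        two * B u (E $ z) + - 1# * B u z   ≡⟨ sym (trans (B-addʳ u (two • (E $ z)) ((- 1#) • z)) (cong₂ _+_ (B-scaleʳ two u (E $ z)) (B-scaleʳ (- 1#) u z))) ⟩
        B u (H $ z) ∎
        where open ≡-Reasoning

      -- A^(j+2) - A = A (A^(j+1) - A) - A S, and A sends the cyclic submodule into its first level.
      -- Thus E agrees with 1 - S, and the reflection with 1 - 2 S, modulo N V.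
      pow-A-leading : ∀ j u → Cyclic v 1 ((pow A (suc j) $ u) ⊖ (A $ u))
      pow-A-leading zero u = respects (λ i → solve 1 (λ a → :0 := a :+ :- a) refl ((A $ u) i)) null
      pow-A-leading (suc j) u = respects
        (λ i → trans (cong (_+ - 1# * (A $ S $ u) i) (trans (sub A (pow A (suc j) $ u) (A $ u) i)
                 (cong (λ x → (pow A (suc (suc j)) $ u) i + - x)
                   (trans (add A u ((- 1#) • (S $ u)) i) (cong ((A $ u) i +_) (scale A (- 1#) (S $ u) i))))))
               (solve 3 (λ p a s → p :+ :- (a :+ :- :1 :* s) :+ :- :1 :* s := p :+ :- a) refl
                 ((pow A (suc (suc j)) $ u) i) ((A $ u) i) ((A $ S $ u) i)))
        (plus (weaken (Cyclic-raise A A-commute A-lowers (pow-A-leading j u)))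
              (times (- 1#) (Cyclic-raise A A-commute A-lowers (T-cyclic t k v u))))

    reflection : CentralizerElement
    reflection = record
      { op = H ; inv = H
      ; commutes = ⊞-commute (two ⊡ E) ((- 1#) ⊡ 𝟙) N (⊡-commute two E N (pow-commute A N A-commute (suc k)))
          (⊡-commute (- 1#) 𝟙 N (λ u → ≈-refl {N $ u}))
      ; isometric = λ u z → trans (H-symmetric u (H $ z)) (B-congʳ u (H-involutive z))
      ; inv-op = H-involutive ; op-inv = H-involutive }

    -- As 2 t is the inverse of β(v,v), the scalar is 2 β(u,v) / β(v,v): modulo N V this is the
    -- classical formula for the reflection in v.
    reflection-leading : ∀ u → InN ((H $ u) ⊖ (u ⊖ (two * (two * t * β k u v)) • v))
    reflection-leading u = InN-resp
      (λ i → solve 5 (λ e x s b y → (:1 :+ :1) :* (e :+ :- (x :+ :- :1 :* s)) :+ :- (:1 :+ :1) :* (s :+ :- (b :* y))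
                := (:1 :+ :1) :* e :+ :- :1 :* x :+ :- (x :+ :- ((:1 :+ :1) :* b :* y))) refl
           ((E $ u) i) (u i) ((S $ u) i) (two * t * β k u v) (v i))
      (Cyclic⇒InN (plus (times two (pow-A-leading k u)) (times (- two) (T-leading t k v∈Ker u))))

  -- The Cayley transform (1 + S)/(1 - S) of a nilpotent skew operator.
  module Cayley (S : Operator) (n : ℕ) (S-nilpotent : ∀ u → pow S (suc n) $ u ≈ 0V) (S-N : Commute S N)
                (S-skew : ∀ u z → B (S $ u) z ≡ - B u (S $ z)) where

    geometric : Operator → ℕ → Operator
    geometric A zero    = 𝟙
    geometric A (suc j) = 𝟙 ⊞ A ∘ᵒ geometric A j

    geometric-commute : ∀ A C → Commute A C → ∀ j → Commute (geometric A j) C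
    geometric-commute A C e zero    = λ u → ≈-refl {C $ u}
    geometric-commute A C e (suc j) = ⊞-commute 𝟙 (A ∘ᵒ geometric A j) C (λ u → ≈-refl {C $ u})
      (∘-commute A (geometric A j) C e (geometric-commute A C e j))

    geometric-sum : ∀ A j u → geometric A j $ u ≈ u ⊕ (A $ geometric A j $ u) ⊖ (pow A (suc j) $ u)
    geometric-sum A zero    u i = solve 2 (λ a b → a := a :+ b :+ :- b) refl (u i) ((A $ u) i)
    geometric-sum A (suc j) u = begin
      u ⊕ (A $ geometric A j $ u)
        ≈⟨ ⊕-cong (≈-refl {u}) (≈-trans (resp A (geometric-sum A j u)) (sub A (geometric A (suc j) $ u) (pow A (suc j) $ u))) ⟩
      u ⊕ ((A $ geometric A (suc j) $ u) ⊖ (pow A (suc (suc j)) $ u))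
        ≈⟨ (λ i → solve 3 (λ a b d → a :+ (b :+ :- d) := a :+ b :+ :- d) refl (u i) ((A $ geometric A (suc j) $ u) i) ((pow A (suc (suc j)) $ u) i)) ⟩
      u ⊕ (A $ geometric A (suc j) $ u) ⊖ (pow A (suc (suc j)) $ u) ∎
      where open ≈-Reasoning

    private
      S⁻ R R⁻ H H⁻ : Operator
      S⁻ = (- 1#) ⊡ S
      R  = geometric S n
      R⁻ = geometric S⁻ n
      H  = R ⊞ S ∘ᵒ R
      H⁻ = R⁻ ⊞ S⁻ ∘ᵒ R⁻

      S⁻-nilpotent : ∀ u → pow S⁻ (suc n) $ u ≈ 0V
      S⁻-nilpotent u = ≈-trans (proj₂ (powers (suc n))) (≈-trans (•-congˡ (proj₁ (powers (suc n))) (S-nilpotent u)) (λ _ → *-zeroʳ _))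
        where
        powers : ∀ j → ∃ λ a → pow S⁻ j $ u ≈ a • (pow S j $ u)
        powers zero    = 1# , λ i → solve 1 (λ x → x := :1 :* x) refl (u i)
        powers (suc j) with powers j
        ... | a , e = - 1# * a , ≈-trans (•-congˡ (- 1#) (≈-trans (resp S e) (scale S a (pow S j $ u))))
          (λ i → solve 2 (λ a x → :- :1 :* (a :* x) := :- :1 :* a :* x) refl a ((pow S (suc j) $ u) i))

      fixpoint : ∀ A → (∀ u → pow A (suc n) $ u ≈ 0V) → ∀ u → geometric A n $ u ≈ u ⊕ (A $ geometric A n $ u)
      fixpoint A e u i = trans (geometric-sum A n u i) (trans (cong (λ x → u i + (A $ geometric A n $ u) i + - x) (e u i))
        (solve 2 (λ a b → a :+ b :+ :- :0 := a :+ b) refl (u i) ((A $ geometric A n $ u) i)))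

      R-fixpoint : ∀ u → R $ u ≈ u ⊕ (S $ R $ u)
      R-fixpoint = fixpoint S S-nilpotent

      R⁻-fixpoint : ∀ u → R⁻ $ u ≈ u ⊕ (S⁻ $ R⁻ $ u)
      R⁻-fixpoint = fixpoint S⁻ S⁻-nilpotent

      1-S∘R : ∀ u → (R $ u) ⊕ (S⁻ $ R $ u) ≈ u
      1-S∘R u i = trans (cong (_+ - 1# * (S $ R $ u) i) (R-fixpoint u i))
        (solve 2 (λ a b → a :+ b :+ :- :1 :* b := a) refl (u i) ((S $ R $ u) i))

      1+S∘R⁻ : ∀ u → (R⁻ $ u) ⊕ (S $ R⁻ $ u) ≈ u
      1+S∘R⁻ u i = trans (cong (_+ (S $ R⁻ $ u) i) (R⁻-fixpoint u i))
        (solve 2 (λ a b → a :+ :- :1 :* b :+ b := a) refl (u i) ((S $ R⁻ $ u) i))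

      R∘1-S : ∀ u → R $ (u ⊕ (S⁻ $ u)) ≈ u
      R∘1-S u = ≈-trans (geometric-commute S (𝟙 ⊞ S⁻) (λ w → ≈-sym (⊞-commute 𝟙 S⁻ S (λ x → ≈-refl {S $ x})
        (⊡-commute (- 1#) S S (λ x → ≈-refl {S $ S $ x})) w)) n u) (1-S∘R u)

      R⁻∘1+S : ∀ u → R⁻ $ (u ⊕ (S $ u)) ≈ u
      R⁻∘1+S u = ≈-trans (geometric-commute S⁻ (𝟙 ⊞ S) (⊡-commute (- 1#) S (𝟙 ⊞ S) (λ w → ≈-sym (⊞-commute 𝟙 S S (λ x → ≈-refl {S $ x})
        (λ x → ≈-refl {S $ S $ x}) w))) n u) (1+S∘R⁻ u)

      -- Skewness cancels the cross terms, so the result depends on s only through s². Hence 1 + S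
      -- and 1 - S pull B back to the same form, and their quotient is an isometry.
      B-1±S : ∀ s a b → B (a ⊕ s • (S $ a)) (b ⊕ s • (S $ b)) ≡ B a b + s * s * B (S $ a) (S $ b)
      B-1±S s a b = begin
        B (a ⊕ s • (S $ a)) (b ⊕ s • (S $ b))
          ≡⟨ trans (B-addˡ a (s • (S $ a)) _) (cong₂ _+_ (trans (B-addʳ a b _) (cong (B a b +_) (B-scaleʳ s a (S $ b))))
               (trans (B-scaleˡ s (S $ a) _) (cong (s *_) (trans (B-addʳ (S $ a) b _) (cong₂ _+_ (S-skew a b) (B-scaleʳ s (S $ a) (S $ b))))))) ⟩
        B a b + s * B a (S $ b) + s * (- B a (S $ b) + s * B (S $ a) (S $ b))
          ≡⟨ solve 4 (λ s p q r → p :+ s :* q :+ s :* (:- q :+ s :* r) := p :+ s :* s :* r) refl s (B a b) (B a (S $ b)) (B (S $ a) (S $ b)) ⟩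
        B a b + s * s * B (S $ a) (S $ b) ∎
        where open ≡-Reasoning

    transform : CentralizerElement
    transform = record
      { op = H ; inv = H⁻
      ; commutes = ⊞-commute R (S ∘ᵒ R) N R-N (∘-commute S R N S-N R-N)
      ; isometric = λ u w → begin
          B (H $ u) (H $ w)
            ≡⟨ B-cong (λ i → solve 2 (λ a b → a :+ b := a :+ :1 :* b) refl ((R $ u) i) ((S $ R $ u) i))
                      (λ i → solve 2 (λ a b → a :+ b := a :+ :1 :* b) refl ((R $ w) i) ((S $ R $ w) i)) ⟩
          B ((R $ u) ⊕ 1# • (S $ R $ u)) ((R $ w) ⊕ 1# • (S $ R $ w))
            ≡⟨ B-1±S 1# (R $ u) (R $ w) ⟩
          B (R $ u) (R $ w) + 1# * 1# * B (S $ R $ u) (S $ R $ w)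
            ≡⟨ cong (λ x → B (R $ u) (R $ w) + x * B (S $ R $ u) (S $ R $ w)) (solve 0 (:1 :* :1 := :- :1 :* :- :1) refl) ⟩
          B (R $ u) (R $ w) + - 1# * - 1# * B (S $ R $ u) (S $ R $ w)
            ≡⟨ sym (B-1±S (- 1#) (R $ u) (R $ w)) ⟩
          B ((R $ u) ⊕ (S⁻ $ R $ u)) ((R $ w) ⊕ (S⁻ $ R $ w))
            ≡⟨ B-cong (1-S∘R u) (1-S∘R w) ⟩
          B u w ∎
      ; inv-op = λ u → ≈-trans (⊕-cong (R⁻∘1+S (R $ u)) (•-congˡ (- 1#) (resp S (R⁻∘1+S (R $ u))))) (1-S∘R u)
      ; op-inv = λ u → ≈-trans (⊕-cong (R∘1-S (R⁻ $ u)) (resp S (R∘1-S (R⁻ $ u)))) (1+S∘R⁻ u) }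
      where
      open ≡-Reasoning
      R-N : Commute R N
      R-N = geometric-commute S N S-N n

    -- This is (1 + S)/(1 - S) = 1 + 2 S + 2 S²/(1 - S), where R inverts 1 - S.
    transform-leading : ∀ u → (H $ u) ⊖ (u ⊕ two • (S $ u)) ≈ two • (S $ S $ R $ u)
    transform-leading u i = trans
      (cong₂ (λ x y → x + y + - (u i + two * (S $ u) i)) (trans (R-fixpoint u i) (cong (u i +_) SR)) SR)
      (solve 3 (λ x s r → x :+ (s :+ r) :+ (s :+ r) :+ :- (x :+ (:1 :+ :1) :* s) := (:1 :+ :1) :* r) refl (u i) ((S $ u) i) ((S $ S $ R $ u) i))
      where
      SR : (S $ R $ u) i ≡ (S $ u) i + (S $ S $ R $ u) i
      SR = trans (resp S (R-fixpoint u) i) (add S u (S $ R $ u) i)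

  module Transvection (k : ℕ) (v : V) (v∈Ker : Ker k v) (σ≡-1 : σ k ≡ - 1#) (β≡0 : β k v v ≡ 0#) (t : F) where
    private
      S = T t k v

      S-lowers : Cyclic v 1 (S $ v)
      S-lowers = respects (λ i → trans (cong (λ b → (S $ v) i + - (two * t * b * v i)) β≡0)
          (solve 3 (λ s t x → s :+ :- ((:1 :+ :1) :* t :* :0 :* x) := s) refl ((S $ v) i) t (v i)))
        (T-leading t k v∈Ker v)

      -- Since β(v,v) = 0, S raises levels and its power k + 1 kills the cyclic submodule; one more
      -- power is needed to bring an arbitrary vector into that submodule.
      module C = Cayley S (suc k)
        (λ u → ≈-trans (pow-suc S (suc k) u) (Cyclic-nilpotent S (T-commute t k v∈Ker) S-lowers k v∈Ker (T-cyclic t k v u)))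
        (T-commute t k v∈Ker)
        (λ u z → trans (T-adjoint t k v u z) (trans (cong (_* B u (S $ z)) σ≡-1) (solve 1 (λ a → :- :1 :* a := :- a) refl (B u (S $ z)))))

    transvection : CentralizerElement
    transvection = C.transform

    transvection-leading : ∀ u → InN ((CentralizerElement.op transvection $ u) ⊖ (u ⊕ (two * (two * t * β k u v)) • v))
    transvection-leading u = InN-resp
      (λ i → trans (cong (_+ two * ((S $ u) i + - (two * t * β k u v * v i))) (sym (C.transform-leading u i)))
        (solve 5 (λ h x s b y → h :+ :- (x :+ (:1 :+ :1) :* s) :+ (:1 :+ :1) :* (s :+ :- (b :* y)) := h :+ :- (x :+ (:1 :+ :1) :* b :* y)) refl
          ((CentralizerElement.op transvection $ u) i) (u i) ((S $ u) i) (two * t * β k u v) (v i)))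
      (Cyclic⇒InN (plus (times two (Cyclic-raise S (T-commute t k v∈Ker) S-lowers (T-cyclic t k v _)))
                        (times two (T-leading t k v∈Ker u))))

-- Orbits of the centralizer modulo N V and their complete invariant.

module Orbits (𝔽 : FiniteField) (two≢0 : CharacteristicNot2 𝔽) (m : ℕ)
              (c : LinAlg.QForm 𝔽 m) (nondegenerate : LinAlg.Nondegenerate 𝔽 m c)
              (g : LinAlg.Mat 𝔽 m) (g∈O : LinAlg.InO 𝔽 m c g) where
  open Centralizer 𝔽 m c nondegenerate g g∈O public

  open CentralizerElement

  pow-op : ∀ h k v → pow N k $ op h $ v ≈ op h $ pow N k $ v
  pow-op h k v = pow-commute N (op h) (λ u → ≈-sym (commutes h u)) k v

  compose : CentralizerElement → CentralizerElement → CentralizerElement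
  compose h h′ = record
    { op = op h ∘ᵒ op h′ ; inv = inv h′ ∘ᵒ inv h
    ; commutes = ∘-commute (op h) (op h′) N (commutes h) (commutes h′)
    ; isometric = λ u v → trans (isometric h (op h′ $ u) (op h′ $ v)) (isometric h′ u v)
    ; inv-op = λ v → ≈-trans (resp (inv h′) (inv-op h (op h′ $ v))) (inv-op h′ v)
    ; op-inv = λ v → ≈-trans (resp (op h) (op-inv h′ (inv h $ v))) (op-inv h v) }

  negation : CentralizerElement
  negation = record
    { op = (- 1#) ⊡ 𝟙 ; inv = (- 1#) ⊡ 𝟙
    ; commutes = ⊡-commute (- 1#) 𝟙 N (λ v → ≈-refl {N $ v})
    ; isometric = λ u v → trans (B-scaleˡ (- 1#) u _) (trans (cong (- 1# *_) (B-scaleʳ (- 1#) u v))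
        (solve 1 (λ b → :- :1 :* (:- :1 :* b) := b) refl (B u v)))
    ; inv-op = λ v i → solve 1 (λ x → :- :1 :* (:- :1 :* x) := x) refl (v i)
    ; op-inv = λ v i → solve 1 (λ x → :- :1 :* (:- :1 :* x) := x) refl (v i) }

  Orbit : V → V → Set
  Orbit x y = ∃ λ h → InN ((op h $ x) ⊖ y)

  Orbit-trans : ∀ {x y z} → Orbit x y → Orbit y z → Orbit x z
  Orbit-trans {x} {y} {z} (h , p) (h′ , q) = compose h′ h , InN-resp
    (λ i → trans (cong (_+ ((op h′ $ y) i + - z i)) (sub (op h′) (op h $ x) y i))
      (solve 3 (λ a b d → a :+ :- b :+ (b :+ :- d) := a :+ :- d) refl ((op h′ $ op h $ x) i) ((op h′ $ y) i) (z i)))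
    (InN-⊕ (InN-map (op h′) (commutes h′) p) q)

  Orbit⇒SameOrbit : ∀ {x y} → Orbit x y → SameOrbit c g x y
  Orbit⇒SameOrbit {x} {y} (h , r , e) = matrix (op h) ,
    (((matrix (inv h) , (λ v → ≈-trans (matrix-· (inv h) _) (≈-trans (resp (inv h) (matrix-· (op h) v)) (inv-op h v)))
                      , (λ v → ≈-trans (matrix-· (op h) _) (≈-trans (resp (op h) (matrix-· (inv h) v)) (op-inv h v)))) ,
      (λ v → trans (Qv-cong (matrix-· (op h) v)) (isometric⇒Qv-preserving two≢0 (op h) (isometric h) v))) ,
     (λ v → ≈-trans (matrix-· (op h) _) (≈-trans (commute-G (op h) (commutes h) v) (resp G (≈-sym (matrix-· (op h) v)))))) ,
    -- Commutators are written v - g v, the negative of N v, hence the sign of the witness.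
    (- 1#) • r , λ i → trans (cong (_+ - y i) (matrix-· (op h) x i)) (trans (e i) (trans
      (solve 2 (λ a b → a :+ :- b := :- :1 :* b :+ :- (:- :1 :* a)) refl ((G $ r) i) (r i))
      (cong (λ s → - 1# * r i + - s) (sym (scale G (- 1#) r i)))))

  SameOrbit⇒Orbit : ∀ {x y} → SameOrbit c g x y → Orbit x y
  SameOrbit⇒Orbit (h , (((h⁻ , l , r) , pres) , com) , w , e) = record
    { op = ⟪ h ⟫ ; inv = ⟪ h⁻ ⟫ ; commutes = commute-N ⟪ h ⟫ com
    ; isometric = Qv-preserving⇒isometric ⟪ h ⟫ pres ; inv-op = l ; op-inv = r } ,
    (- 1#) • w , λ i → trans (e i) (trans
      (solve 2 (λ a b → a :+ :- b := :- :1 :* (b :+ :- a)) refl (w i) ((G $ w) i))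
      (sym (scale N (- 1#) w i)))

  β-addˡ : ∀ k u v w → β k (u ⊕ v) w ≡ β k u w + β k v w
  β-addˡ k u v w = B-addˡ u v (pow N k $ w)

  β-addʳ : ∀ k u v w → β k u (v ⊕ w) ≡ β k u v + β k u w
  β-addʳ k u v w = trans (B-congʳ u (add (pow N k) v w)) (B-addʳ u _ _)

  β-scaleˡ : ∀ k a u v → β k (a • u) v ≡ a * β k u v
  β-scaleˡ k a u v = B-scaleˡ a u (pow N k $ v)

  β-scaleʳ : ∀ k a u v → β k u (a • v) ≡ a * β k u v
  β-scaleʳ k a u v = trans (B-congʳ u (scale (pow N k) a v)) (B-scaleʳ a u _)

  β-subˡ : ∀ k u v w → β k (u ⊖ v) w ≡ β k u w + - β k v w
  β-subˡ k u v w = B-subˡ u v (pow N k $ w)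

  β-subʳ : ∀ k u v w → β k u (v ⊖ w) ≡ β k u v + - β k u w
  β-subʳ k u v w = trans (B-congʳ u (sub (pow N k) v w)) (B-subʳ u _ _)

  Ker-⊕ : ∀ k {u v} → Ker k u → Ker k v → Ker k (u ⊕ v)
  Ker-⊕ k {u} {v} p q = ≈-trans (add (pow N (suc k)) u v) (≈-trans (⊕-cong p q) (λ _ → solve 0 (:0 :+ :0 := :0) refl))

  Ker-• : ∀ k a {u} → Ker k u → Ker k (a • u)
  Ker-• k a {u} p = ≈-trans (scale (pow N (suc k)) a u) (≈-trans (•-congˡ a p) (λ _ → *-zeroʳ a))

  Ker-⊖ : ∀ k {u v} → Ker k u → Ker k v → Ker k (u ⊖ v)
  Ker-⊖ k {u} {v} p q = ≈-trans (sub (pow N (suc k)) u v) (≈-trans (⊖-cong p q) (λ _ → solve 0 (:0 :+ :- :0 := :0) refl))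

  σ-nonzero : ∀ k → σ k ≢ 0#
  σ-nonzero k σ≡0 = 0≢1 (trans (sym (*-zeroʳ (σ k))) (trans (cong (σ k *_) (sym σ≡0)) (σ-square k)))

  x≡-x⇒x≡0 : ∀ {x} → x ≡ - x → x ≡ 0#
  x≡-x⇒x≡0 {x} e = *-cancelˡ two≢0 (trans (solve 1 (λ x → (:1 :+ :1) :* x := x :+ x) refl x)
    (trans (cong (x +_) e) (solve 1 (λ x → x :+ :- x := (:1 :+ :1) :* :0) refl x)))

  β-alternating : ∀ k → σ k ≡ - 1# → ∀ {v} → Ker k v → β k v v ≡ 0#
  β-alternating k σ≡-1 {v} e = x≡-x⇒x≡0 (trans (β-sym k v e) (trans (cong (_* β k v v) σ≡-1)
    (solve 1 (λ b → :- :1 :* b := :- b) refl (β k v v))))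

  β-symmetric : ∀ k → σ k ≡ 1# → ∀ u {v} → Ker k v → β k v u ≡ β k u v
  β-symmetric k σ≡1 u {v} e = trans (β-sym k u e) (trans (cong (_* β k u v) σ≡1) (solve 1 (λ b → :1 :* b := b) refl (β k u v)))

  -- The reflection or transvection along x - y moves x to y.
  direct-orbit : ∀ k {x y} → Ker k x → Ker k y → β k x x ≡ β k y y → β k x x ≢ β k x y → Orbit x y
  direct-orbit k {x} {y} x∈ y∈ qx≡qy qx≢βxy with σ-cases k
  ... | inj₁ σ≡1 = R.reflection , InN-resp
        (λ i → trans (cong (λ a → (op R.reflection $ x) i + - (x i + - (a * v i))) (trans (solve 3 (λ a t b → a :* (a :* t :* b) := a :* (a :* b) :* t) refl two t (β k x v)) scalar))
          (solve 3 (λ h x y → h :+ :- (x :+ :- (:1 :* (x :+ :- y))) := h :+ :- y) refl ((op R.reflection $ x) i) (x i) (y i)))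
        (R.reflection-leading x)
    where
    v = x ⊖ y
    d≢0 : β k x v ≢ 0#
    d≢0 e = qx≢βxy (x-y≡0⇒x≡y (trans (sym (β-subʳ k x x y)) e))
    -- Equal values at x and y give β(v,v) = 2 β(x,v). So t = 1 / (4 β(x,v)) both meets the
    -- normalisation of the reflection and makes the coefficient of v equal to 1, sending x to x - v
    -- = y.
    t = (two * (two * β k x v)) ⁻¹[ *-nonzero two≢0 (*-nonzero two≢0 d≢0) ]
    scalar : two * (two * β k x v) * t ≡ 1#
    scalar = *-inverse (two * (two * β k x v)) (*-nonzero two≢0 (*-nonzero two≢0 d≢0))
    βvv : β k v v ≡ two * β k x v
    βvv = begin
      β k v v                                               ≡⟨ β-subˡ k x y v ⟩
      β k x v + - β k y v                                   ≡⟨ cong (λ a → β k x v + - a) (β-subʳ k y x y) ⟩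
      β k x v + - (β k y x + - β k y y)                     ≡⟨ cong₂ (λ a b → β k x v + - (a + - b)) (β-symmetric k σ≡1 x y∈) (sym qx≡qy) ⟩
      β k x v + - (β k x y + - β k x x)                     ≡⟨ solve 3 (λ a b d → a :+ :- (b :+ :- d) := a :+ (d :+ :- b)) refl (β k x v) (β k x y) (β k x x) ⟩
      β k x v + (β k x x + - β k x y)                       ≡⟨ cong (β k x v +_) (sym (β-subʳ k x x y)) ⟩
      β k x v + β k x v                                     ≡⟨ solve 1 (λ a → a :+ a := (:1 :+ :1) :* a) refl (β k x v) ⟩
      two * β k x v ∎
      where open ≡-Reasoning
    module R = Reflection k v (Ker-⊖ k x∈ y∈) σ≡1 t
      (trans (cong (two * t *_) βvv) (trans (solve 3 (λ a t b → a :* t :* b := a :* b :* t) refl two t (two * β k x v)) scalar))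
  ... | inj₂ σ≡-1 = S.transvection , InN-resp
        (λ i → trans (cong (λ a → (op S.transvection $ x) i + - (x i + a * v i)) (trans (solve 3 (λ a s b → a :* (a :* (:- :1 :* s) :* b) := :- (a :* (a :* b) :* s)) refl two s (β k x v)) (cong -_ scalar)))
          (solve 3 (λ h x y → h :+ :- (x :+ :- :1 :* (x :+ :- y)) := h :+ :- y) refl ((op S.transvection $ x) i) (x i) (y i)))
        (S.transvection-leading x)
    where
    v = x ⊖ y
    v∈ = Ker-⊖ k x∈ y∈
    d≢0 : β k x v ≢ 0#
    d≢0 e = qx≢βxy (x-y≡0⇒x≡y (trans (sym (β-subʳ k x x y)) e))
    s = (two * (two * β k x v)) ⁻¹[ *-nonzero two≢0 (*-nonzero two≢0 d≢0) ]
    scalar : two * (two * β k x v) * s ≡ 1#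
    scalar = *-inverse (two * (two * β k x v)) (*-nonzero two≢0 (*-nonzero two≢0 d≢0))
    -- The transvection adds its multiple of v instead of subtracting it, so the parameter is the
    -- negative of the one for the reflection.
    module S = Transvection k v v∈ σ≡-1 (β-alternating k σ≡-1 v∈) (- 1# * s)

  -- Being outside the radical of the form on `Ker k`. This excludes vectors that modulo N V come
  -- from the kernel of a smaller power of N, and so makes the index k an invariant.
  Regular : ℕ → V → Set
  Regular k u = ∃ λ z → Ker k z × β k z u ≢ 0#

  -- A vector space is not the union of two proper subspaces: if neither partner serves both
  -- vectors, their sum does.
  common-partner : ∀ k {x y} → Regular k x → Regular k y → ∃ λ z → Ker k z × β k z x ≢ 0# × β k z y ≢ 0#
  common-partner k {x} {y} (z , z∈ , zx≢0) (w , w∈ , wy≢0) with β k z y ≟ 0# | β k w x ≟ 0#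
  ... | no zy≢0  | _         = z , z∈ , zx≢0 , zy≢0
  ... | yes _    | no wx≢0   = w , w∈ , wx≢0 , wy≢0
  ... | yes zy≡0 | yes wx≡0  = z ⊕ w , Ker-⊕ k z∈ w∈ ,
    (λ e → zx≢0 (trans (sym (trans (β-addˡ k z w x) (trans (cong (β k z x +_) wx≡0) (solve 1 (λ a → a :+ :0 := a) refl (β k z x))))) e)) ,
    (λ e → wy≢0 (trans (sym (trans (β-addˡ k z w y) (trans (cong (_+ β k w y) zy≡0) (solve 1 (λ a → :0 :+ a := a) refl (β k w y))))) e))

  -- In the symmetric case q(z + s x) = q(z) + 2 s β(z,x) because q(x) = 0, a linear equation for s;
  -- in the alternating case s = 0 already works.
  isotropic-partner : ∀ k {x z} → Ker k x → Ker k z → β k x x ≡ 0# → (zx≢0 : β k z x ≢ 0#) →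
                      ∃ λ s → β k (z ⊕ s • x) (z ⊕ s • x) ≡ 0#
  isotropic-partner k {x} {z} x∈ z∈ qx≡0 zx≢0 with σ-cases k
  ... | inj₂ σ≡-1 = 0# , β-alternating k σ≡-1 (Ker-⊕ k z∈ (Ker-• k 0# x∈))
  ... | inj₁ σ≡1 = s , (begin
      β k w w                                           ≡⟨ β-addˡ k z (s • x) w ⟩
      β k z w + β k (s • x) w                           ≡⟨ cong₂ _+_ (trans (β-addʳ k z z (s • x)) (cong (β k z z +_) (β-scaleʳ k s z x))) (trans (β-scaleˡ k s x w) (cong (s *_) xw)) ⟩
      β k z z + s * β k z x + s * β k z x               ≡⟨ solve 3 (λ a s b → a :+ s :* b :+ s :* b := a :+ (:1 :+ :1) :* b :* s) refl (β k z z) s (β k z x) ⟩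
      β k z z + two * β k z x * s                       ≡⟨ cong (β k z z +_) (*-/ (- β k z z) (two * β k z x) (*-nonzero two≢0 zx≢0)) ⟩
      β k z z + - β k z z                               ≡⟨ solve 1 (λ a → a :+ :- a := :0) refl (β k z z) ⟩
      0# ∎)
    where
    open ≡-Reasoning
    s = (- β k z z) / two * β k z x [ *-nonzero two≢0 zx≢0 ]
    w = z ⊕ s • x
    xw : β k x w ≡ β k z x
    xw = trans (β-addʳ k x z (s • x)) (trans (cong₂ _+_ (β-symmetric k σ≡1 z x∈) (trans (β-scaleʳ k s x x) (cong (s *_) qx≡0)))
      (solve 2 (λ a s → a :+ s :* :0 := a) refl (β k z x) s))

  -- When β(x,y) = 0 the difference x - y is isotropic and pairs to zero with x, so no direct move
  -- exists. An isotropic w pairing nontrivially with both x and y splits the move into two direct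
  -- ones.
  isotropic-orbit : ∀ k {x y} → Ker k x → Ker k y → Regular k x → Regular k y →
                    β k x x ≡ 0# → β k y y ≡ 0# → β k x y ≡ 0# → Orbit x y
  isotropic-orbit k {x} {y} x∈ y∈ x-reg y-reg qx≡0 qy≡0 xy≡0 with common-partner k x-reg y-reg
  ... | z , z∈ , zx≢0 , zy≢0 with isotropic-partner k x∈ z∈ qx≡0 zx≢0
  ... | s , qw≡0 = Orbit-trans
      (direct-orbit k x∈ w∈ (trans qx≡0 (sym qw≡0)) (λ e → *-nonzero (σ-nonzero k) zx≢0 (trans (sym xw) (trans (sym e) qx≡0))))
      (direct-orbit k w∈ y∈ (trans qw≡0 (sym qy≡0)) (λ e → zy≢0 (trans (sym wy) (trans (sym e) qw≡0))))
    where
    w = z ⊕ s • x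
    w∈ = Ker-⊕ k z∈ (Ker-• k s x∈)
    xw : β k x w ≡ σ k * β k z x
    xw = trans (β-addʳ k x z (s • x)) (trans (cong₂ _+_ (β-sym k z x∈) (trans (β-scaleʳ k s x x) (cong (s *_) qx≡0)))
      (solve 2 (λ a s → a :+ s :* :0 := a) refl (σ k * β k z x) s))
    wy : β k w y ≡ β k z y
    wy = trans (β-addˡ k z (s • x) y) (trans (cong (β k z y +_) (trans (β-scaleˡ k s x y) (cong (s *_) xy≡0)))
      (solve 2 (λ a s → a :+ s :* :0 := a) refl (β k z y) s))

  transitive : ∀ k {x y} → Ker k x → Ker k y → Regular k x → Regular k y → β k x x ≡ β k y y → Orbit x y
  transitive k {x} {y} x∈ y∈ x-reg y-reg qx≡qy with β k x x ≟ β k x y | β k x x ≟ 0#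
  ... | no  qx≢xy | _        = direct-orbit k x∈ y∈ qx≡qy qx≢xy
  ... | yes qx≡xy | yes qx≡0 = isotropic-orbit k x∈ y∈ x-reg y-reg qx≡0 (trans (sym qx≡qy) qx≡0) (trans (sym qx≡xy) qx≡0)
  -- Here β(x, - y) = - q(x) differs from q(x), so x moves directly to - y, and - 1 is central.
  ... | yes qx≡xy | no  qx≢0 = Orbit-trans
      (direct-orbit k x∈ (Ker-• k (- 1#) y∈)
        (trans qx≡qy (sym (trans (β-scaleˡ k (- 1#) y _) (trans (cong (- 1# *_) (β-scaleʳ k (- 1#) y y)) (solve 1 (λ b → :- :1 :* (:- :1 :* b) := b) refl (β k y y))))))
        (λ e → qx≢0 (x≡-x⇒x≡0 (trans e (trans (β-scaleʳ k (- 1#) x y) (trans (solve 1 (λ b → :- :1 :* b := :- b) refl (β k x y)) (cong -_ (sym qx≡xy))))))))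
      (negation , InN-0 (λ i → solve 1 (λ b → :- :1 :* (:- :1 :* b) :+ :- b := :0) refl (y i)))

  -- Transposing N^(k+1) onto z kills it; hence the pairing with a fixed kernel vector depends only
  -- on the class modulo N V.
  β-InN : ∀ k {z w} → Ker k z → InN w → β k z w ≡ 0#
  β-InN k {z} {w} e (r , p) = begin
    B z (pow N k $ w)          ≡⟨ B-congʳ z (≈-trans (resp (pow N k) p) (≈-sym (pow-suc N k r))) ⟩
    B z (pow N (suc k) $ r)    ≡⟨ B-sym _ _ ⟩
    B (pow N (suc k) $ r) z    ≡⟨ adjoint-pow (suc k) r z ⟩
    B r (pow M (suc k) $ z)    ≡⟨ B-0ʳ r (pow-M-vanish (suc k) e) ⟩
    0# ∎
    where open ≡-Reasoning

  -- The invariant of the orbit of x modulo N V: the least i = k + 1 with x ∈ ker Nⁱ + N V,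
  -- and the value a of the form B(u, N^k u) at a representative u ∈ ker Nⁱ.
  HasType : V → ℕ → F → Set
  HasType x k a = ∃ λ u → InN (x ⊖ u) × Ker k u × Regular k u × β k u u ≡ a

  InN-flip : ∀ {u v} → InN (u ⊖ v) → InN (v ⊖ u)
  InN-flip {u} {v} p = InN-resp (λ i → solve 2 (λ a b → :- :1 :* (a :+ :- b) := b :+ :- a) refl (u i) (v i)) (InN-• (- 1#) p)

  InN-chain : ∀ {u v w} → InN (u ⊖ v) → InN (v ⊖ w) → InN (u ⊖ w)
  InN-chain {u} {v} {w} p q = InN-resp (λ i → solve 3 (λ a b d → a :+ :- b :+ (b :+ :- d) := a :+ :- d) refl (u i) (v i) (w i)) (InN-⊕ p q)

  InN-op : ∀ h {u v} → InN (u ⊖ v) → InN ((op h $ u) ⊖ (op h $ v))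
  InN-op h {u} {v} p = InN-resp (sub (op h) u v) (InN-map (op h) (commutes h) p)

  InN-Orbit : ∀ {x y} → Orbit x y → InN x → InN y
  InN-Orbit {x} {y} (h , p) q = InN-resp (λ i → solve 2 (λ a b → a :+ :- :1 :* (a :+ :- b) := b) refl ((op h $ x) i) (y i))
    (InN-⊕ (InN-map (op h) (commutes h) q) (InN-• (- 1#) p))

  HasType-Orbit : ∀ {x y k a} → Orbit x y → HasType x k a → HasType y k a
  HasType-Orbit {x} {y} {k} (h , p) (u , x-u , u∈ , (z , z∈ , zu≢0) , q) =
    (op h $ u) , InN-chain (InN-flip p) (InN-op h x-u) , Ker-op u∈ ,
    ((op h $ z) , Ker-op z∈ , λ e → zu≢0 (trans (sym (β-op z u)) e)) , trans (β-op u u) q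
    where
    Ker-op : ∀ {v} → Ker k v → Ker k (op h $ v)
    Ker-op {v} e = ≈-trans (pow-op h (suc k) v) (resp-0 (op h) e)
    β-op : ∀ v w → β k (op h $ v) (op h $ w) ≡ β k v w
    β-op v w = trans (B-congʳ (op h $ v) (pow-op h k w)) (isometric h v (pow N k $ w))

  HasType⇒Orbit : ∀ {x y k a} → HasType x k a → HasType y k a → Orbit x y
  HasType⇒Orbit {k = k} (u , x-u , u∈ , u-reg , qu) (v , y-v , v∈ , v-reg , qv) with transitive k u∈ v∈ u-reg v-reg (trans qu (sym qv))
  ... | h , p = h , InN-chain (InN-op h x-u) (InN-chain p (InN-flip y-v))

  InN⇒Orbit : ∀ {x y} → InN x → InN y → Orbit x y
  InN⇒Orbit {x} {y} p q = negation , InN-resp (λ i → solve 2 (λ a b → :- :1 :* a :+ :- :1 :* b := :- :1 :* a :+ :- b) refl (x i) (y i))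
    (InN-⊕ (InN-• (- 1#) p) (InN-• (- 1#) q))

  HasType⇒¬InN : ∀ {x k a} → HasType x k a → ¬ InN x
  HasType⇒¬InN {x} {k} (u , x-u , _ , (z , z∈ , zu≢0) , _) p = zu≢0 (β-InN k z∈
    (InN-resp (λ i → solve 2 (λ a b → a :+ :- :1 :* (a :+ :- b) := b) refl (x i) (u i)) (InN-⊕ p (InN-• (- 1#) x-u))))

  -- The representative of smaller index lies in the kernel of N^l and pairs to zero under `β l`.
  -- The other one differs from it by an element of N V, so it would pair to zero as well and fail
  -- to be regular.
  HasType-≤ : ∀ {x k l a b} → HasType x k a → HasType x l b → ¬ (k ℕ.< l)
  HasType-≤ {x} {k} {l} (u , x-u , u∈ , _) (v , x-v , _ , (z , z∈ , zv≢0) , _) k<l = zv≢0 (begin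
    β l z v                                ≡⟨ solve 2 (λ a b → a := b :+ :- (b :+ :- a)) refl (β l z v) (β l z u) ⟩
    β l z u + - (β l z u + - β l z v)      ≡⟨ cong₂ (λ a b → a + - b) (B-0ʳ z (pow-vanish N k<l u∈))
                                                (trans (sym (β-subʳ l z u v)) (β-InN l z∈ (InN-chain (InN-flip x-u) x-v))) ⟩
    0# + - 0#                              ≡⟨ solve 0 (:0 :+ :- :0 := :0) refl ⟩
    0# ∎)
    where open ≡-Reasoning

  HasType-unique : ∀ {x k l a b} → HasType x k a → HasType x l b → k ≡ l × a ≡ b
  HasType-unique {x} {k} {l} p q with ℕₚ.<-cmp k l
  ... | tri< k<l _ _ = ⊥-elim (HasType-≤ p q k<l)
  ... | tri> _ _ l<k = ⊥-elim (HasType-≤ q p l<k)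
  HasType-unique {x} {k} (u , x-u , u∈ , _ , qu) (v , x-v , v∈ , _ , qv) | tri≈ _ refl _ = refl , (begin
    _                     ≡⟨ sym qu ⟩
    β k u u               ≡⟨ β-mod u u∈ ⟩
    β k u v               ≡⟨ β-sym k v u∈ ⟩
    σ k * β k v u         ≡⟨ cong (σ k *_) (β-mod v v∈) ⟩
    σ k * β k v v         ≡⟨ sym (β-sym k v v∈) ⟩
    β k v v               ≡⟨ qv ⟩
    _ ∎)
    where
    open ≡-Reasoning
    β-mod : ∀ z → Ker k z → β k z u ≡ β k z v
    β-mod z z∈ = x-y≡0⇒x≡y (trans (sym (β-subʳ k z u v)) (β-InN k z∈ (InN-chain (InN-flip x-u) x-v)))

-- Counting in duplicate-free lists.

module FiniteSets {A : Set} (_≟′_ : DecidableEquality A) where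

  remove : A → List A → List A
  remove y = filter (λ x → ¬? (x ≟′ y))

  length-remove : ∀ {y xs} → Unique xs → y ∈ xs → length xs ≡ suc (length (remove y xs))
  length-remove {y} {x ∷ xs} (x∉ ∷ u) (here refl) = cong suc (trans
    (sym (cong length (Listₚ.filter-all (λ z → ¬? (z ≟′ y)) (All.map (λ y≢z z≡y → y≢z (sym z≡y)) x∉))))
    (sym (cong length (Listₚ.filter-reject (λ z → ¬? (z ≟′ y)) {x} {xs} (λ x≢x → x≢x refl)))))
  length-remove {y} {x ∷ xs} (x∉ ∷ u) (there y∈) = cong suc (trans (length-remove u y∈)
    (sym (cong length (Listₚ.filter-accept (λ z → ¬? (z ≟′ y)) {x} {xs} (λ { refl → All.lookup x∉ y∈ refl })))))

  remove-unique : ∀ {y xs} → Unique xs → Unique (remove y xs)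
  remove-unique {y} = Uniqueₚ.filter⁺ (λ x → ¬? (x ≟′ y))

  ∈-remove⁺ : ∀ {y x xs} → x ∈ xs → x ≢ y → x ∈ remove y xs
  ∈-remove⁺ {y} = ∈-filter⁺ (λ x → ¬? (x ≟′ y))

  ∈-remove⁻ : ∀ {y x} xs → x ∈ remove y xs → x ∈ xs × x ≢ y
  ∈-remove⁻ {y} {x} xs = ∈-filter⁻ (λ x → ¬? (x ≟′ y)) {v = x} {xs = xs}

  unique-⊆-length : ∀ {xs ys} → Unique xs → (∀ {x} → x ∈ xs → x ∈ ys) → Unique ys → length xs ℕ.≤ length ys
  unique-⊆-length {[]} _ _ _ = ℕ.z≤n
  unique-⊆-length {x ∷ xs} {ys} (x∉ ∷ u) sub u′ = ℕₚ.≤-trans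
    (ℕ.s≤s (unique-⊆-length u (λ z∈ → ∈-remove⁺ (sub (there z∈)) (λ { refl → All.lookup x∉ z∈ refl })) (remove-unique u′)))
    (ℕₚ.≤-reflexive (sym (length-remove u′ (sub (here refl)))))

  map-unique : ∀ {B : Set} (f : A → B) {xs} → (∀ {x y} → x ∈ xs → y ∈ xs → f x ≡ f y → x ≡ y) → Unique xs → Unique (map f xs)
  map-unique f {[]} inj [] = []
  map-unique f {x ∷ xs} inj (x∉ ∷ u) = Allₚ.map⁺ (All.tabulate (λ y∈ fx≡fy → All.lookup x∉ y∈ (inj (here refl) (there y∈) fx≡fy)))
    ∷ map-unique f (λ y∈ z∈ → inj (there y∈) (there z∈)) u

  -- A set of representatives for the orbits of a fixed point free involution.
  halve : (τ : A → A) → (∀ x → τ (τ x) ≡ x) → ∀ n xs → length xs ℕ.≤ n → Unique xs →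
          (∀ {x} → x ∈ xs → τ x ∈ xs) → (∀ {x} → x ∈ xs → τ x ≢ x) →
          ∃ λ hs → Unique hs × length xs ≡ length hs ℕ.+ length hs × (∀ {x} → x ∈ hs → x ∈ xs)
            × (∀ {x} → x ∈ xs → x ∈ hs ⊎ τ x ∈ hs) × (∀ {x} → x ∈ hs → τ x ∉ hs)
  halve τ ττ n [] _ _ _ _ = [] , [] , refl , (λ ()) , (λ ()) , λ ()
  -- The bound n drives the recursion, since the list left after deleting x and τ x is not a
  -- structural part of the original.
  halve τ ττ (suc n) (x ∷ xs) (ℕ.s≤s len) (x∉ ∷ u) closed free = extend (halve τ ττ n (remove (τ x) xs)
      (ℕₚ.≤-trans (Listₚ.length-filter (λ z → ¬? (z ≟′ τ x)) xs) len) (remove-unique u) closed′ (λ z∈ → free (there (proj₁ (∈-remove⁻ xs z∈)))))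
    where
    strict : ∀ {z} → z ∈ x ∷ xs → z ≢ x → z ∈ xs
    strict (here z≡x) z≢x = ⊥-elim (z≢x z≡x)
    strict (there z∈) _   = z∈
    τx∈ : τ x ∈ xs
    τx∈ = strict (closed (here refl)) (free (here refl))
    x≢ : ∀ {z} → z ∈ xs → z ≢ x
    x≢ z∈ refl = All.lookup x∉ z∈ refl
    swap : ∀ {z} → τ z ≡ x → z ≡ τ x
    swap {z} e = trans (sym (ττ z)) (cong τ e)
    closed′ : ∀ {z} → z ∈ remove (τ x) xs → τ z ∈ remove (τ x) xs
    closed′ {z} z∈ with ∈-remove⁻ xs z∈
    ... | z∈xs , z≢τx = ∈-remove⁺ (strict (closed (there z∈xs)) (z≢τx ∘ swap))
      (λ τz≡τx → x≢ z∈xs (trans (sym (ττ z)) (trans (cong τ τz≡τx) (ττ x))))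
    extend : _ → _
    extend (hs , hs-u , len≡ , hs⊆ , cover , exclude) = x ∷ hs
      , All.tabulate (λ z∈ → λ { refl → x≢ (proj₁ (∈-remove⁻ xs (hs⊆ z∈))) refl }) ∷ hs-u
      , cong suc (trans (length-remove u τx∈) (trans (cong suc len≡) (sym (ℕₚ.+-suc (length hs) (length hs)))))
      , (λ { (here refl) → here refl ; (there z∈) → there (proj₁ (∈-remove⁻ xs (hs⊆ z∈))) })
      , (λ {_} → cover′)
      , (λ {_} → exclude′)
      where
      cover′ : ∀ {z} → z ∈ x ∷ xs → z ∈ x ∷ hs ⊎ τ z ∈ x ∷ hs
      cover′ (here refl) = inj₁ (here refl)
      cover′ {z} (there z∈) with z ≟′ τ x
      ... | yes refl = inj₂ (here (ττ x))
      ... | no z≢τx with cover (∈-remove⁺ z∈ z≢τx)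
      ... | inj₁ p = inj₁ (there p)
      ... | inj₂ p = inj₂ (there p)
      exclude′ : ∀ {z} → z ∈ x ∷ hs → τ z ∉ x ∷ hs
      exclude′ (here refl) (here p) = free (here refl) p
      exclude′ (here refl) (there p) = proj₂ (∈-remove⁻ xs (hs⊆ p)) refl
      exclude′ (there z∈) (here p) = proj₂ (∈-remove⁻ xs (hs⊆ z∈)) (swap p)
      exclude′ (there z∈) (there p) = exclude z∈ p

-- Squares in a finite field of odd order.

module OddField (𝔽 : FiniteField) (m : ℕ) (odd : FiniteField.order 𝔽 ℕ.% 2 ≡ 1) where
  open LinearAlgebra 𝔽 m
  open FiniteSets _≟_

  n+n≡n*2 : ∀ n → n ℕ.+ n ≡ n ℕ.* 2
  n+n≡n*2 n = trans (cong (n ℕ.+_) (sym (ℕₚ.+-identityʳ n))) (ℕₚ.*-comm 2 n)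

  -- If 2 = 0, translation by 1 would be a fixed point free involution of the field, and its order
  -- would be even.
  two≢0 : 1# + 1# ≢ 0#
  two≢0 2≡0 with halve (_+ 1#) (λ x → trans (solve 1 (λ x → x :+ :1 :+ :1 := x :+ (:1 :+ :1)) refl x)
                  (trans (cong (x +_) 2≡0) (solve 1 (λ x → x :+ :0 := x) refl x)))
                  order elements ℕₚ.≤-refl unique (λ _ → complete _)
                  (λ {x} _ e → 0≢1 (sym (trans (solve 1 (λ x → :1 := x :+ :1 :+ :- x) refl x) (trans (cong (_+ - x) e) (solve 1 (λ x → x :+ :- x := :0) refl x)))))
  ... | hs , _ , len , _ with trans (sym odd) (trans (cong (ℕ._% 2) (trans len (n+n≡n*2 (length hs)))) (m*n%n≡0 (length hs) 2))
  ... | ()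

  units : List F
  units = remove 0# elements

  ∈-units : ∀ {x} → x ≢ 0# → x ∈ units
  ∈-units x≢0 = ∈-remove⁺ (complete _) x≢0

  order≡1+units : order ≡ suc (length units)
  order≡1+units = length-remove unique (complete 0#)

  opaque
    -- One unit from each pair x, - x; negation has no fixed unit because 2 is nonzero. Squaring is
    -- injective on these, so they parametrise the nonzero squares.
    halves : ∃ λ hs → Unique hs × length units ≡ length hs ℕ.+ length hs × (∀ {x} → x ∈ hs → x ∈ units)
               × (∀ {x} → x ∈ units → x ∈ hs ⊎ - x ∈ hs) × (∀ {x} → x ∈ hs → - x ∉ hs)
    halves = halve -_ (λ x → solve 1 (λ x → :- :- x := x) refl x) (length units) units ℕₚ.≤-refl (remove-unique unique)
      (λ x∈ → ∈-units (-‿nonzero (proj₂ (∈-remove⁻ elements x∈))))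
      (λ {x} x∈ e → *-nonzero two≢0 (proj₂ (∈-remove⁻ elements x∈)) (trans (solve 1 (λ x → (:1 :+ :1) :* x := x :+ x) refl x)
        (trans (cong (x +_) (sym e)) (solve 1 (λ x → x :+ :- x := :0) refl x))))

  half : List F
  half = proj₁ halves

  half-unique : Unique half
  half-unique = proj₁ (proj₂ halves)

  order≡1+2half : order ≡ suc (length half ℕ.+ length half)
  order≡1+2half = trans order≡1+units (cong suc (proj₁ (proj₂ (proj₂ halves))))

  half-length : length half ≡ (order ℕ.∸ 1) ℕ./ 2
  half-length = sym (trans (cong (λ n → (n ℕ.∸ 1) ℕ./ 2) order≡1+2half)
    (trans (cong (ℕ._/ 2) (n+n≡n*2 (length half))) (m*n/n≡m (length half) 2)))

  half-nonzero : ∀ {x} → x ∈ half → x ≢ 0#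
  half-nonzero x∈ = proj₂ (∈-remove⁻ elements (proj₁ (proj₂ (proj₂ (proj₂ halves))) x∈))

  squares-injective : ∀ {x y} → x ∈ 0# ∷ half → y ∈ 0# ∷ half → x * x ≡ y * y → x ≡ y
  squares-injective {x} {y} x∈ y∈ e with x + - y ≟ 0#
  ... | yes x-y≡0 = x-y≡0⇒x≡y x-y≡0
  ... | no  x-y≢0 = opposite x∈ y∈ (x-y≡0⇒x≡y (trans (solve 2 (λ x y → x :+ :- :- y := x :+ y) refl x y)
      (*-cancelˡ x-y≢0 (trans (solve 2 (λ x y → (x :+ :- y) :* (x :+ y) := x :* x :+ :- (y :* y)) refl x y)
        (trans (cong (_+ - (y * y)) e) (solve 2 (λ z d → z :+ :- z := d :* :0) refl (y * y) (x + - y)))))))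
    where
    opposite : ∀ {x y} → x ∈ 0# ∷ half → y ∈ 0# ∷ half → x ≡ - y → x ≡ y
    opposite (here refl) (here refl) _ = refl
    opposite (here refl) (there y∈) e = ⊥-elim (-‿nonzero (half-nonzero y∈) (sym e))
    opposite (there x∈) (here refl) e = ⊥-elim (half-nonzero x∈ (trans e (solve 0 (:- :0 := :0) refl)))
    opposite (there x∈) (there y∈) refl = ⊥-elim (proj₂ (proj₂ (proj₂ (proj₂ (proj₂ halves)))) y∈ x∈)

  half-squares : ∀ {x} → x ≢ 0# → ∃ λ s → s ∈ half × s * s ≡ x * x
  half-squares {x} x≢0 with proj₁ (proj₂ (proj₂ (proj₂ (proj₂ halves)))) (∈-units x≢0)
  ... | inj₁ p = x , p , refl
  ... | inj₂ p = - x , p , solve 1 (λ x → :- x :* :- x := x :* x) refl x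

  0∷half-unique : Unique (0# ∷ half)
  0∷half-unique = All.tabulate (λ x∈ 0≡x → half-nonzero x∈ (sym 0≡x)) ∷ half-unique

  opaque
    -- Both α s² and γ - β t² take (q + 1)/2 values, so they share one.
    binary-universal : ∀ {α β} → α ≢ 0# → β ≢ 0# → ∀ γ → ∃ λ s → ∃ λ t → α * (s * s) + β * (t * t) ≡ γ
    binary-universal {α} {β} α≢0 β≢0 γ with any? (λ x → any? (x ≟_) ys) xs
      where
      xs ys : List F
      xs = map (λ s → α * (s * s)) (0# ∷ half)
      ys = map (λ t → γ + - (β * (t * t))) (0# ∷ half)
    ... | yes p with find p
    ... | x , x∈ , x∈ys with ∈-map⁻ (λ s → α * (s * s)) x∈ | ∈-map⁻ (λ t → γ + - (β * (t * t))) x∈ys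
    ... | s , _ , x≡ | t , _ , x≡′ = s , t , trans (cong (_+ β * (t * t)) (trans (sym x≡) x≡′))
          (solve 2 (λ g b → g :+ :- b :+ b := g) refl γ (β * (t * t)))
    binary-universal {α} {β} α≢0 β≢0 γ | no ¬p = ⊥-elim (ℕₚ.<-irrefl refl (ℕₚ.≤-trans too-long
        (unique-⊆-length (Uniqueₚ.++⁺ xs-unique ys-unique (λ (x∈ , x∈′) → ¬p (lose x∈ x∈′))) (λ _ → complete _) unique)))
      where
      xs ys : List F
      xs = map (λ s → α * (s * s)) (0# ∷ half)
      ys = map (λ t → γ + - (β * (t * t))) (0# ∷ half)
      xs-unique : Unique xs
      xs-unique = map-unique (λ s → α * (s * s)) (λ x∈ y∈ e → squares-injective x∈ y∈ (*-cancelˡ α≢0 e)) 0∷half-unique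
      ys-unique : Unique ys
      ys-unique = map-unique (λ t → γ + - (β * (t * t))) (λ {x} {y} x∈ y∈ e → squares-injective x∈ y∈ (*-cancelˡ β≢0
        (trans (solve 2 (λ g b → b := :- (g :+ :- b) :+ g) refl γ (β * (x * x)))
          (trans (cong (λ z → - z + γ) e) (solve 2 (λ g b → :- (g :+ :- b) :+ g := b) refl γ (β * (y * y))))))) 0∷half-unique
      too-long : order ℕ.< length (xs ++ ys)
      too-long = ℕₚ.≤-reflexive (trans (cong suc order≡1+2half) (sym (trans (Listₚ.length-++ xs) (trans
        (cong₂ ℕ._+_ (Listₚ.length-map (λ s → α * (s * s)) (0# ∷ half)) (Listₚ.length-map (λ t → γ + - (β * (t * t))) (0# ∷ half)))
        (cong suc (ℕₚ.+-suc (length half) (length half)))))))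

  -- Values of nondegenerate symmetric forms at nonzero vectors.

  NonzeroVector : ∀ {n} → (Fin n → F) → Set
  NonzeroVector d = ∃ λ j → d j ≢ 0#

  -- `expand` encodes linearity and compatibility with pointwise equality at once, and turns
  -- orthogonality to given vectors into a linear system.
  record SymmetricForm (n : ℕ) : Set where
    field
      form          : (Fin n → F) → (Fin n → F) → F
      coefficients  : (Fin n → F) → Fin n → F
      expand        : ∀ d e → form d e ≡ Σ[ n ] (λ j → coefficients d j * e j)
      symmetric     : ∀ d e → form d e ≡ form e d
      nondegenerate : ∀ d → NonzeroVector d → ∃ λ e → form e d ≢ 0#

  module FormValues {n : ℕ} (φ : SymmetricForm n) where
    open SymmetricForm φ

    q : (Fin n → F) → F
    q d = form d d

    form-congʳ : ∀ d {e e′} → (∀ j → e j ≡ e′ j) → form d e ≡ form d e′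
    form-congʳ d {e} {e′} p = trans (expand d e) (trans (Σ-cong n (λ j → cong (coefficients d j *_) (p j))) (sym (expand d e′)))

    form-congˡ : ∀ {d d′} e → (∀ j → d j ≡ d′ j) → form d e ≡ form d′ e
    form-congˡ e p = trans (symmetric _ e) (trans (form-congʳ e p) (symmetric e _))

    q-cong : ∀ {d d′} → (∀ j → d j ≡ d′ j) → q d ≡ q d′
    q-cong p = trans (form-congʳ _ p) (form-congˡ _ p)

    form-linearʳ : ∀ d s e t e′ → form d (λ j → s * e j + t * e′ j) ≡ s * form d e + t * form d e′
    form-linearʳ d s e t e′ = begin
      form d (λ j → s * e j + t * e′ j)                                     ≡⟨ expand d _ ⟩
      Σ[ n ] (λ j → coefficients d j * (s * e j + t * e′ j))                ≡⟨ Σ-cong n (λ j → solve 5 (λ c s x t y → c :* (s :* x :+ t :* y) := s :* (c :* x) :+ t :* (c :* y)) refl (coefficients d j) s (e j) t (e′ j)) ⟩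
      Σ[ n ] (λ j → s * (coefficients d j * e j) + t * (coefficients d j * e′ j)) ≡⟨ Σ-+ n (λ j → s * (coefficients d j * e j)) (λ j → t * (coefficients d j * e′ j)) ⟩
      Σ[ n ] (λ j → s * (coefficients d j * e j)) + Σ[ n ] (λ j → t * (coefficients d j * e′ j)) ≡⟨ cong₂ _+_ (Σ-* n s (λ j → coefficients d j * e j)) (Σ-* n t (λ j → coefficients d j * e′ j)) ⟩
      s * Σ[ n ] (λ j → coefficients d j * e j) + t * Σ[ n ] (λ j → coefficients d j * e′ j)     ≡⟨ cong₂ (λ x y → s * x + t * y) (sym (expand d e)) (sym (expand d e′)) ⟩
      s * form d e + t * form d e′ ∎
      where open ≡-Reasoning

    form-linearˡ : ∀ s d t d′ e → form (λ j → s * d j + t * d′ j) e ≡ s * form d e + t * form d′ e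
    form-linearˡ s d t d′ e = trans (symmetric _ e) (trans (form-linearʳ e s d t d′) (cong₂ (λ x y → s * x + t * y) (symmetric e d) (symmetric e d′)))

    q-combination : ∀ s d t e → q (λ j → s * d j + t * e j) ≡ s * s * q d + two * s * t * form d e + t * t * q e
    q-combination s d t e = trans (form-linearˡ s d t e _) (trans
      (cong₂ (λ x y → s * x + t * y) (form-linearʳ d s d t e) (trans (form-linearʳ e s d t e) (cong (λ x → s * x + t * q e) (symmetric e d))))
      (solve 5 (λ s t a b c → s :* (s :* a :+ t :* b) :+ t :* (s :* b :+ t :* c) := s :* s :* a :+ (:1 :+ :1) :* s :* t :* b :+ t :* t :* c) refl s t (q d) (form d e) (q e)))

    form-nonzero : ∀ {d e} → form d e ≢ 0# → NonzeroVector e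
    form-nonzero {d} {e} de≢0 with nonzero-entry n e
    ... | inj₁ p = p
    ... | inj₂ z = ⊥-elim (de≢0 (trans (expand d e) (Σ-zero n (λ j → trans (cong (coefficients d j *_) (z j)) (*-zeroʳ _)))))

    Isotropic : Set
    Isotropic = ∃ λ d → NonzeroVector d × q d ≡ 0#

    Attained : F → Set
    Attained γ = ∃ λ d → NonzeroVector d × q d ≡ γ

    -- For e not orthogonal to the isotropic d, q(e + t d) is q(e) plus a nonzero multiple of t, so
    -- it takes every value. The vector is nonzero, also for γ = 0, because it pairs with d as e
    -- does.
    isotropic⇒universal : Isotropic → ∀ γ → Attained γ
    isotropic⇒universal (d , d≢0 , qd≡0) γ with nondegenerate d d≢0
    ... | e , ed≢0 = x , form-nonzero {d} {x} (λ z → ed≢0 (trans (symmetric e d) (trans (sym dx) z))) , (begin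
        q x                                        ≡⟨ q-combination 1# e t d ⟩
        1# * 1# * q e + two * 1# * t * form e d + t * t * q d ≡⟨ cong (λ y → 1# * 1# * q e + two * 1# * t * form e d + t * t * y) qd≡0 ⟩
        1# * 1# * q e + two * 1# * t * form e d + t * t * 0#  ≡⟨ solve 3 (λ a t b → :1 :* :1 :* a :+ (:1 :+ :1) :* :1 :* t :* b :+ t :* t :* :0 := a :+ (:1 :+ :1) :* b :* t) refl (q e) t (form e d) ⟩
        q e + two * form e d * t                   ≡⟨ cong (q e +_) (*-/ (γ + - q e) (two * form e d) (*-nonzero two≢0 ed≢0)) ⟩
        q e + (γ + - q e)                          ≡⟨ solve 2 (λ a g → a :+ (g :+ :- a) := g) refl (q e) γ ⟩
        γ ∎)
      where
      open ≡-Reasoning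
      t = (γ + - q e) / two * form e d [ *-nonzero two≢0 ed≢0 ]
      x : Fin n → F
      x j = 1# * e j + t * d j
      dx : form d x ≡ form d e
      dx = trans (form-linearʳ d 1# e t d) (trans (cong (λ y → 1# * form d e + t * y) qd≡0)
        (solve 2 (λ a t → :1 :* a :+ t :* :0 := a) refl (form d e) t))

    opaque
      orthogonal-combination : ∀ {d e} → q d ≢ 0# → q e ≢ 0# → form d e ≡ 0# → ∀ γ →
        ∃ λ s → ∃ λ t → q (λ j → s * d j + t * e j) ≡ γ
      orthogonal-combination {d} {e} qd≢0 qe≢0 de≡0 γ = conclude (binary-universal qd≢0 qe≢0 γ)
        where
        conclude : (∃ λ s → ∃ λ t → q d * (s * s) + q e * (t * t) ≡ γ) → ∃ λ s → ∃ λ t → q (λ j → s * d j + t * e j) ≡ γ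
        conclude (s , t , eq) = s , t , (begin
          q (λ j → s * d j + t * e j)                            ≡⟨ q-combination s d t e ⟩
          s * s * q d + two * s * t * form d e + t * t * q e     ≡⟨ cong (λ x → s * s * q d + two * s * t * x + t * t * q e) de≡0 ⟩
          s * s * q d + two * s * t * 0# + t * t * q e           ≡⟨ solve 4 (λ s t a b → s :* s :* a :+ (:1 :+ :1) :* s :* t :* :0 :+ t :* t :* b := a :* (s :* s) :+ b :* (t :* t)) refl s t (q d) (q e) ⟩
          q d * (s * s) + q e * (t * t)                          ≡⟨ eq ⟩
          γ ∎)
          where open ≡-Reasoning

    orthogonal-vector : ∀ {r} → r ℕ.< n → (ds : Fin r → Fin n → F) → ∃ λ e → NonzeroVector e × (∀ i → form (ds i) e ≡ 0#)
    orthogonal-vector r<n ds with underdetermined r<n (λ i → coefficients (ds i))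
    ... | e , e≢0 , z = e , e≢0 , λ i → trans (expand (ds i) e) (z i)

    anisotropic⇒units : 1 ℕ.< n → ¬ Isotropic → ∀ γ → γ ≢ 0# → Attained γ
    -- An empty system of equations merely supplies some nonzero vector.
    anisotropic⇒units 1<n aniso γ γ≢0 with orthogonal-vector {0} (ℕₚ.<-trans (ℕ.s≤s ℕ.z≤n) 1<n) (λ ())
    ... | d , d≢0 , _ with orthogonal-vector 1<n (λ _ → d)
    ... | e , e≢0 , de≡0 with orthogonal-combination {d} {e} (λ z → aniso (d , d≢0 , z)) (λ z → aniso (e , e≢0 , z)) (de≡0 fzero) γ
    ... | s , t , eq = (λ j → s * d j + t * e j) , form-nonzero {λ j → s * d j + t * e j} (λ z → γ≢0 (trans (sym eq) z)) , eq

    -- Among three mutually orthogonal anisotropic vectors, the first two have a combination of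
    -- value - q(h). Adding h gives value zero, and the sum is nonzero since it pairs with h to
    -- q(h).
    ternary-isotropic : 2 ℕ.< n → Isotropic
    ternary-isotropic 2<n with orthogonal-vector {0} (ℕₚ.<-trans (ℕ.s≤s ℕ.z≤n) 2<n) (λ ())
    ... | d , d≢0 , _ with q d ≟ 0#
    ... | yes qd≡0 = d , d≢0 , qd≡0
    ... | no qd≢0 with orthogonal-vector (ℕₚ.<-trans (ℕₚ.n<1+n 1) 2<n) (λ _ → d)
    ... | e , e≢0 , de≡0 with q e ≟ 0#
    ... | yes qe≡0 = e , e≢0 , qe≡0
    ... | no qe≢0 with orthogonal-vector 2<n (λ { fzero → d ; (fsuc _) → e })
    ... | h , h≢0 , ⊥h with q h ≟ 0#
    ... | yes qh≡0 = h , h≢0 , qh≡0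
    ... | no qh≢0 with orthogonal-combination {d} {e} qd≢0 qe≢0 (de≡0 fzero) (- q h)
    ... | s , t , eq = x , form-nonzero {h} {x} (λ z → qh≢0 (trans (sym hx) z)) , (begin
        q x                                                   ≡⟨ q-combination 1# y 1# h ⟩
        1# * 1# * q y + two * 1# * 1# * form y h + 1# * 1# * q h ≡⟨ cong₂ (λ u v → 1# * 1# * u + two * 1# * 1# * v + 1# * 1# * q h) eq yh ⟩
        1# * 1# * - q h + two * 1# * 1# * 0# + 1# * 1# * q h  ≡⟨ solve 1 (λ a → :1 :* :1 :* :- a :+ (:1 :+ :1) :* :1 :* :1 :* :0 :+ :1 :* :1 :* a := :0) refl (q h) ⟩
        0# ∎)
      where
      open ≡-Reasoning
      y x : Fin n → F
      y j = s * d j + t * e j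
      x j = 1# * y j + 1# * h j
      yh : form y h ≡ 0#
      yh = trans (form-linearˡ s d t e h) (trans (cong₂ (λ u v → s * u + t * v) (⊥h fzero) (⊥h (fsuc fzero)))
        (solve 2 (λ s t → s :* :0 :+ t :* :0 := :0) refl s t))
      hx : form h x ≡ q h
      hx = trans (form-linearʳ h 1# y 1# h) (trans (cong (λ u → 1# * u + 1# * q h) (trans (symmetric h y) yh))
        (solve 1 (λ a → :1 :* :0 :+ :1 :* a := a) refl (q h)))

    ValueList : ℕ → Set
    ValueList l = ∃ λ vs → length vs ≡ l × Unique vs × (∀ {γ} → γ ∈ vs → Attained γ) × (∀ d → NonzeroVector d → q d ∈ vs)

    isotropic-values : Isotropic → ValueList order
    isotropic-values iso = elements , refl , unique , (λ {γ} _ → isotropic⇒universal iso γ) , λ _ _ → complete _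

    anisotropic-values : 1 ℕ.< n → ¬ Isotropic → ValueList (order ℕ.∸ 1)
    anisotropic-values 1<n aniso = units , sym (cong (ℕ._∸ 1) order≡1+units) , remove-unique unique
      , (λ γ∈ → anisotropic⇒units 1<n aniso _ (proj₂ (∈-remove⁻ elements γ∈))) , λ d d≢0 → ∈-units (λ z → aniso (d , d≢0 , z))

  -- In one variable the form is α s², so its nonzero values are one coset of the squares, half of
  -- the units.
  unary-values : (φ : SymmetricForm 1) → FormValues.ValueList φ ((order ℕ.∸ 1) ℕ./ 2)
  unary-values φ = map (λ s → α * (s * s)) half , trans (Listₚ.length-map (λ s → α * (s * s)) half) half-length
    , map-unique (λ s → α * (s * s)) (λ x∈ y∈ e → squares-injective (there x∈) (there y∈) (*-cancelˡ α≢0 e)) half-unique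
    , attained
    , λ { d (fzero , d₀≢0) → let (s , s∈ , e) = half-squares d₀≢0 in
            subst (_∈ map (λ s → α * (s * s)) half) (trans (cong (α *_) e) (sym (q-α d))) (∈-map⁺ (λ s → α * (s * s)) s∈) }
    where
    open SymmetricForm φ
    open FormValues φ
    one : Fin 1 → F
    one _ = 1#
    α = q one
    form-one : ∀ d e → form d e ≡ d fzero * form one e
    form-one d e = trans (form-congˡ e (λ { fzero → solve 1 (λ x → x := x :* :1 :+ :0 :* :1) refl (d fzero) }))
      (trans (form-linearˡ (d fzero) one 0# one e) (solve 2 (λ x y → x :* y :+ :0 :* y := x :* y) refl (d fzero) (form one e)))
    q-α : ∀ d → q d ≡ α * (d fzero * d fzero)
    q-α d = trans (form-one d d) (trans (cong (d fzero *_) (trans (symmetric one d) (form-one d one)))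
      (solve 2 (λ x a → x :* (x :* a) := a :* (x :* x)) refl (d fzero) α))
    α≢0 : α ≢ 0#
    α≢0 z with nondegenerate one (fzero , 0≢1 ∘ sym)
    ... | e , e1≢0 = e1≢0 (trans (form-one e one) (trans (cong (e fzero *_) z) (*-zeroʳ _)))
    attained : ∀ {γ} → γ ∈ map (λ s → α * (s * s)) half → Attained γ
    attained γ∈ with ∈-map⁻ (λ s → α * (s * s)) γ∈
    ... | s , s∈ , refl = (λ _ → s) , (fzero , half-nonzero s∈) , q-α (λ _ → s)

  pair : F → F → Fin 2 → F
  pair s t fzero    = s
  pair s t (fsuc _) = t

  pair-nonzero : ∀ {s t} → ¬ (s ≡ 0# × t ≡ 0#) → NonzeroVector (pair s t)
  pair-nonzero {s} {t} ¬0 with s ≟ 0# | t ≟ 0#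
  ... | no s≢0  | _       = fzero , s≢0
  ... | yes _   | no t≢0  = fsuc fzero , t≢0
  ... | yes s≡0 | yes t≡0 = ⊥-elim (¬0 (s≡0 , t≡0))

  -- The length in rank two is specified separately for each sign, so the sign must be decided; the
  -- search over pairs of scalars is finite.
  binary-isotropic? : (φ : SymmetricForm 2) → Dec (FormValues.Isotropic φ)
  binary-isotropic? φ with any? (λ s → any? (λ t → ¬? (s ≟ 0# ×-dec t ≟ 0#) ×-dec (FormValues.q φ (pair s t) ≟ 0#)) elements) elements
  ... | no ¬p = no λ (d , d≢0 , e) → ¬p (lose (complete (d fzero)) (lose (complete (d (fsuc fzero)))
      (not-both d d≢0 , trans (FormValues.q-cong φ (λ { fzero → refl ; (fsuc fzero) → refl })) e)))
    where
    not-both : ∀ (d : Fin 2 → F) → NonzeroVector d → ¬ (d fzero ≡ 0# × d (fsuc fzero) ≡ 0#)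
    not-both d (fzero , p)      (z , _) = p z
    not-both d (fsuc fzero , p) (_ , z) = p z
  ... | yes p with find p
  ... | s , _ , p′ with find p′
  ... | t , _ , ¬0 , e = yes (pair s t , pair-nonzero ¬0 , e)

  opaque
    odd-values : ∀ n (φ : SymmetricForm n) → let open FormValues φ in n ≢ 0 → ∀ l →
      (2 ℕ.< n → l ≡ order) → (n ≡ 2 → Isotropic → l ≡ order) → (n ≡ 2 → ¬ Isotropic → l ≡ order ℕ.∸ 1) →
      (n ≡ 1 → l ≡ (order ℕ.∸ 1) ℕ./ 2) → ValueList l
    odd-values 0 φ n≢0 = ⊥-elim (n≢0 refl)
    odd-values 1 φ _ l _ _ _ l₁ = subst (FormValues.ValueList φ) (sym (l₁ refl)) (unary-values φ)
    odd-values 2 φ _ l _ l₊ l₋ _ with binary-isotropic? φ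
    ... | yes iso = subst (FormValues.ValueList φ) (sym (l₊ refl iso)) (FormValues.isotropic-values φ iso)
    ... | no aniso = subst (FormValues.ValueList φ) (sym (l₋ refl aniso)) (FormValues.anisotropic-values φ (ℕₚ.n<1+n 1) aniso)
    odd-values (suc (suc (suc n))) φ _ l l₃ _ _ _ = subst (FormValues.ValueList φ) (sym (l₃ 2<n))
      (FormValues.isotropic-values φ (FormValues.ternary-isotropic φ 2<n))
      where
      2<n : 2 ℕ.< suc (suc (suc n))
      2<n = ℕ.s≤s (ℕ.s≤s (ℕ.s≤s ℕ.z≤n))

-- Reading the invariant off the Jordan decomposition.

last-or-all : ∀ n {P Q : Fin n → Set} → (∀ k → P k ⊎ Q k) →
              (∀ k → Q k) ⊎ (∃ λ k → P k × (∀ l → toℕ k ℕ.< toℕ l → Q l))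
last-or-all zero    dec = inj₁ λ ()
last-or-all (suc n) dec with last-or-all n (dec ∘ fsuc) | dec fzero
... | inj₂ (k , p , later) | _      = inj₂ (fsuc k , p , λ { (fsuc l) (ℕ.s≤s k<l) → later l k<l })
... | inj₁ all             | inj₁ p = inj₂ (fzero , p , λ { (fsuc l) _ → all l })
... | inj₁ all             | inj₂ q = inj₁ λ { fzero → q ; (fsuc l) → all l }

module NormalForm (𝔽 : FiniteField) (two≢0 : CharacteristicNot2 𝔽) (m : ℕ)
                  (c : LinAlg.QForm 𝔽 m) (nondegenerate : LinAlg.Nondegenerate 𝔽 m c)
                  (g : LinAlg.Mat 𝔽 m) (g∈O : LinAlg.InO 𝔽 m c g)
                  (W : ℕ → LinAlg.Subspace 𝔽 m) (a : ℕ → ℕ) (decomposition : LinAlg.OrthJordanDecomp 𝔽 m c g W a) where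
  open Orbits 𝔽 two≢0 m c nondegenerate g g∈O public

  -- A linear relation Σ dₖ N^k x = 0 with lowest nonzero coefficient dⱼ reads N^j (x + N r) = 0.
  lowest-term : ∀ n l x (d : Fin n → F) → (∃ λ k → d k ≢ 0#) →
    pow N l $ ΣV[ n ] (λ k → d k • (pow N (toℕ k) $ x)) ≈ 0V →
    ∃ λ j → ∃ λ r → j ℕ.< l ℕ.+ n × pow N j $ (x ⊕ (N $ r)) ≈ 0V
  lowest-term (suc n) l x d d≢0 e with d fzero ≟ 0#
  ... | no d₀≢0 = l , d₀⁻¹ • s , ℕₚ.m<m+n l (ℕ.s≤s ℕ.z≤n) , λ i → *-cancelˡ d₀≢0 (trans
      (trans (sym (scale (pow N l) (d fzero) (x ⊕ (N $ (d₀⁻¹ • s))) i)) (resp (pow N l) factor i)) (trans (e i) (sym (*-zeroʳ (d fzero)))))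
    where
    d₀⁻¹ = d fzero ⁻¹[ d₀≢0 ]
    s = ΣV[ n ] (λ k → d (fsuc k) • (pow N (toℕ k) $ x))
    N-s : N $ s ≈ ΣV[ n ] (λ k → d (fsuc k) • (pow N (suc (toℕ k)) $ x))
    N-s = ≈-trans (Operator.sum N n (λ k → d (fsuc k) • (pow N (toℕ k) $ x))) (ΣV-cong n (λ k → scale N (d (fsuc k)) (pow N (toℕ k) $ x)))
    factor : d fzero • (x ⊕ (N $ (d₀⁻¹ • s))) ≈ ΣV[ suc n ] (λ k → d k • (pow N (toℕ k) $ x))
    factor i = begin
      d fzero * (x i + (N $ (d₀⁻¹ • s)) i)             ≡⟨ cong (λ y → d fzero * (x i + y)) (scale N d₀⁻¹ s i) ⟩
      d fzero * (x i + d₀⁻¹ * (N $ s) i)               ≡⟨ solve 4 (λ d d⁻¹ x y → d :* (x :+ d⁻¹ :* y) := d :* x :+ d :* d⁻¹ :* y) refl (d fzero) d₀⁻¹ (x i) ((N $ s) i) ⟩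
      d fzero * x i + d fzero * d₀⁻¹ * (N $ s) i       ≡⟨ cong₂ (λ y z → d fzero * x i + y * z) (*-inverse (d fzero) d₀≢0) (N-s i) ⟩
      d fzero * x i + 1# * ΣV[ n ] (λ k → d (fsuc k) • (pow N (suc (toℕ k)) $ x)) i ≡⟨ solve 2 (λ a b → a :+ :1 :* b := a :+ b) refl (d fzero * x i) _ ⟩
      ΣV[ suc n ] (λ k → d k • (pow N (toℕ k) $ x)) i ∎
      where open ≡-Reasoning
  lowest-term (suc n) l x d (fzero , p) e | yes d₀≡0 = ⊥-elim (p d₀≡0)
  lowest-term (suc n) l x d (fsuc k , p) e | yes d₀≡0 with lowest-term n (suc l) x (d ∘ fsuc) (k , p) (≈-trans (pow-suc N l s) (≈-trans (resp (pow N l) drop) e))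
    where
    s = ΣV[ n ] (λ k → d (fsuc k) • (pow N (toℕ k) $ x))
    drop : N $ s ≈ ΣV[ suc n ] (λ k → d k • (pow N (toℕ k) $ x))
    drop i = trans (≈-trans (Operator.sum N n (λ k → d (fsuc k) • (pow N (toℕ k) $ x))) (ΣV-cong n (λ k → scale N (d (fsuc k)) (pow N (toℕ k) $ x))) i)
      (trans (solve 2 (λ x y → y := :0 :* x :+ y) refl (x i) _) (cong (λ y → y * x i + ΣV[ n ] (λ k → d (fsuc k) • (pow N (suc (toℕ k)) $ x)) i) (sym d₀≡0)))
  ... | j , r , j< , e′ = j , r , ℕₚ.≤-trans j< (ℕₚ.≤-reflexive (sym (ℕₚ.+-suc l n))) , e′

  -- The m + 1 vectors x, N x, …, N^m x are linearly dependent.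
  fitting : ∀ x → ∃ λ r → InV₁ g (x ⊕ (N $ r))
  fitting x with underdetermined (ℕₚ.n<1+n m) (λ i (k : Fin (suc m)) → (pow N (toℕ k) $ x) i)
  ... | d , d≢0 , e with lowest-term (suc m) 0 x d d≢0
          (λ i → trans (Σ-cong (suc m) (λ k → solve 2 (λ a b → a :* b := b :* a) refl (d k) ((pow N (toℕ k) $ x) i))) (e i))
  -- The relation has m + 1 coefficients, so j is at most m and x + N r is killed by N^m: modulo N V
  -- every vector comes from V₁.
  ... | j , r , ℕ.s≤s j≤m , e′ = r , ≈-trans (Npow≈pow m (x ⊕ (N $ r))) (pow-vanish N j≤m e′)

  module Block (k : Fin m) where
    κ = toℕ k
    W′ = W (sz k)
    subspace = proj₁ decomposition k
    jordan = proj₁ (proj₂ (proj₂ decomposition)) k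

    size : ℕ
    size = a (sz k)

    x : Fin size → V
    x = proj₁ jordan

    W-resp : ∀ {u v} → u ≈ v → W′ u → W′ v
    W-resp {u} {v} = proj₁ subspace u v

    W-⊕ : ∀ {u v} → W′ u → W′ v → W′ (u ⊕ v)
    W-⊕ {u} {v} = proj₁ (proj₂ (proj₂ subspace)) u v

    W-• : ∀ s {u} → W′ u → W′ (s • u)
    W-• s {u} = proj₂ (proj₂ (proj₂ subspace)) s u

    W-N : ∀ {u} → W′ u → W′ (N $ u)
    W-N {u} p = W-resp (λ i → solve 2 (λ a b → a :+ :- :1 :* b := a :+ :- b) refl ((G $ u) i) (u i))
      (W-⊕ (proj₁ (proj₂ decomposition) k u p) (W-• (- 1#) p))

    W-pow : ∀ j {u} → W′ u → W′ (pow N j $ u)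
    W-pow zero    p = p
    W-pow (suc j) p = W-N (W-pow j p)

    W-ΣV : ∀ n {f : Fin n → V} → (∀ j → W′ (f j)) → W′ (ΣV[ n ] f)
    W-ΣV zero    p = proj₁ (proj₂ subspace)
    W-ΣV (suc n) p = W-⊕ (p fzero) (W-ΣV n (p ∘ fsuc))

    x∈W : ∀ j → W′ (x j)
    x∈W = proj₁ (proj₂ jordan)

    Ker-ΣV : ∀ n {f : Fin n → V} → (∀ j → Ker κ (f j)) → Ker κ (ΣV[ n ] f)
    Ker-ΣV n {f} p = ≈-trans (Operator.sum (pow N (suc κ)) n f) (ΣV-zero n p)

    x∈Ker : ∀ j → Ker κ (x j)
    x∈Ker j = ≈-trans (≈-sym (Npow≈pow (suc κ) (x j))) (proj₁ (proj₂ (proj₂ jordan)) j)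

    -- The combinations of the tops of the Jordan chains, which represent W/NW.
    lead : (Fin size → F) → V
    lead d = ΣV[ size ] (λ j → d j • x j)

    lead∈W : ∀ d → W′ (lead d)
    lead∈W d = W-ΣV size (λ j → W-• (d j) (x∈W j))

    lead∈Ker : ∀ d → Ker κ (lead d)
    lead∈Ker d = Ker-ΣV size (λ j → Ker-• κ (d j) (x∈Ker j))

    lead-zero : ∀ {d} → (∀ j → d j ≡ 0#) → lead d ≈ 0V
    lead-zero e = ΣV-zero size (λ j i → trans (cong (_* x j i) (e j)) (solve 1 (λ a → :0 :* a := :0) refl (x j i)))

    opaque
      -- The terms with a positive power of N are collected into N r. That r stays in W matters for
      -- the sign, whose condition concerns N W and not N V.
      lead-decomposition : ∀ {w} → W′ w → ∃ λ d → ∃ λ r → W′ r × w ⊖ lead d ≈ N $ r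
      lead-decomposition {w} p with proj₂ (proj₂ (proj₂ (proj₂ jordan))) w p
      ... | e , w≈ = (λ j → e j fzero) , ΣV[ size ] r ,
        W-ΣV size (λ j → W-ΣV κ (λ l → W-• (e j (fsuc l)) (W-resp (≈-sym (Npow≈pow (toℕ l) (x j))) (W-pow (toℕ l) (x∈W j))))) ,
        ≈-trans (⊖-cong w≈ (≈-refl {lead (λ j → e j fzero)}))
          (≈-trans (ΣV-⊖ size (λ j → ΣV[ suc κ ] (λ l → e j l • Npow g (toℕ l) (x j))) (λ j → e j fzero • x j))
          (≈-trans (ΣV-cong size (λ j → ≈-trans
              (λ i → solve 2 (λ a b → a :+ b :+ :- a := b) refl (e j fzero * x j i) (ΣV[ κ ] (λ l → e j (fsuc l) • Npow g (suc (toℕ l)) (x j)) i))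
              (≈-sym (≈-trans (Operator.sum N κ (λ l → e j (fsuc l) • Npow g (toℕ l) (x j))) (ΣV-cong κ (λ l → scale N (e j (fsuc l)) (Npow g (toℕ l) (x j))))))))
            (≈-sym (Operator.sum N size r))))
        where
        r : Fin size → V
        r j = ΣV[ κ ] (λ l → e j (fsuc l) • Npow g (toℕ l) (x j))

    W⇒Ker : ∀ {w} → W′ w → Ker κ w
    W⇒Ker {w} p with proj₂ (proj₂ (proj₂ (proj₂ jordan))) w p
    ... | e , w≈ = ≈-trans (resp (pow N (suc κ)) w≈) (Ker-ΣV size (λ j → Ker-ΣV′ j))
      where
      Ker-ΣV′ : ∀ j → Ker κ (ΣV[ suc κ ] (λ l → e j l • Npow g (toℕ l) (x j)))
      Ker-ΣV′ j = Ker-ΣV (suc κ) (λ l → Ker-• κ (e j l) (≈-trans (resp (pow N (suc κ)) (Npow≈pow (toℕ l) (x j)))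
        (≈-trans (pow-commute N (pow N (toℕ l)) (λ u → pow-suc N (toℕ l) u) (suc κ) (x j)) (resp-0 (pow N (toℕ l)) (x∈Ker j)))))

    top-independent : ∀ d → pow N κ $ lead d ≈ 0V → ∀ j → d j ≡ 0#
    top-independent d e j = trans (trans (solve 1 (λ a → a := a :* :1) refl (d j)) (cong (d j *_) (sym (δ-diag (fromℕ κ)))))
      -- Independence of the Jordan basis is applied to coefficients that sit in the top power κ and
      -- vanish elsewhere.
      (proj₁ (proj₂ (proj₂ (proj₂ jordan))) (λ j l → d j * δ (fromℕ κ) l) vanish j (fromℕ κ))
      where
      vanish : ΣV[ size ] (λ j → ΣV[ suc κ ] (λ l → (d j * δ (fromℕ κ) l) • Npow g (toℕ l) (x j))) ≈ 0V
      vanish = begin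
        ΣV[ size ] (λ j → ΣV[ suc κ ] (λ l → (d j * δ (fromℕ κ) l) • Npow g (toℕ l) (x j)))
          ≈⟨ ΣV-cong size (λ j → ≈-trans
               (ΣV-single (suc κ) (λ l → (d j * δ (fromℕ κ) l) • Npow g (toℕ l) (x j)) (fromℕ κ)
                 (λ l l≢ i → trans (cong (λ y → d j * y * Npow g (toℕ l) (x j) i) (δ-off (l≢ ∘ sym)))
                    (solve 2 (λ a b → a :* :0 :* b := :0) refl (d j) (Npow g (toℕ l) (x j) i))))
               (•-cong (trans (cong (d j *_) (δ-diag (fromℕ κ))) (solve 1 (λ a → a :* :1 := a) refl (d j)))
                 (≈-trans (λ i → cong (λ n → Npow g n (x j) i) (Finₚ.toℕ-fromℕ κ)) (Npow≈pow κ (x j))))) ⟩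
        ΣV[ size ] (λ j → d j • (pow N κ $ x j))
          ≈⟨ ΣV-cong size (λ j → ≈-sym (scale (pow N κ) (d j) (x j))) ⟩
        ΣV[ size ] (λ j → pow N κ $ (d j • x j))
          ≈⟨ ≈-sym (Operator.sum (pow N κ) size (λ j → d j • x j)) ⟩
        pow N κ $ lead d ≈⟨ e ⟩
        0V ∎
        where open ≈-Reasoning

    -- The counterpart of `β-InN` with the image of N in the first argument: transposing that N
    -- yields N^(κ+1) u up to sign and g⁻¹.
    β-N : ∀ r {u} → Ker κ u → β κ (N $ r) u ≡ 0#
    β-N r {u} e = trans (adjoint r (pow N κ $ u)) (B-0ʳ r (≈-trans (M≈-G⁻N (pow N κ $ u))
      (≈-trans (•-congˡ (- 1#) (resp-0 G⁻ e)) (λ _ → *-zeroʳ _))))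

    -- Nondegeneracy of B gives some v pairing with N^κ of the head. Changing v modulo N V into V₁,
    -- dropping the components in the other orthogonal blocks and reducing the remaining one modulo
    -- N W to its head all preserve the pairing.
    lead-pairing : ∀ d → (∃ λ j → d j ≢ 0#) → ∃ λ e → β κ (lead e) (lead d) ≢ 0#
    lead-pairing d (j , dⱼ≢0) with nonzero-pairing nondegenerate {pow N κ $ lead d} (λ e → dⱼ≢0 (top-independent d e j))
    ... | v , vw≢0 with fitting v
    ... | r , v₁ with proj₁ (proj₂ (proj₂ (proj₂ (proj₂ (proj₂ decomposition))))) (v ⊕ (N $ r)) v₁
    ... | w , w∈W , v₁≈ with lead-decomposition (w∈W k)
    ... | e , s , _ , wₖ-e = e , λ z → vw≢0 (begin
      B v y                               ≡⟨ solve 1 (λ a → a := a :+ :0) refl (B v y) ⟩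
      B v y + 0#                          ≡⟨ cong (B v y +_) (sym (β-N r (lead∈Ker d))) ⟩
      B v y + B (N $ r) y                 ≡⟨ sym (B-addˡ v (N $ r) y) ⟩
      B (v ⊕ (N $ r)) y                   ≡⟨ B-congˡ y v₁≈ ⟩
      B (ΣV[ m ] w) y                     ≡⟨ B-sym _ _ ⟩
      B y (ΣV[ m ] w)                     ≡⟨ B-Σʳ y m w ⟩
      Σ[ m ] (λ l → B y (w l))            ≡⟨ Σ-single m (λ l → B y (w l)) k (λ l l≢k → trans (B≡Bf y (w l))
                                               (proj₁ (proj₂ (proj₂ (proj₂ decomposition))) k l (l≢k ∘ Finₚ.toℕ-injective ∘ sym) y (w l) (W-pow κ (lead∈W d)) (w∈W l))) ⟩
      B y (w k)                           ≡⟨ B-sym y (w k) ⟩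
      B (w k) y                           ≡⟨ solve 2 (λ a b → a := b :+ (a :+ :- b)) refl (B (w k) y) (B (lead e) y) ⟩
      B (lead e) y + (B (w k) y + - B (lead e) y) ≡⟨ cong₂ _+_ z (trans (sym (B-subˡ (w k) (lead e) y)) (trans (B-congˡ y wₖ-e) (β-N s (lead∈Ker d)))) ⟩
      0# + 0#                             ≡⟨ solve 0 (:0 :+ :0 := :0) refl ⟩
      0# ∎)
      where
      open ≡-Reasoning
      y = pow N κ $ lead d

    form : (Fin size → F) → (Fin size → F) → F
    form d e = β κ (lead d) (lead e)

  open Block using (lead; form)

  -- The type of Σ uₗ is read off its component in the largest block size with nonzero coordinates.
  sum-type : (d : ∀ l → Fin (a (sz l)) → F) (k : Fin m) → (∃ λ j → d k j ≢ 0#) →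
             (∀ l → toℕ k ℕ.< toℕ l → ∀ j → d l j ≡ 0#) →
             HasType (ΣV[ m ] (λ l → lead l (d l))) (toℕ k) (form k (d k) (d k))
  sum-type d k dₖ≢0 later = u , InN-0 (λ i → solve 1 (λ a → a :+ :- a := :0) refl (u i)) , u∈Ker ,
    (lead k e , Bk.lead∈Ker e , λ z → eu≢0 (trans (sym (B-congʳ (lead k e) top)) z)) , (begin
      β κ u u                        ≡⟨ B-congʳ u top ⟩
      β κ u uₖ                       ≡⟨ β-sym κ uₖ u∈Ker ⟩
      σ κ * β κ uₖ u                 ≡⟨ cong (σ κ *_) (B-congʳ uₖ top) ⟩
      σ κ * β κ uₖ uₖ                ≡⟨ sym (β-sym κ uₖ (Bk.lead∈Ker (d k))) ⟩
      β κ uₖ uₖ ∎)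
    where
    open ≡-Reasoning
    module Bk = Block k
    κ = toℕ k
    u = ΣV[ m ] (λ l → lead l (d l))
    uₖ = lead k (d k)
    e = proj₁ (Bk.lead-pairing (d k) dₖ≢0)
    eu≢0 = proj₂ (Bk.lead-pairing (d k) dₖ≢0)
    killed : ∀ j l → suc (toℕ l) ℕ.≤ j ⊎ κ ℕ.< toℕ l → pow N j $ lead l (d l) ≈ 0V
    killed j l (inj₁ l<j) = pow-vanish N l<j (Block.lead∈Ker l (d l))
    killed j l (inj₂ k<l) = resp-0 (pow N j) (Block.lead-zero l (later l k<l))
    u∈Ker : Ker κ u
    u∈Ker = ≈-trans (Operator.sum (pow N (suc κ)) m (λ l → lead l (d l))) (ΣV-zero m (λ l → killed (suc κ) l (split l)))
      where
      split : ∀ l → suc (toℕ l) ℕ.≤ suc κ ⊎ κ ℕ.< toℕ l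
      split l with toℕ l ℕ.≤? κ
      ... | yes l≤κ = inj₁ (ℕ.s≤s l≤κ)
      ... | no  l≰κ = inj₂ (ℕₚ.≰⇒> l≰κ)
    top : pow N κ $ u ≈ pow N κ $ uₖ
    top = ≈-trans (Operator.sum (pow N κ) m (λ l → lead l (d l)))
      (ΣV-single m (λ l → pow N κ $ lead l (d l)) k (λ l l≢k → killed κ l (split l l≢k)))
      where
      split : ∀ l → l ≢ k → suc (toℕ l) ℕ.≤ κ ⊎ κ ℕ.< toℕ l
      split l l≢k with ℕₚ.<-cmp (toℕ l) κ
      ... | tri< l<κ _ _ = inj₁ l<κ
      ... | tri≈ _ l≡κ _ = ⊥-elim (l≢k (Finₚ.toℕ-injective l≡κ))
      ... | tri> _ _ κ<l = inj₂ κ<l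

  HasType-resp : ∀ {x y k s} → InN (x ⊖ y) → HasType y k s → HasType x k s
  HasType-resp p (u , y-u , rest) = u , InN-chain p y-u , rest

  lead-type : ∀ k d → (∃ λ j → d j ≢ 0#) → HasType (lead k d) (toℕ k) (form k d d)
  lead-type k d (j , dⱼ≢0) = lead k d , InN-0 (λ i → solve 1 (λ a → a :+ :- a := :0) refl (lead k d i)) , Block.lead∈Ker k d ,
    (lead k (proj₁ p) , Block.lead∈Ker k (proj₁ p) , proj₂ p) , refl
    where p = Block.lead-pairing k d (j , dⱼ≢0)

  normal-form : ∀ x → InN x ⊎ (∃ λ k → ∃ λ d → (∃ λ j → d j ≢ 0#) × HasType x (toℕ k) (form k d d))
  normal-form x with fitting x
  ... | r , v₁ with proj₁ (proj₂ (proj₂ (proj₂ (proj₂ (proj₂ decomposition))))) (x ⊕ (N $ r)) v₁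
  ... | w , w∈W , v₁≈ = conclude (last-or-all m (λ l → nonzero-entry (a (sz l)) (d l)))
    where
    d : ∀ l → Fin (a (sz l)) → F
    d l = proj₁ (Block.lead-decomposition l (w∈W l))
    s : Fin m → V
    s l = proj₁ (proj₂ (Block.lead-decomposition l (w∈W l)))
    u = ΣV[ m ] (λ l → lead l (d l))
    x-u : InN (x ⊖ u)
    x-u = InN-resp (λ i → trans (cong (_+ - 1# * (N $ r) i) (trans (cong (_+ - u i) (sym (v₁≈ i))) refl))
             (solve 3 (λ x n u → x :+ n :+ :- u :+ :- :1 :* n := x :+ :- u) refl (x i) ((N $ r) i) (u i)))
      (InN-⊕ (ΣV[ m ] s , ≈-trans (ΣV-⊖ m w (λ l → lead l (d l)))
                (≈-trans (ΣV-cong m (λ l → proj₂ (proj₂ (proj₂ (Block.lead-decomposition l (w∈W l)))))) (≈-sym (Operator.sum N m s))))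
             (InN-• (- 1#) (r , ≈-refl {N $ r})))
    conclude : (∀ l j → d l j ≡ 0#) ⊎ (∃ λ k → (∃ λ j → d k j ≢ 0#) × (∀ l → toℕ k ℕ.< toℕ l → ∀ j → d l j ≡ 0#)) →
      InN x ⊎ (∃ λ k → ∃ λ d → (∃ λ j → d j ≢ 0#) × HasType x (toℕ k) (form k d d))
    conclude (inj₁ all) = inj₁ (InN-resp (λ i → solve 2 (λ x u → x :+ :- u :+ u := x) refl (x i) (u i))
      (InN-⊕ x-u (InN-0 (ΣV-zero m (λ l → Block.lead-zero l (all l))))))
    conclude (inj₂ (k , dₖ≢0 , later)) = inj₂ (k , d k , dₖ≢0 , HasType-resp {x} {u} {toℕ k} x-u (sum-type d k dₖ≢0 later))

-- Counting the invariants and choosing representatives.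

module Enumeration (𝔽 : FiniteField) (odd : FiniteField.order 𝔽 ℕ.% 2 ≡ 1) (m : ℕ)
                   (c : LinAlg.QForm 𝔽 m) (nondegenerate : LinAlg.Nondegenerate 𝔽 m c)
                   (g : LinAlg.Mat 𝔽 m) (g∈O : LinAlg.InO 𝔽 m c g)
                   (W : ℕ → LinAlg.Subspace 𝔽 m) (a : ℕ → ℕ) (decomposition : LinAlg.OrthJordanDecomp 𝔽 m c g W a)
                   (f : ℕ → ℕ)
                   (f-spec : ∀ i → 1 ℕ.≤ i → i ℕ.≤ m → isOdd i ≡ true → a i ≢ 0 → LinAlg.FSpec 𝔽 m c g (W i) (a i) i (f i)) where
  open OddField 𝔽 m odd
  open NormalForm 𝔽 two≢0 m c nondegenerate g g∈O W a decomposition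
  open Block using (lead; form)

  block-form : ∀ k → σ (toℕ k) ≡ 1# → SymmetricForm (a (sz k))
  block-form k σ≡1 = record
    { form          = form k
    ; coefficients  = λ d j → β κ (lead k d) (x j)
    ; expand        = λ d e → begin
        B (lead k d) (pow N κ $ ΣV[ size ] (λ j → e j • x j))
          ≡⟨ B-congʳ (lead k d) (≈-trans (Operator.sum (pow N κ) size (λ j → e j • x j)) (ΣV-cong size (λ j → scale (pow N κ) (e j) (x j)))) ⟩
        B (lead k d) (ΣV[ size ] (λ j → e j • (pow N κ $ x j)))
          ≡⟨ B-Σʳ (lead k d) size (λ j → e j • (pow N κ $ x j)) ⟩
        Σ[ size ] (λ j → B (lead k d) (e j • (pow N κ $ x j)))
          ≡⟨ Σ-cong size (λ j → trans (B-scaleʳ (e j) (lead k d) (pow N κ $ x j)) (solve 2 (λ s b → s :* b := b :* s) refl (e j) (β κ (lead k d) (x j)))) ⟩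
        Σ[ size ] (λ j → β κ (lead k d) (x j) * e j) ∎
    ; symmetric     = λ d e → β-symmetric κ σ≡1 (lead k e) (lead∈Ker d)
    ; nondegenerate = lead-pairing }
    where
    open Block k hiding (lead; form)
    open ≡-Reasoning

  isotropic⇒SignPlus : ∀ k (σ≡1 : σ (toℕ k) ≡ 1#) → FormValues.Isotropic (block-form k σ≡1) → SignPlus c g (W (sz k)) (sz k)
  isotropic⇒SignPlus k σ≡1 (d , d≢0 , q≡0) = lead k d , lead∈W d ,
    (λ (w , _ , e) → let (z , zd≢0) = lead-pairing d d≢0 in zd≢0 (β-InN κ (lead∈Ker z) (w , e))) ,
    trans (sym (B≡Bf (lead k d) _)) (trans (B-congʳ (lead k d) (Npow≈pow κ (lead k d))) q≡0)
    where open Block k hiding (lead; form)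

  not-all-zero : ∀ {n} {d : Fin n → F} → ¬ (∀ j → d j ≡ 0#) → NonzeroVector d
  not-all-zero {n} {d} ¬z with nonzero-entry n d
  ... | inj₁ p = p
  ... | inj₂ z = ⊥-elim (¬z z)

  -- The isotropic y may be replaced by its head, from which it differs by an element of N W; this
  -- head has nonzero coordinates, as otherwise y would lie in N W.
  SignPlus⇒isotropic : ∀ k (σ≡1 : σ (toℕ k) ≡ 1#) → SignPlus c g (W (sz k)) (sz k) → FormValues.Isotropic (block-form k σ≡1)
  SignPlus⇒isotropic k σ≡1 (y , y∈W , y∉NW , By≡0) = d , d≢0 , (begin
      β κ u u    ≡⟨ x-y≡0⇒x≡y (trans (sym (β-subʳ κ u u y)) (β-InN κ (lead∈Ker d) (InN-flip (r , e)))) ⟩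
      β κ u y    ≡⟨ sym (x-y≡0⇒x≡y (trans (sym (β-subˡ κ y u y)) (trans (B-congˡ (pow N κ $ y) e) (β-N r (W⇒Ker y∈W))))) ⟩
      β κ y y    ≡⟨ trans (B-congʳ y (≈-sym (Npow≈pow κ y))) (B≡Bf y (Npow g κ y)) ⟩
      Bf c y (Npow g κ y) ≡⟨ By≡0 ⟩
      0# ∎)
    where
    open Block k hiding (lead; form)
    open ≡-Reasoning
    d : Fin size → F
    d = proj₁ (lead-decomposition y∈W)
    r : V
    r = proj₁ (proj₂ (lead-decomposition y∈W))
    u : V
    u = lead k d
    e : y ⊖ u ≈ N $ r
    e = proj₂ (proj₂ (proj₂ (lead-decomposition y∈W)))
    d≢0 : NonzeroVector d
    d≢0 = not-all-zero (λ z → y∉NW (r , proj₁ (proj₂ (proj₂ (lead-decomposition y∈W))) ,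
        λ i → trans (sym (trans (cong (λ s → y i + - s) (lead-zero {d} z i)) (solve 1 (λ y → y :+ :- :0 := y) refl (y i)))) (e i)))

  Parity : ℕ → Set
  Parity k = (isOdd (suc k) ≡ true × isEven (suc k) ≡ false × σ k ≡ 1#)
           ⊎ (isOdd (suc k) ≡ false × isEven (suc k) ≡ true × σ k ≡ - 1#)

  parity : ∀ k → Parity k
  parity 0 = inj₁ (refl , refl , refl)
  parity 1 = inj₂ (refl , refl , refl)
  parity (suc (suc k)) with parity k
  ... | inj₁ (o , e , s) = inj₁ (o , e , trans (solve 1 (λ x → :- :- x := x) refl (σ k)) s)
  ... | inj₂ (o , e , s) = inj₂ (o , e , trans (solve 1 (λ x → :- :- x := x) refl (σ k)) s)

  evenTerm oddTerm : ℕ → ℕ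
  evenTerm i = if isEven i ∧ nonzero (a i) then 1 else 0
  oddTerm  i = if isOdd i ∧ nonzero (a i) then f i else 0

  nonzero-true : ∀ {n} → n ≢ 0 → nonzero n ≡ true
  nonzero-true {zero}  n≢0 = ⊥-elim (n≢0 refl)
  nonzero-true {suc n} _   = refl

  -- By parity one of the two terms vanishes; keeping their sum lets even and odd sizes share one
  -- induction.
  BlockValues : Fin m → Set
  BlockValues k = ∃ λ vs → length vs ≡ evenTerm (sz k) ℕ.+ oddTerm (sz k) × Unique vs
    × (∀ {γ} → γ ∈ vs → ∃ λ d → NonzeroVector d × form k d d ≡ γ) × (∀ d → NonzeroVector d → form k d d ∈ vs)

  empty-block : ∀ k → a (sz k) ≡ 0 → BlockValues k
  empty-block k a≡0 = [] , sym (cong₂ ℕ._+_ (no-term (isEven (sz k)) 1) (no-term (isOdd (sz k)) (f (sz k)))) , [] , (λ ())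
                    , λ _ (j , _) → ⊥-elim (Finₚ.¬Fin0 (subst Fin a≡0 j))
    where
    no-term : ∀ b n → (if b ∧ nonzero (a (sz k)) then n else 0) ≡ 0
    no-term true  n = cong (λ l → if nonzero l then n else 0) a≡0
    no-term false n = refl

  -- The form is alternating, so every nonzero head has value zero and the block size contributes
  -- exactly one invariant.
  even-block : ∀ k → a (sz k) ≢ 0 → isOdd (sz k) ≡ false → isEven (sz k) ≡ true → σ (toℕ k) ≡ - 1# → BlockValues k
  even-block k a≢0 o e σ≡-1 = 0# ∷ []
      , sym (cong₂ ℕ._+_ (cong₂ (λ b b′ → if b ∧ b′ then 1 else 0) e (nonzero-true a≢0))
                         (cong (λ b → if b ∧ nonzero (a (sz k)) then f (sz k) else 0) o))
      , [] ∷ []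
      , (λ { (here refl) → (λ _ → 1#) , (fromℕ< (ℕₚ.n≢0⇒n>0 a≢0) , 0≢1 ∘ sym) , vanish (λ _ → 1#) })
      , λ d _ → here (vanish d)
    where
    vanish : ∀ d → form k d d ≡ 0#
    vanish d = β-alternating (toℕ k) σ≡-1 (Block.lead∈Ker k d)

  odd-block : ∀ k → a (sz k) ≢ 0 → isOdd (sz k) ≡ true → isEven (sz k) ≡ false → σ (toℕ k) ≡ 1# → BlockValues k
  odd-block k a≢0 o e σ≡1 = proj₁ values , trans (proj₁ (proj₂ values)) terms , proj₂ (proj₂ values)
    where
    spec : FSpec c g (W (sz k)) (a (sz k)) (sz k) (f (sz k))
    spec = f-spec (sz k) (ℕ.s≤s ℕ.z≤n) (Finₚ.toℕ<n k) o a≢0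
    values : FormValues.ValueList (block-form k σ≡1) (f (sz k))
    values = odd-values (a (sz k)) (block-form k σ≡1) a≢0 (f (sz k))
      (proj₁ spec) (λ a≡2 iso → proj₁ (proj₂ spec) a≡2 (isotropic⇒SignPlus k σ≡1 iso))
      (λ a≡2 aniso → proj₁ (proj₂ (proj₂ spec)) a≡2 (aniso ∘ SignPlus⇒isotropic k σ≡1)) (proj₂ (proj₂ (proj₂ spec)))
    terms : f (sz k) ≡ evenTerm (sz k) ℕ.+ oddTerm (sz k)
    terms = sym (cong₂ ℕ._+_ (cong (λ b → if b ∧ nonzero (a (sz k)) then 1 else 0) e)
                             (cong₂ (λ b b′ → if b ∧ b′ then f (sz k) else 0) o (nonzero-true a≢0)))

  opaque
    block-values : ∀ k → BlockValues k
    block-values k = cases (a (sz k) ℕ.≟ 0) (parity (toℕ k))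
      where
      cases : Dec (a (sz k) ≡ 0) → Parity (toℕ k) → BlockValues k
      cases (yes a≡0) _                 = empty-block k a≡0
      cases (no a≢0) (inj₁ (o , e , s)) = odd-block k a≢0 o e s
      cases (no a≢0) (inj₂ (o , e , s)) = even-block k a≢0 o e s

  -- The recursion on n follows the two sums of the statement; the bound k < n in the soundness
  -- clause keeps the invariants of the next block size disjoint from those already listed.
  Types : ℕ → Set
  Types n = ∃ λ (τs : List (ℕ × F)) → length τs ≡ evenCount a n ℕ.+ oddSum a f n × Unique τs
    × (∀ {k γ} → (k , γ) ∈ τs → k ℕ.< n × (∃ λ y → HasType y k γ))
    × (∀ k d → toℕ k ℕ.< n → NonzeroVector d → (toℕ k , form k d d) ∈ τs)

  extend-types : ∀ {n} (n<m : n ℕ.< m) → Types n → BlockValues (fromℕ< n<m) → Types (suc n)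
  extend-types {n} n<m (τs , len , u , sound , cover) (vs , len′ , u′ , attained , cover′) =
      τs ++ map (κ ,_) vs
      , (begin
          length (τs ++ map (κ ,_) vs)                 ≡⟨ trans (Listₚ.length-++ τs) (cong (length τs ℕ.+_) (Listₚ.length-map (κ ,_) vs)) ⟩
          length τs ℕ.+ length vs                      ≡⟨ cong₂ ℕ._+_ len (trans len′ (cong (λ l → evenTerm (suc l) ℕ.+ oddTerm (suc l)) κ≡n)) ⟩
          (evenCount a n ℕ.+ oddSum a f n) ℕ.+ (evenTerm (suc n) ℕ.+ oddTerm (suc n))
            ≡⟨ interchange (evenCount a n) (oddSum a f n) (evenTerm (suc n)) (oddTerm (suc n)) ⟩
          evenCount a (suc n) ℕ.+ oddSum a f (suc n) ∎)
      , Uniqueₚ.++⁺ u (Uniqueₚ.map⁺ (λ { refl → refl }) u′) (λ (p , p′) → disjoint p (∈-map⁻ (κ ,_) p′))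
      , (λ p → sound′ (∈-++⁻ τs p))
      , cover″
    where
    open ≡-Reasoning
    k′ = fromℕ< n<m
    κ = toℕ k′
    κ≡n : κ ≡ n
    κ≡n = Finₚ.toℕ-fromℕ< n<m
    interchange : ∀ w x y z → (w ℕ.+ x) ℕ.+ (y ℕ.+ z) ≡ (w ℕ.+ y) ℕ.+ (x ℕ.+ z)
    interchange w x y z = trans (ℕₚ.+-assoc w x (y ℕ.+ z)) (trans (cong (w ℕ.+_) (trans (sym (ℕₚ.+-assoc x y z))
      (trans (cong (ℕ._+ z) (ℕₚ.+-comm x y)) (ℕₚ.+-assoc y x z)))) (sym (ℕₚ.+-assoc w y (x ℕ.+ z))))
    disjoint : ∀ {l γ} → (l , γ) ∈ τs → (∃ λ γ′ → γ′ ∈ vs × (l , γ) ≡ (κ , γ′)) → ⊥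
    disjoint p (_ , _ , refl) = ℕₚ.<-irrefl κ≡n (proj₁ (sound p))
    sound′ : ∀ {l γ} → (l , γ) ∈ τs ⊎ (l , γ) ∈ map (κ ,_) vs → l ℕ.< suc n × (∃ λ y → HasType y l γ)
    sound′ (inj₁ p) = ℕₚ.m<n⇒m<1+n (proj₁ (sound p)) , proj₂ (sound p)
    sound′ (inj₂ p) with ∈-map⁻ (κ ,_) p
    ... | γ , γ∈ , refl with attained γ∈
    ... | d , d≢0 , refl = ℕ.s≤s (ℕₚ.≤-reflexive κ≡n) , lead k′ d , lead-type k′ d d≢0
    cover″ : ∀ k d → toℕ k ℕ.< suc n → NonzeroVector d → (toℕ k , form k d d) ∈ τs ++ map (κ ,_) vs
    cover″ k d (ℕ.s≤s k≤n) d≢0 with ℕₚ.m≤n⇒m<n∨m≡n k≤n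
    ... | inj₁ k<n = ∈-++⁺ˡ (cover k d k<n d≢0)
    ... | inj₂ k≡n with Finₚ.toℕ-injective (trans k≡n (sym κ≡n))
    ... | refl = ∈-++⁺ʳ τs (∈-map⁺ (κ ,_) (cover′ d d≢0))

  types : ∀ n → n ℕ.≤ m → Types n
  types zero    _   = [] , refl , [] , (λ ()) , λ _ _ ()
  types (suc n) n<m = extend-types n<m (types n (ℕₚ.<⇒≤ n<m)) (block-values (fromℕ< n<m))

  Representatives : List (ℕ × F) → Set
  Representatives τs = ∃ λ ys → length ys ≡ length τs × AllPairs (λ x y → ¬ SameOrbit c g x y) ys
    × All (λ y → ∃ λ τ → τ ∈ τs × HasType y (proj₁ τ) (proj₂ τ)) ys
    × (∀ {k γ} → (k , γ) ∈ τs → Any (λ y → HasType y k γ) ys)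

  add-representative : ∀ {k γ τs} → All ((k , γ) ≢_) τs → (∃ λ y → HasType y k γ) → Representatives τs → Representatives ((k , γ) ∷ τs)
  add-representative {k} {γ} {τs} τ∉ (y , y-type) (ys , len , distinct , sound , cover) = y ∷ ys , cong suc len
      , All.map new sound ∷ distinct
      , ((k , γ) , here refl , y-type) ∷ All.map (λ (τ , τ∈ , t) → τ , there τ∈ , t) sound
      , λ { (here refl) → here y-type ; (there p) → there (cover p) }
    where
    new : ∀ {z} → (∃ λ τ → τ ∈ τs × HasType z (proj₁ τ) (proj₂ τ)) → ¬ SameOrbit c g y z
    new (τ , τ∈ , z-type) same = absurd (HasType-unique {k = k} (HasType-Orbit {k = k} (SameOrbit⇒Orbit same) y-type) z-type)
      where
      absurd : ¬ (k ≡ proj₁ τ × γ ≡ proj₂ τ)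
      absurd (refl , refl) = All.lookup τ∉ τ∈ refl

  representatives : ∀ τs → Unique τs → (∀ {k γ} → (k , γ) ∈ τs → ∃ λ y → HasType y k γ) → Representatives τs
  representatives [] _ _ = [] , refl , [] , [] , λ ()
  representatives (_ ∷ τs) (τ∉ ∷ u) realise =
    add-representative τ∉ (realise (here refl)) (representatives τs u (realise ∘ there))

  count-types : Types m → OrbitCount c g (1 ℕ.+ evenCount a m ℕ.+ oddSum a f m)
  count-types (τs , len , u , sound , cover) = count (representatives τs u (proj₂ ∘ sound))
    where
    count : Representatives τs → OrbitCount c g (1 ℕ.+ evenCount a m ℕ.+ oddSum a f m)
    -- The class of zero, which is N V itself, has no type; it accounts for the summand 1.
    count (ys , len′ , distinct , ys-types , ys-cover) = 0V ∷ ys , cong suc (trans len′ len)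
      , All.map (λ (τ , _ , y-type) same → HasType⇒¬InN {k = proj₁ τ} y-type (InN-Orbit (SameOrbit⇒Orbit same) (InN-0 (≈-refl {0V})))) ys-types ∷ distinct
      , λ x → covered x (normal-form x)
      where
      covered : ∀ x → InN x ⊎ (∃ λ k → ∃ λ d → NonzeroVector d × HasType x (toℕ k) (form k d d)) →
                Any (λ r → SameOrbit c g x r) (0V ∷ ys)
      covered x (inj₁ p) = here (Orbit⇒SameOrbit (InN⇒Orbit p (InN-0 (≈-refl {0V}))))
      covered x (inj₂ (k , d , d≢0 , x-type)) = there (Any.map (λ y-type → Orbit⇒SameOrbit (HasType⇒Orbit {k = toℕ k} x-type y-type))
        (ys-cover (cover k d (Finₚ.toℕ<n k) d≢0)))

open import Data.Nat using (_+_; _≤_)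

theorem6p1 : (𝔽 : FiniteField) → IsOddPrimePower (FiniteField.order 𝔽) →
    (m : ℕ) → 1 ≤ m →
    let open LinAlg 𝔽 m in
    (c : QForm) → Nondegenerate c →
    (g : Mat) → InO c g →
    (W : ℕ → Subspace) (a : ℕ → ℕ) → OrthJordanDecomp c g W a →
    (f : ℕ → ℕ) →
    (∀ i → 1 ≤ i → i ≤ m → isOdd i ≡ true → a i ≢ 0 → FSpec c g (W i) (a i) i (f i)) →
    OrbitCount c g (1 + evenCount a m + oddSum a f m)
theorem6p1 𝔽 (_ , _ , _ , _ , odd) m _ c nondegenerate g g∈O W a decomposition f f-spec =
  count-types (types m ℕₚ.≤-refl)
  where open Enumeration 𝔽 odd m c nondegenerate g g∈O W a decomposition f f-spec
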